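{- Every lattice $2$-zonotope of covering radius greater than $\frac12$ is unimodularly equivalent to one of the following: (1) a parallelogram of lattice-width one, generated by $\{(1,0),(0,k)\}$ for some integer $k\ge1$; (2) a parallelogram $P_{1,k}$ of lattice-width two and area $k$, for some integer $k\ge2$; (3) a hexagon of lattice-width two, with volume vector $(1,1,k)$ for some integer $k\ge1$; (4) the parallelogram $P_{2,5}$ of lattice-width three and volume $5$. In particular, every cosimple zonotope with generators in $\mathbb{Z}^2$ (with any number of generators) has covering radius at most $\frac12$.
   Context: A lattice $2$-zonotope is a two-dimensional zonotope in $\mathbb{R}^2$ that is a lattice translate of $\sum_{i}[\mathbf 0,\mathbf u_i]$ with finitely many generators $\mathbf u_i\in\mathbb{Z}^2$. The covering radius of a convex body $C\subseteq\mathbb{R}^d$ is $\mu(C)=\min\{\rho>0:\rho C+\mathbb{Z}^d=\mathbb{R}^d\}$. The lattice-width of $C$ is the minimum, over $\mathbf z\in\mathbb{Z}^d\setminus\{\mathbf 0\}$, of $\max_{\mathbf x\in C}\mathbf z^\intercal\mathbf x-\min_{\mathbf x\in C}\mathbf z^\intercal\mathbf x$. Lattice polytopes $P,Q\subseteq\mathbb{R}^d$ are unimodularly equivalent if $P=UQ+\mathbf t$ for some $U\in\mathbb{Z}^{d\times d}$ with $|\det U|=1$ and $\mathbf t\in\mathbb{Z}^d$. For integers $p,q$ put $P_{p,q}:=[\mathbf 0,(1,0)]+[\mathbf 0,(p,q)]$. For a hexagon generated by three vectors $\mathbf u_1,\mathbf u_2,\mathbf u_3\in\mathbb{Z}^2$,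 the volume vector is the triple (up to order) of areas $|\det(\mathbf u_i,\mathbf u_j)|$, $i<j$. A finite collection of vectors $\mathbf u_1,\dots,\mathbf u_n\in\mathbb{Z}^d$ that linearly spans $\mathbb{R}^d$ is cosimple if there is a linear dependence $\sum_i\lambda_i\mathbf u_i=\mathbf 0$ whose coefficients are all non-zero and have pairwise different absolute values; a cosimple zonotope is a zonotope $\sum_i[\mathbf 0,\mathbf u_i]$ generated by a cosimple collection. -}

module Defs where

open import Level using (0ℓ)
open import Algebra.Bundles using (CommutativeRing)
open import Algebra.Core using (Op₁; Op₂)
open import Algebra.Module.Bundles using (Module)
open import Algebra.Structures using (IsCommutativeRing)
import Algebra.Construct.NaturalChoice.Max as Max
import Algebra.Definitions.RawMonoid as RawMonoidDefinitions
import Algebra.Module.Construct.DirectProduct as DirectProduct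
import Algebra.Module.Construct.TensorUnit as TensorUnit
open import Data.Fin using (Fin; zero; suc)
open import Data.Integer as ℤ using (ℤ; +_; -[1+_])
open import Data.List using (List; []; _∷_)
open import Data.Nat using (ℕ)
open import Data.Product using (_×_; _,_; proj₁; proj₂; ∃; ∃-syntax)
open import Data.Vec.Functional as Vector using (Vector)
open import Relation.Binary.Bundles using (DecTotalOrder)
open import Relation.Binary.Core using (Rel)
import Relation.Binary.Construct.NonStrictToStrict as NonStrictToStrict
open import Relation.Binary.PropositionalEquality using (_≡_; _≢_)
open import Relation.Binary.Structures using (IsDecTotalOrder)
open import Relation.Nullary using (¬_)
open import Relation.Unary using (Pred; _∈_; _≐_)

------------------------------------------------------------------------
-- The real numbers

-- The library has no real numbers.  They are given here by their axioms:
-- a Dedekind-complete totally ordered field, which classically is unique up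
-- to isomorphism.  The order is decidable, as it is for the classical reals.

record RealNumbers : Set₁ where
  infix  8 -_
  infixl 7 _*_
  infixl 6 _+_
  infix  4 _≈_ _≤_
  field
    Carrier           : Set
    _≈_               : Rel Carrier 0ℓ
    _≤_               : Rel Carrier 0ℓ
    _+_ _*_           : Op₂ Carrier
    -_                : Op₁ Carrier
    0# 1#             : Carrier
    _⁻¹               : Op₁ Carrier
    isCommutativeRing : IsCommutativeRing _≈_ _+_ _*_ -_ 0# 1#
    isDecTotalOrder   : IsDecTotalOrder _≈_ _≤_

  infix 4 _<_
  _<_ : Rel Carrier 0ℓ
  _<_ = NonStrictToStrict._<_ _≈_ _≤_

  field
    1≉0      : ¬ (1# ≈ 0#)
    -- The value of 0# ⁻¹ is unspecified.
    inverseʳ : ∀ x → ¬ (x ≈ 0#) → x * x ⁻¹ ≈ 1#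
    +-monoˡ  : ∀ z {x y} → x ≤ y → x + z ≤ y + z
    *-nonNeg : ∀ {x y} → 0# ≤ x → 0# ≤ y → 0# ≤ x * y
    -- "Least" is expressed positively: whatever lies below the supremum is
    -- exceeded by some element of the set.
    supremum : (P : Pred Carrier 0ℓ) → ∃ P → (∃[ b ] (∀ x → P x → x ≤ b)) →
               ∃[ s ] ((∀ x → P x → x ≤ s) ×
                       (∀ y → y < s → ∃[ x ] (P x × y < x)))

  commutativeRing : CommutativeRing 0ℓ 0ℓ
  commutativeRing = record { isCommutativeRing = isCommutativeRing }

  decTotalOrder : DecTotalOrder 0ℓ 0ℓ 0ℓ
  decTotalOrder = record { isDecTotalOrder = isDecTotalOrder }

------------------------------------------------------------------------
-- Integer vectors

ℤ² : Set
ℤ² = ℤ × ℤ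

det : ℤ² → ℤ² → ℤ
det (a , b) (c , d) = a ℤ.* d ℤ.- b ℤ.* c

-- The area of the parallelogram spanned by two integer vectors.
area : ℤ² → ℤ² → ℕ
area u v = ℤ.∣ det u v ∣

-- Listed in a fixed order; to be compared up to permutation.  Three vectors
-- generate a hexagon exactly when none of these entries is zero.
volumeVector : Vector ℤ² 3 → List ℕ
volumeVector u = area u₁ u₂ ∷ area u₁ u₃ ∷ area u₂ u₃ ∷ []
  where
  u₁ = u zero
  u₂ = u (suc zero)
  u₃ = u (suc (suc zero))

⟪_,_⟫ : ℤ² → ℤ² → Vector ℤ² 2
⟪ u , v ⟫ = u Vector.∷ v Vector.∷ Vector.[]

e₁ : ℤ²
e₁ = + 1 , + 0

------------------------------------------------------------------------
-- Planar convex geometry over the reals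

module Geometry (𝓡 : RealNumbers) where

  open RealNumbers 𝓡 public
    using (_≈_; _≤_; _<_; _+_; _*_; -_; 0#; 1#; _⁻¹)
    renaming (Carrier to ℝ)
  open CommutativeRing (RealNumbers.commutativeRing 𝓡) public
    using (_-_)
  open RawMonoidDefinitions
    (CommutativeRing.+-rawMonoid (RealNumbers.commutativeRing 𝓡)) public
    using () renaming (_×_ to _·_)
  open Max (DecTotalOrder.totalOrder (RealNumbers.decTotalOrder 𝓡)) public
    using (_⊔_)

  ½ : ℝ
  ½ = (1# + 1#) ⁻¹

  ∣_∣ : ℝ → ℝ
  ∣ x ∣ = x ⊔ (- x)

  fromℤ : ℤ → ℝ
  fromℤ (+ n)    = n · 1#
  fromℤ -[1+ n ] = - (ℕ.suc n · 1#)

  IsMinimum : Pred ℝ 0ℓ → Pred ℝ 0ℓ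
  IsMinimum P m = P m × (∀ x → P x → m ≤ x)

  IsMaximum : Pred ℝ 0ℓ → Pred ℝ 0ℓ
  IsMaximum P m = P m × (∀ x → P x → x ≤ m)

  ℝ²-module : Module (RealNumbers.commutativeRing 𝓡) 0ℓ 0ℓ
  ℝ²-module = DirectProduct.⟨module⟩ TensorUnit.⟨module⟩ TensorUnit.⟨module⟩

  open Module ℝ²-module public
    using (_≈ᴹ_; _+ᴹ_; _*ₗ_; 0ᴹ)
    renaming (Carrierᴹ to ℝ²)
  open RawMonoidDefinitions (Module.+ᴹ-rawMonoid ℝ²-module) public
    using (sum)

  fromℤ² : ℤ² → ℝ²
  fromℤ² (a , b) = fromℤ a , fromℤ b

  combination : ∀ {n} → Vector ℝ n → Vector ℤ² n → ℝ²
  combination c u = sum (λ i → c i *ₗ fromℤ² (u i))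

  image : (ℝ² → ℝ²) → Pred ℝ² 0ℓ → Pred ℝ² 0ℓ
  image f C y = ∃[ x ] (x ∈ C × y ≈ᴹ f x)

  -- The Minkowski sum of the segments [0, uᵢ].
  zonotope : ∀ {n} → Vector ℤ² n → Pred ℝ² 0ℓ
  zonotope {n} u x =
    ∃[ c ] ((∀ (i : Fin n) → 0# ≤ c i × c i ≤ 1#) × x ≈ᴹ combination c u)

  -- The set contains three affinely independent points.
  TwoDimensional : Pred ℝ² 0ℓ → Set
  TwoDimensional C =
    ∃[ x ] ∃[ y ] ∃[ z ] (x ∈ C × y ∈ C × z ∈ C ×
      ¬ ((proj₁ y - proj₁ x) * (proj₂ z - proj₂ x) ≈
         (proj₂ y - proj₂ x) * (proj₁ z - proj₁ x)))

  IsLattice2Zonotope : Pred ℝ² 0ℓ → Set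
  IsLattice2Zonotope C =
    TwoDimensional C ×
    (∃[ n ] ∃[ u ] ∃[ t ] (C ≐ image (_+ᴹ fromℤ² t) (zonotope {n} u)))

  -- ρ C + ℤ² = ℝ²
  Covers : ℝ → Pred ℝ² 0ℓ → Set
  Covers ρ C = ∀ x → ∃[ y ] ∃[ z ] (y ∈ C × x ≈ᴹ (ρ *ₗ y) +ᴹ fromℤ² z)

  IsCoveringRadius : Pred ℝ² 0ℓ → ℝ → Set
  IsCoveringRadius C = IsMinimum (λ ρ → 0# < ρ × Covers ρ C)

  ⟨_∙_⟩ : ℤ² → ℝ² → ℝ
  ⟨ (a , b) ∙ (x , y) ⟩ = fromℤ a * x + fromℤ b * y

  IsWidthAlong : ℤ² → Pred ℝ² 0ℓ → ℝ → Set
  IsWidthAlong z C w =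
    ∃[ M ] ∃[ m ] (IsMaximum values M × IsMinimum values m × w ≈ M - m)
    where
    values : Pred ℝ 0ℓ
    values v = ∃[ x ] (x ∈ C × v ≈ ⟨ z ∙ x ⟩)

  IsLatticeWidth : Pred ℝ² 0ℓ → ℝ → Set
  IsLatticeWidth C =
    IsMinimum (λ w → ∃[ z ] (z ≢ (+ 0 , + 0) × IsWidthAlong z C w))

  -- x ↦ U x + t, where p and q are the columns of U.
  affine : (p q t : ℤ²) → ℝ² → ℝ²
  affine p q t (x , y) = ((x *ₗ fromℤ² p) +ᴹ (y *ₗ fromℤ² q)) +ᴹ fromℤ² t

  UnimodularlyEquivalent : Pred ℝ² 0ℓ → Pred ℝ² 0ℓ → Set
  UnimodularlyEquivalent P Q =
    ∃[ p ] ∃[ q ] ∃[ t ] (ℤ.∣ det p q ∣ ≡ 1 × P ≐ image (affine p q t) Q)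

  -- P_{p,q}
  parallelogram : ℤ → ℤ → Pred ℝ² 0ℓ
  parallelogram p q = zonotope ⟪ e₁ , (p , q) ⟫

  Cosimple : ∀ {n} → Vector ℤ² n → Set
  Cosimple {n} u =
    (∀ x → ∃[ c ] (x ≈ᴹ combination c u)) ×
    (∃[ c ] ( combination c u ≈ᴹ 0ᴹ
            × (∀ i → ¬ (c i ≈ 0#))
            × (∀ i j → i ≢ j → ¬ (∣ c i ∣ ≈ ∣ c j ∣))))

-- Write Z for a lattice zonotope.  Its covering radius is at most ½ iff Z + 2ℤ² = ℝ², and this holds as soon as
-- Z contains a parallelogram with one side 2e, for a primitive vector e, and lattice extent at least 2 across e:
-- its translates by 2ℤe fill a strip, and the translates of the strip fill the plane.  Generators aᵢuᵢ/D that
-- add up to such a side leave 1 - |aᵢ|/D of each segment for the extent, so the existence of the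
-- parallelogram is certified by an integer relation Σ aᵢuᵢ = A e.
--
-- After merging parallel generators, a parallelogram with generators (1,0) and (r,n), 0 ≤ 2r ≤ n, has a
-- certificate unless r ≤ 1 or (r,n) = (2,5).  For a hexagon, twice the largest of the three terms of
-- det(u₂,u₃)u₁ + det(u₃,u₁)u₂ + det(u₁,u₂)u₃ = 0 is a certificate unless the areas are (1,1,k), (1,2,3) or (q,q,q),
-- and the last two cases have others.  With four directions one reduces to all areas being 1, which is
-- impossible by the Plücker relation modulo 2.
--
-- In the remaining cases, in every linear dependence either a direction carrying a single generator has coefficient 0
-- or two such directions have coefficients of equal absolute value, so the collection is not cosimple.
module Submission where

open import Defs
open import Algebra.Bundles using (CommutativeRing)
import Algebra.Construct.NaturalChoice.Max as Max
import Algebra.Properties.Ring as RingProperties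
import Algebra.Properties.Semiring.Mult as Mult
import Algebra.Solver.Ring as RingSolver
open import Algebra.Solver.Ring.AlmostCommutativeRing
  using (AlmostCommutativeRing; _-Raw-AlmostCommutative⟶_; fromCommutativeRing)
open import Data.Bool using (T)
open import Data.Empty using (⊥; ⊥-elim)
open import Data.Fin using (zero; suc)
open import Data.Integer as ℤ using (ℤ; +_; -[1+_]; _⊖_)
import Data.Integer.Divisibility.Signed as ℤᵈ
import Data.Integer.DivMod as ℤ
import Data.Integer.Properties as ℤₚ
open import Data.Integer.Solver using () renaming (module +-*-Solver to ℤ-Solver)
open import Data.List using (List; []; _∷_; _++_; map; tabulate)
open import Data.List.Relation.Binary.Permutation.Propositional as Perm
  using (_↭_; prep; swap; ↭-refl; ↭-sym; ↭-trans)
open import Data.List.Relation.Binary.Permutation.Propositional.Properties using (++-comm)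
open import Data.List.Relation.Unary.All as All using (All; []; _∷_)
open import Data.List.Relation.Unary.AllPairs using (AllPairs; []; _∷_)
open import Data.Maybe using (Maybe; just; nothing)
open import Data.Nat as ℕ using (ℕ; zero; suc; z≤n; s≤s; z<s) renaming (_≤_ to _≤ℕ_; _<_ to _<ℕ_)
open import Data.Nat.Divisibility using (_∣_; ∣⇒≤; ∣-refl; ∣m+n∣m⇒∣n; ∣1⇒≡1)
open import Data.Nat.Induction using (<-wellFounded)
import Data.Nat.Properties as ℕₚ
open import Data.Nat.Tactic.RingSolver using (solve-∀)
open import Data.Product using (_×_; _,_; proj₁; proj₂; ∃-syntax)
open import Data.Sum using (_⊎_; inj₁; inj₂)
open import Data.Vec.Functional as Vector using (Vector)
open import Induction.WellFounded using (Acc; acc)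
open import Level using (0ℓ)
open import Relation.Binary.Bundles using (DecTotalOrder)
import Relation.Binary.PropositionalEquality as ≡
open ≡ using (_≡_; _≢_)
import Relation.Binary.Reasoning.Setoid as SetoidReasoning
open import Relation.Nullary using (¬_; Dec; yes; no; contradiction)
open import Relation.Unary using (Pred; _≐_)


-- A covering radius is a minimum, so a covering of the plane by half of the zonotope already bounds
-- it by one half: every case ends in an explicit covering or in the list, and no covering radius is
-- ever computed. The covering is encoded by integers with a common denominator D, so inequalities
-- between real coefficients become inequalities between naturals, and sporadic cases are settled by
-- evaluation. The second side of the inner parallelogram may be sheared along e; only its
-- determinant with e counts. Both sides draw on the same budget of each generator, and the method
-- fails narrowly: for areas (1 , 1 , k) the extent is 2 - 2 / k, which any further direction
-- repairs. A generator of lattice length at least 2 already contains a side 2 e. Hence merging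
-- parallel generators costs nothing: a merged ray is never primitive, so coefficients of a
-- dependence have to be remembered only on rays that carry one primitive generator, and there
-- cosimplicity survives.

module Lattice where

  open ≡ using (refl; sym; trans; cong; cong₂; subst; subst₂; module ≡-Reasoning)
  open import Data.Integer using (∣_∣)
  open ℤ-Solver using (Polynomial; con; _:+_; _:*_; _:-_; :-_; _:=_) renaming (solve to solveℤ)

  -- Integer vectors and determinants

  infixl 6 _⊕_
  infixr 7 _•_

  _⊕_ : ℤ² → ℤ² → ℤ²
  (a , b) ⊕ (c , d) = a ℤ.+ c , b ℤ.+ d

  _•_ : ℤ → ℤ² → ℤ²
  k • (a , b) = k ℤ.* a , k ℤ.* b

  0² : ℤ²
  0² = + 0 , + 0

  ⟦_,_⟧ : ℤ² → ℤ² → ℤ² → ℤ²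
  ⟦ p , q ⟧ (a , b) = a • p ⊕ b • q

  Poly² : ℕ → Set
  Poly² n = Polynomial n × Polynomial n

  :det : ∀ {n} → Poly² n → Poly² n → Polynomial n
  :det (a , b) (c , d) = a :* d :- b :* c

  •-identity : ∀ u → + 1 • u ≡ u
  •-identity (a , b) = cong₂ _,_ (ℤₚ.*-identityˡ a) (ℤₚ.*-identityˡ b)

  det-self : ∀ u → det u u ≡ + 0
  det-self (a , b) = solveℤ 2 (λ a b → :det (a , b) (a , b) := con (+ 0)) refl a b

  det-swap : ∀ u v → det v u ≡ ℤ.- det u v
  det-swap (a , b) (c , d) =
    solveℤ 4 (λ a b c d → :det (c , d) (a , b) := :- :det (a , b) (c , d)) refl a b c d

  det-•ˡ : ∀ k u v → det (k • u) v ≡ k ℤ.* det u v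
  det-•ˡ k (a , b) (c , d) =
    solveℤ 5 (λ k a b c d → :det (k :* a , k :* b) (c , d) := k :* :det (a , b) (c , d)) refl k a b c d

  det-•ʳ : ∀ k u v → det u (k • v) ≡ k ℤ.* det u v
  det-•ʳ k (a , b) (c , d) =
    solveℤ 5 (λ k a b c d → :det (a , b) (k :* c , k :* d) := k :* :det (a , b) (c , d)) refl k a b c d

  det-⊕ʳ : ∀ u v w → det u (v ⊕ w) ≡ det u v ℤ.+ det u w
  det-⊕ʳ (a , b) (c , d) (m , n) =
    solveℤ 6 (λ a b c d m n → :det (a , b) (c :+ m , d :+ n) := :det (a , b) (c , d) :+ :det (a , b) (m , n))
      refl a b c d m n

  det-⟦⟧ : ∀ p q x y → det (⟦ p , q ⟧ x) (⟦ p , q ⟧ y) ≡ det p q ℤ.* det x y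
  det-⟦⟧ (a , b) (c , d) (k , l) (m , n) =
    solveℤ 8 (λ a b c d k l m n →
      :det (k :* a :+ l :* c , k :* b :+ l :* d) (m :* a :+ n :* c , m :* b :+ n :* d)
        := :det (a , b) (c , d) :* :det (k , l) (m , n))
      refl a b c d k l m n

  ⟦⟧-⊕ : ∀ p q x y → ⟦ p , q ⟧ (x ⊕ y) ≡ ⟦ p , q ⟧ x ⊕ ⟦ p , q ⟧ y
  ⟦⟧-⊕ (a , b) (c , d) (k , l) (m , n) = cong₂ _,_ (eq a c) (eq b d)
    where
    eq : ∀ s t → (k ℤ.+ m) ℤ.* s ℤ.+ (l ℤ.+ n) ℤ.* t ≡ (k ℤ.* s ℤ.+ l ℤ.* t) ℤ.+ (m ℤ.* s ℤ.+ n ℤ.* t)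
    eq s t = solveℤ 6 (λ k l m n s t → (k :+ m) :* s :+ (l :+ n) :* t := (k :* s :+ l :* t) :+ (m :* s :+ n :* t))
      refl k l m n s t

  ⟦⟧-• : ∀ p q k x → ⟦ p , q ⟧ (k • x) ≡ k • ⟦ p , q ⟧ x
  ⟦⟧-• (a , b) (c , d) k (m , n) = cong₂ _,_ (eq a c) (eq b d)
    where
    eq : ∀ s t → k ℤ.* m ℤ.* s ℤ.+ k ℤ.* n ℤ.* t ≡ k ℤ.* (m ℤ.* s ℤ.+ n ℤ.* t)
    eq s t = solveℤ 5 (λ k m n s t → k :* m :* s :+ k :* n :* t := k :* (m :* s :+ n :* t)) refl k m n s t

  -- Cramer's rule, with no denominator because the determinant is one.
  coordinates : ∀ e f → det e f ≡ + 1 → ∀ u → u ≡ ⟦ e , f ⟧ (det u f , det e u)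
  coordinates (a , b) (c , d) ef (m , n) = cong₂ _,_
    (trans (sym (trans (cong (ℤ._* m) ef) (ℤₚ.*-identityˡ m)))
      (solveℤ 6 (λ a b c d m n → :det (a , b) (c , d) :* m
        := :det (m , n) (c , d) :* a :+ :det (a , b) (m , n) :* c) refl a b c d m n))
    (trans (sym (trans (cong (ℤ._* n) ef) (ℤₚ.*-identityˡ n)))
      (solveℤ 6 (λ a b c d m n → :det (a , b) (c , d) :* n
        := :det (m , n) (c , d) :* b :+ :det (a , b) (m , n) :* d) refl a b c d m n))

  area-swap : ∀ u v → area v u ≡ area u v
  area-swap u v = trans (cong ∣_∣ (det-swap u v)) (ℤₚ.∣-i∣≡∣i∣ (det u v))

  area-self : ∀ u → area u u ≡ 0
  area-self u = cong ∣_∣ (det-self u)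

  -- Primitivity is encoded by a Bézout partner: f completes e to a positively oriented lattice
  -- basis, and the later coordinate computations use this f directly.
  Primitive : ℤ² → Set
  Primitive e = ∃[ f ] det e f ≡ + 1

  ∣i∣≡1⇒i*i≡1 : ∀ i → ∣ i ∣ ≡ 1 → i ℤ.* i ≡ + 1
  ∣i∣≡1⇒i*i≡1 (+ 1)    refl = refl
  ∣i∣≡1⇒i*i≡1 -[1+ 0 ] refl = refl

  area≡1⇒Primitive : ∀ e f → area e f ≡ 1 → Primitive e
  area≡1⇒Primitive e f ef =
    det e f • f , trans (det-•ʳ (det e f) e f) (∣i∣≡1⇒i*i≡1 (det e f) ef)

  -- Certificates and their transport by unimodular maps

  linear : List (ℤ × ℤ²) → ℤ²
  linear []            = 0²
  linear ((a , u) ∷ K) = a • u ⊕ linear K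

  slack : ℕ → ℤ² → List (ℤ × ℤ²) → ℕ
  slack D e []            = 0
  slack D e ((a , u) ∷ K) = (D ℕ.∸ ∣ a ∣) ℕ.* area e u ℕ.+ slack D e K

  -- In a row (a , u) of K, a / D is the coefficient of u in the segment (A / D) e.  The unused part of
  -- each generator, of length 1 - |a| / D, contributes to the extent of the zonotope across e.
  record Certificate (K : List (ℤ × ℤ²)) : Set where
    field
      D         : ℕ
      D>0       : 0 <ℕ D
      e         : ℤ²
      e-primitive : Primitive e
      -- Keeps every coefficient a / D in [-1 , 1] and makes the truncated subtraction in `slack`
      -- exact.
      bounded   : All (λ k → ∣ proj₁ k ∣ ≤ℕ D) K
      A         : ℤ
      along     : linear K ≡ A • e
      -- Both `A` and the slack are scaled by D, so the side length 2 and the extent 2 turn into 2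
      -- D.
      long      : 2 ℕ.* D ≤ℕ ∣ A ∣
      wide      : 2 ℕ.* D ≤ℕ slack D e K

  -- Reordering the generators leaves the zonotope unchanged and a new generator only enlarges it,
  -- so a certificate for a few generators serves every collection that contains them.
  data Slab : List ℤ² → Set where
    certificate : ∀ K → Certificate K → Slab (map proj₂ K)
    permute     : ∀ {L M} → L ↭ M → Slab L → Slab M
    weaken      : ∀ {u L} → Slab L → Slab (u ∷ L)

  module _ (p q : ℤ²) (unimodular : area p q ≡ 1) where

    area-⟦⟧ : ∀ x y → area (⟦ p , q ⟧ x) (⟦ p , q ⟧ y) ≡ area x y
    area-⟦⟧ x y = begin
      area (⟦ p , q ⟧ x) (⟦ p , q ⟧ y)  ≡⟨ cong ∣_∣ (det-⟦⟧ p q x y) ⟩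
      ∣ det p q ℤ.* det x y ∣           ≡⟨ ℤₚ.abs-* (det p q) (det x y) ⟩
      area p q ℕ.* area x y             ≡⟨ cong (ℕ._* area x y) unimodular ⟩
      1 ℕ.* area x y                    ≡⟨ ℕₚ.*-identityˡ _ ⟩
      area x y                          ∎
      where open ≡-Reasoning

    transform : List (ℤ × ℤ²) → List (ℤ × ℤ²)
    transform = map (λ (a , u) → a , ⟦ p , q ⟧ u)

    linear-transform : ∀ K → linear (transform K) ≡ ⟦ p , q ⟧ (linear K)
    linear-transform []            = refl
    linear-transform ((a , u) ∷ K) = begin
      a • ⟦ p , q ⟧ u ⊕ linear (transform K)        ≡⟨ cong₂ _⊕_ (sym (⟦⟧-• p q a u)) (linear-transform K) ⟩
      ⟦ p , q ⟧ (a • u) ⊕ ⟦ p , q ⟧ (linear K)      ≡⟨ ⟦⟧-⊕ p q (a • u) (linear K) ⟨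
      ⟦ p , q ⟧ (a • u ⊕ linear K)                  ∎
      where open ≡-Reasoning

    slack-transform : ∀ D e K → slack D (⟦ p , q ⟧ e) (transform K) ≡ slack D e K
    slack-transform D e []            = refl
    slack-transform D e ((a , u) ∷ K) =
      cong₂ ℕ._+_ (cong ((D ℕ.∸ ∣ a ∣) ℕ.*_) (area-⟦⟧ e u)) (slack-transform D e K)

    bounded-transform : ∀ {D} K → All (λ k → ∣ proj₁ k ∣ ≤ℕ D) K → All (λ k → ∣ proj₁ k ∣ ≤ℕ D) (transform K)
    bounded-transform []      []       = []
    bounded-transform (_ ∷ K) (b ∷ bs) = b ∷ bounded-transform K bs

    -- The relation is linear, and the slack depends only on areas, which a unimodular map
    -- preserves; the image of the Bézout partner still spans area one with the image of e.
    Certificate-transform : ∀ {K} → Certificate K → Certificate (transform K)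
    Certificate-transform {K} c = record
      { D         = D
      ; D>0       = D>0
      ; e         = ⟦ p , q ⟧ e
      ; e-primitive = area≡1⇒Primitive (⟦ p , q ⟧ e) (⟦ p , q ⟧ f) (trans (area-⟦⟧ e f) (cong ∣_∣ ef))
      ; bounded   = bounded-transform K bounded
      ; A         = A
      ; along     = trans (linear-transform K) (trans (cong ⟦ p , q ⟧ along) (⟦⟧-• p q A e))
      ; long      = long
      ; wide      = subst (2 ℕ.* D ≤ℕ_) (sym (slack-transform D e K)) wide
      }
      where
      open Certificate c
      f  = proj₁ e-primitive
      ef = proj₂ e-primitive

    slab-transform : ∀ K → Certificate K → Slab (map proj₂ (transform K))
    slab-transform K c = certificate (transform K) (Certificate-transform c)

  -- Primitive directions by the Euclidean algorithm

  ≤-decided : ∀ {m n} → {_ : T (m ℕ.≤ᵇ n)} → m ≤ℕ n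
  ≤-decided {m} {n} {le} = ℕₚ.≤ᵇ⇒≤ m n le

  -- Storing the multiplicity minus one makes it positive by construction. The vector is primitive
  -- for excess 0 and has lattice length at least 2 otherwise, which is the case distinction made
  -- throughout.
  record Ray : Set where
    constructor ray
    field
      excess    : ℕ
      direction : ℤ²
      primitive-direction : Primitive direction

    multiplicity : ℕ
    multiplicity = suc excess

    vector : ℤ²
    vector = + multiplicity • direction


  open Ray

  -- The matrix with rows (m , 1) and (1 , 0) carries (b , c) to the new vector. Its determinant is
  -- -1, hence the negated image of the Bézout partner.
  euclidStep : ∀ m b c → ∃[ r ] vector r ≡ (b , c) → ∃[ r ] vector r ≡ (c ℤ.+ m ℤ.* b , b)
  euclidStep m b c (ray g (e₁ , e₂) ((f₁ , f₂) , ef) , eq) =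
    ray g (m ℤ.* e₁ ℤ.+ e₂ , e₁) ((ℤ.- (m ℤ.* f₁ ℤ.+ f₂) , ℤ.- f₁) ,
      trans (solveℤ 5 (λ m e₁ e₂ f₁ f₂ →
               (m :* e₁ :+ e₂) :* (:- f₁) :- e₁ :* (:- (m :* f₁ :+ f₂)) := e₁ :* f₂ :- e₂ :* f₁)
               refl m e₁ e₂ f₁ f₂) ef) ,
    cong₂ _,_
      (trans (solveℤ 4 (λ g m e₁ e₂ → g :* (m :* e₁ :+ e₂) := g :* e₂ :+ m :* (g :* e₁)) refl (+ suc g) m e₁ e₂)
             (cong₂ (λ x y → x ℤ.+ m ℤ.* y) (cong proj₂ eq) (cong proj₁ eq)))
      (cong proj₁ eq)

  -- Euclid's algorithm on the two coordinates: the multiplicity is their greatest common divisor,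
  -- and the remainder modulo the second coordinate is what decreases.
  toRay : ∀ v → v ≢ 0² → ∃[ r ] vector r ≡ v
  toRay v = euclid v (<-wellFounded ∣ proj₂ v ∣)
    where
    euclid : ∀ v → Acc _<ℕ_ ∣ proj₂ v ∣ → v ≢ 0² → ∃[ r ] vector r ≡ v
    divide : ∀ a b .{{_ : ℤ.NonZero b}} → Acc _<ℕ_ (a ℤ.% b) → b ≢ + 0 → ∃[ r ] vector r ≡ (a , b)

    euclid (+ 0 , + 0) _ v≢0 = contradiction refl v≢0
    euclid (+ suc n , + 0) _ _ =
      ray n (+ 1 , + 0) ((+ 0 , + 1) , refl) ,
      cong₂ _,_ (ℤₚ.*-identityʳ (+ suc n)) (ℤₚ.*-zeroʳ (+ suc n))
    euclid (-[1+ n ] , + 0) _ _ =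
      ray n (-[1+ 0 ] , + 0) ((+ 0 , -[1+ 0 ]) , refl) ,
      cong₂ _,_ (trans (ℤₚ.*-comm (+ suc n) -[1+ 0 ]) (ℤₚ.-1*i≡-i (+ suc n))) (ℤₚ.*-zeroʳ (+ suc n))
    euclid (a , b@(+ suc _))  (acc rec) _ = divide a b (rec (ℤ.n%d<d a b)) λ ()
    euclid (a , b@(-[1+ _ ])) (acc rec) _ = divide a b (rec (ℤ.n%d<d a b)) λ ()

    divide a b ac b≢0 =
      subst (λ a′ → ∃[ r ] vector r ≡ (a′ , b)) (sym (ℤ.a≡a%n+[a/n]*n a b))
        (euclidStep (a ℤ./ b) b (+ (a ℤ.% b)) (euclid (b , + (a ℤ.% b)) ac λ eq → b≢0 (cong proj₁ eq)))

  -- Pairs with a primitive generator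

  record NormalForm (u v : ℤ²) : Set where
    field
      p q        : ℤ²
      unimodular : area p q ≡ 1
      -- This sign is the price of `r+r≤n`: folding r to n - r replaces p by its negative, and u is
      -- then - p.
      σ          : ℤ
      ∣σ∣≡1      : ∣ σ ∣ ≡ 1
      r n        : ℕ
      r+r≤n      : r ℕ.+ r ≤ℕ n
      u-eq       : u ≡ ⟦ p , q ⟧ (σ , + 0)
      v-eq       : v ≡ ⟦ p , q ⟧ (+ r , + n)
      area-eq    : area u v ≡ n

  area-•ʳ : ∀ k u v → area u (k • v) ≡ ∣ k ∣ ℕ.* area u v
  area-•ʳ k u v = trans (cong ∣_∣ (det-•ʳ k u v)) (ℤₚ.abs-* k (det u v))

  area-•ˡ : ∀ k u v → area (k • u) v ≡ ∣ k ∣ ℕ.* area u v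
  area-•ˡ k u v = trans (cong ∣_∣ (det-•ˡ k u v)) (ℤₚ.abs-* k (det u v))

  signed : ∀ i → ∃[ s ] (∣ s ∣ ≡ 1 × i ≡ + ∣ i ∣ ℤ.* s)
  signed (+ n)    = + 1 , refl , sym (ℤₚ.*-identityʳ (+ n))
  signed -[1+ n ] = -[1+ 0 ] , refl , trans (sym (ℤₚ.-1*i≡-i (+ suc n))) (ℤₚ.*-comm -[1+ 0 ] (+ suc n))

  -- Orienting a generator by the sign of its determinant with e makes its contribution to the
  -- height nonnegative, so that contributions of different generators never cancel.
  *-signed : ∀ m i → + m ℤ.* proj₁ (signed i) ℤ.* i ≡ + (m ℕ.* ∣ i ∣)
  *-signed m i = trans (cong (+ m ℤ.* s ℤ.*_) s-eq) (trans (rearrange (+ m) s (+ ∣ i ∣))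
    (trans (cong (λ k → + m ℤ.* + ∣ i ∣ ℤ.* k) (∣i∣≡1⇒i*i≡1 s s≡)) (trans (ℤₚ.*-identityʳ _) (sym (ℤₚ.pos-* m ∣ i ∣)))))
    where
    s    = proj₁ (signed i)
    s≡   = proj₁ (proj₂ (signed i))
    s-eq = proj₂ (proj₂ (signed i))
    rearrange : ∀ i j k → i ℤ.* j ℤ.* (k ℤ.* j) ≡ i ℤ.* k ℤ.* (j ℤ.* j)
    rearrange = solveℤ 3 (λ i j k → i :* j :* (k :* j) := i :* k :* (j :* j)) refl

  normalForm : ∀ u v → Primitive u → 1 ≤ℕ area u v → NormalForm u v
  normalForm u v (f , uf) uv≥1 = body (area u v) refl uv≥1
    where
    open ≡-Reasoning
    body : ∀ n → area u v ≡ n → 1 ≤ℕ n → NormalForm u v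
    body n@(suc _) eqn _ = choose (r ℕ.+ r ℕ.≤? n)
      where
      s   = proj₁ (signed (det u v))
      x   = det v f
      m   = x ℤ./ℕ n
      r   = x ℤ.%ℕ n
      -- In the basis (u , f) the vector v has coordinates (x , n s). Moving the quotient m of x by
      -- n into q leaves the remainder r: v = r u + n q.
      q   = s • f ⊕ m • u

      ∣s∣≡1 : ∣ s ∣ ≡ 1
      ∣s∣≡1 = proj₁ (proj₂ (signed (det u v)))

      y-eq : det u v ≡ + n ℤ.* s
      y-eq = trans (proj₂ (proj₂ (signed (det u v)))) (cong (λ k → + k ℤ.* s) eqn)

      det-uq : det u q ≡ s
      det-uq = begin
        det u (s • f ⊕ m • u)              ≡⟨ det-⊕ʳ u (s • f) (m • u) ⟩
        det u (s • f) ℤ.+ det u (m • u)    ≡⟨ cong₂ ℤ._+_ (det-•ʳ s u f) (det-•ʳ m u u) ⟩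
        s ℤ.* det u f ℤ.+ m ℤ.* det u u    ≡⟨ cong₂ (λ a b → s ℤ.* a ℤ.+ m ℤ.* b) uf (det-self u) ⟩
        s ℤ.* + 1 ℤ.+ m ℤ.* + 0            ≡⟨ solveℤ 2 (λ s m → s :* con (+ 1) :+ m :* con (+ 0) := s) refl s m ⟩
        s ∎

      component : ∀ a b → x ℤ.* a ℤ.+ det u v ℤ.* b
                        ≡ + r ℤ.* a ℤ.+ + n ℤ.* (s ℤ.* b ℤ.+ m ℤ.* a)
      component a b = begin
        x ℤ.* a ℤ.+ det u v ℤ.* b
          ≡⟨ cong₂ (λ i j → i ℤ.* a ℤ.+ j ℤ.* b) (ℤ.a≡a%ℕn+[a/ℕn]*n x n) y-eq ⟩
        (+ r ℤ.+ m ℤ.* + n) ℤ.* a ℤ.+ (+ n ℤ.* s) ℤ.* b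
          ≡⟨ solveℤ 6 (λ r m n a s b → (r :+ m :* n) :* a :+ (n :* s) :* b := r :* a :+ n :* (s :* b :+ m :* a))
               refl (+ r) m (+ n) a s b ⟩
        + r ℤ.* a ℤ.+ + n ℤ.* (s ℤ.* b ℤ.+ m ℤ.* a) ∎

      v-eq : v ≡ ⟦ u , q ⟧ (+ r , + n)
      v-eq = trans (coordinates u f uf v)
        (cong₂ _,_ (component (proj₁ u) (proj₁ f)) (component (proj₂ u) (proj₂ f)))

      choose : _ → NormalForm u v
      choose (yes r+r≤n) = record
        { p = u ; q = q ; unimodular = trans (cong ∣_∣ det-uq) ∣s∣≡1
        ; σ = + 1 ; ∣σ∣≡1 = refl ; r = r ; n = n ; r+r≤n = r+r≤n
        ; u-eq = cong₂ _,_ (id′ (proj₁ u) (proj₁ q)) (id′ (proj₂ u) (proj₂ q))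
        ; v-eq = v-eq ; area-eq = eqn }
        where
        id′ : ∀ a b → a ≡ + 1 ℤ.* a ℤ.+ + 0 ℤ.* b
        id′ a b = solveℤ 2 (λ a b → a := con (+ 1) :* a :+ con (+ 0) :* b) refl a b
      -- The reflection rests on r u + n q = (n - r) (- u) + n (q + u).
      choose (no r+r≰n) = record
        { p = -[1+ 0 ] • u ; q = q ⊕ u ; unimodular = unimodular
        ; σ = -[1+ 0 ] ; ∣σ∣≡1 = refl ; r = n ℕ.∸ r ; n = n ; r+r≤n = bound
        ; u-eq = cong₂ _,_ (id′ (proj₁ u) (proj₁ (q ⊕ u))) (id′ (proj₂ u) (proj₂ (q ⊕ u)))
        ; v-eq = trans v-eq (cong₂ _,_ (reflect (proj₁ u) (proj₁ q)) (reflect (proj₂ u) (proj₂ q)))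
        ; area-eq = eqn }
        where
        id′ : ∀ a b → a ≡ -[1+ 0 ] ℤ.* (-[1+ 0 ] ℤ.* a) ℤ.+ + 0 ℤ.* b
        id′ a b = solveℤ 2 (λ a b → a := con -[1+ 0 ] :* (con -[1+ 0 ] :* a) :+ con (+ 0) :* b) refl a b
        r≤n : r ≤ℕ n
        r≤n = ℕₚ.<⇒≤ (ℤ.n%ℕd<d x n)
        bound : (n ℕ.∸ r) ℕ.+ (n ℕ.∸ r) ≤ℕ n
        bound = ℕₚ.≤-trans (ℕₚ.+-monoʳ-≤ (n ℕ.∸ r) (ℕₚ.m≤n+o⇒m∸n≤o n r (ℕₚ.<⇒≤ (ℕₚ.≰⇒> r+r≰n))))
          (ℕₚ.≤-reflexive (ℕₚ.m∸n+n≡m r≤n))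
        reflect : ∀ a b → + r ℤ.* a ℤ.+ + n ℤ.* b
                        ≡ + (n ℕ.∸ r) ℤ.* (-[1+ 0 ] ℤ.* a) ℤ.+ + n ℤ.* (b ℤ.+ a)
        reflect a b = begin
          + r ℤ.* a ℤ.+ + n ℤ.* b
            ≡⟨ solveℤ 4 (λ r n a b → r :* a :+ n :* b
                 := (n :- r) :* (con -[1+ 0 ] :* a) :+ n :* (b :+ a)) refl (+ r) (+ n) a b ⟩
          (+ n ℤ.- + r) ℤ.* (-[1+ 0 ] ℤ.* a) ℤ.+ + n ℤ.* (b ℤ.+ a)
            ≡⟨ cong (λ k → k ℤ.* (-[1+ 0 ] ℤ.* a) ℤ.+ + n ℤ.* (b ℤ.+ a))
                 (trans (ℤₚ.m-n≡m⊖n n r) (ℤₚ.⊖-≥ r≤n)) ⟩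
          + (n ℕ.∸ r) ℤ.* (-[1+ 0 ] ℤ.* a) ℤ.+ + n ℤ.* (b ℤ.+ a) ∎
        unimodular : area (-[1+ 0 ] • u) (q ⊕ u) ≡ 1
        unimodular = begin
          area (-[1+ 0 ] • u) (q ⊕ u)    ≡⟨ area-•ˡ -[1+ 0 ] u (q ⊕ u) ⟩
          1 ℕ.* area u (q ⊕ u)           ≡⟨ ℕₚ.*-identityˡ (area u (q ⊕ u)) ⟩
          ∣ det u (q ⊕ u) ∣              ≡⟨ cong ∣_∣ (trans (det-⊕ʳ u q u)
                                              (trans (cong (λ k → det u q ℤ.+ k) (det-self u)) (ℤₚ.+-identityʳ (det u q)))) ⟩
          ∣ det u q ∣                    ≡⟨ trans (cong ∣_∣ det-uq) ∣s∣≡1 ⟩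
          1 ∎

  ∣i∣≡1⇒i≡±1 : ∀ i → ∣ i ∣ ≡ 1 → i ≡ + 1 ⊎ i ≡ -[1+ 0 ]
  ∣i∣≡1⇒i≡±1 (+ 1)    refl = inj₁ refl
  ∣i∣≡1⇒i≡±1 -[1+ 0 ] refl = inj₂ refl

  -- The coordinates of a generator pair in normal form whose parallelogram has
  -- covering radius greater than ½.
  data Exceptional : ℕ → ℕ → Set where
    width-one   : ∀ {n} → 1 ≤ℕ n → Exceptional 0 n
    width-two   : ∀ {n} → 2 ≤ℕ n → Exceptional 1 n
    width-three : Exceptional 2 5

  pairList : ℤ → ℤ → ℤ → ℕ → ℕ → List (ℤ × ℤ²)
  pairList a b σ r n = (a , (σ , + 0)) ∷ (b , (+ r , + n)) ∷ []

  -- The strip in the direction (0 , 1) = (v - r σ u) / n.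
  verticalCertificate : ∀ σ r n → ∣ σ ∣ ≡ 1 → 1 ≤ℕ r → r ℕ.+ r ≤ℕ n → 4 ≤ℕ n → n ≤ℕ r ℕ.* (n ℕ.∸ 4) →
                        Certificate (pairList (+ (r ℕ.+ r) ℤ.* ℤ.- σ) (+ 2) σ r n)
  verticalCertificate σ r n ∣σ∣≡1 r≥1 r+r≤n n≥4 n≤ = record
    { D = n ; D>0 = ℕₚ.≤-trans (s≤s z≤n) n≥4
    ; e = + 0 , + 1 ; e-primitive = (-[1+ 0 ] , + 0) , refl
    ; bounded = ℕₚ.≤-trans (ℕₚ.≤-reflexive abs-a) r+r≤n ∷ ℕₚ.≤-trans ≤-decided n≥4 ∷ []
    ; A = + 2 ℤ.* + n
    ; along = cong₂ _,_ x-eq y-eq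
    ; long = ℕₚ.≤-reflexive (sym (ℤₚ.abs-* (+ 2) (+ n)))
    ; wide = wide
    }
    where
    abs-a : ∣ + (r ℕ.+ r) ℤ.* ℤ.- σ ∣ ≡ r ℕ.+ r
    abs-a = trans (ℤₚ.abs-* (+ (r ℕ.+ r)) (ℤ.- σ))
      (trans (cong ((r ℕ.+ r) ℕ.*_) (trans (ℤₚ.∣-i∣≡∣i∣ σ) ∣σ∣≡1)) (ℕₚ.*-identityʳ (r ℕ.+ r)))
    open ≡-Reasoning
    x-eq : + (r ℕ.+ r) ℤ.* ℤ.- σ ℤ.* σ ℤ.+ (+ 2 ℤ.* + r ℤ.+ + 0) ≡ (+ 2 ℤ.* + n) ℤ.* + 0
    x-eq = begin
      (+ r ℤ.+ + r) ℤ.* ℤ.- σ ℤ.* σ ℤ.+ (+ 2 ℤ.* + r ℤ.+ + 0)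
        ≡⟨ solveℤ 2 (λ r σ → (r :+ r) :* (:- σ) :* σ :+ (con (+ 2) :* r :+ con (+ 0))
             := con (+ 2) :* r :* (con (+ 1) :- σ :* σ)) refl (+ r) σ ⟩
      + 2 ℤ.* + r ℤ.* (+ 1 ℤ.- σ ℤ.* σ)
        ≡⟨ cong (λ k → + 2 ℤ.* + r ℤ.* (+ 1 ℤ.- k)) (∣i∣≡1⇒i*i≡1 σ ∣σ∣≡1) ⟩
      + 2 ℤ.* + r ℤ.* + 0
        ≡⟨ solveℤ 2 (λ r n → con (+ 2) :* r :* con (+ 0) := con (+ 2) :* n :* con (+ 0)) refl (+ r) (+ n) ⟩
      + 2 ℤ.* + n ℤ.* + 0 ∎
    y-eq : + (r ℕ.+ r) ℤ.* ℤ.- σ ℤ.* + 0 ℤ.+ (+ 2 ℤ.* + n ℤ.+ + 0) ≡ (+ 2 ℤ.* + n) ℤ.* + 1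
    y-eq = solveℤ 3 (λ r σ n → (r :+ r) :* (:- σ) :* con (+ 0) :+ (con (+ 2) :* n :+ con (+ 0))
             := con (+ 2) :* n :* con (+ 1)) refl (+ r) σ (+ n)
    area-u : area (+ 0 , + 1) (σ , + 0) ≡ 1
    area-u = trans (cong ∣_∣ (solveℤ 1 (λ σ → con (+ 0) :* con (+ 0) :- con (+ 1) :* σ := :- σ) refl σ))
      (trans (ℤₚ.∣-i∣≡∣i∣ σ) ∣σ∣≡1)
    area-v : area (+ 0 , + 1) (+ r , + n) ≡ r
    area-v = trans (cong ∣_∣ (solveℤ 2 (λ r n → con (+ 0) :* n :- con (+ 1) :* r := :- r) refl (+ r) (+ n)))
      (ℤₚ.∣-i∣≡∣i∣ (+ r))
    slack-eq : slack n (+ 0 , + 1) (pairList (+ (r ℕ.+ r) ℤ.* ℤ.- σ) (+ 2) σ r n)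
             ≡ n ℕ.+ r ℕ.* (n ℕ.∸ 4)
    slack-eq with ℕₚ.m≤n⇒∃[o]m+o≡n r+r≤n | ℕₚ.m≤n⇒∃[o]m+o≡n n≥4
    ... | c , r+r+c≡n | m , 4+m≡n = begin
      (n ℕ.∸ ∣ + (r ℕ.+ r) ℤ.* ℤ.- σ ∣) ℕ.* area (+ 0 , + 1) (σ , + 0)
        ℕ.+ ((n ℕ.∸ 2) ℕ.* area (+ 0 , + 1) (+ r , + n) ℕ.+ 0)
        ≡⟨ cong₂ ℕ._+_ (cong₂ (λ i j → (n ℕ.∸ i) ℕ.* j) abs-a area-u)
             (cong₂ (λ i j → (i ℕ.∸ 2) ℕ.* j ℕ.+ 0) (sym 4+m≡n) area-v) ⟩
      (n ℕ.∸ (r ℕ.+ r)) ℕ.* 1 ℕ.+ ((2 ℕ.+ m) ℕ.* r ℕ.+ 0)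
        ≡⟨ cong (λ i → i ℕ.* 1 ℕ.+ ((2 ℕ.+ m) ℕ.* r ℕ.+ 0))
             (trans (cong (ℕ._∸ (r ℕ.+ r)) (sym r+r+c≡n)) (ℕₚ.m+n∸m≡n (r ℕ.+ r) c)) ⟩
      c ℕ.* 1 ℕ.+ ((2 ℕ.+ m) ℕ.* r ℕ.+ 0)
        ≡⟨ arith c m r ⟩
      (r ℕ.+ r ℕ.+ c) ℕ.+ r ℕ.* m
        ≡⟨ cong₂ (λ i j → i ℕ.+ r ℕ.* (j ℕ.∸ 4)) r+r+c≡n 4+m≡n ⟩
      n ℕ.+ r ℕ.* (n ℕ.∸ 4) ∎
      where
      arith : ∀ c m r → c ℕ.* 1 ℕ.+ ((2 ℕ.+ m) ℕ.* r ℕ.+ 0) ≡ (r ℕ.+ r ℕ.+ c) ℕ.+ r ℕ.* m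
      arith = solve-∀
    wide : 2 ℕ.* n ≤ℕ slack n (+ 0 , + 1) (pairList (+ (r ℕ.+ r) ℤ.* ℤ.- σ) (+ 2) σ r n)
    wide = ℕₚ.≤-trans (ℕₚ.+-monoʳ-≤ n (ℕₚ.≤-trans (ℕₚ.≤-reflexive (ℕₚ.+-identityʳ n)) n≤))
      (ℕₚ.≤-reflexive (sym slack-eq))

  -- Here v is twice (1 , 2), and the untouched u has area 2 with that direction.
  certificate-4-2 : ∀ σ → σ ≡ + 1 ⊎ σ ≡ -[1+ 0 ] → Certificate (pairList (+ 0) (+ 1) σ 2 4)
  certificate-4-2 σ σ≡±1 = record
    { D = 1 ; D>0 = s≤s z≤n ; e = + 1 , + 2 ; e-primitive = (+ 0 , + 1) , refl ; bounded = z≤n ∷ ≤-decided ∷ []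
    ; A = + 2 ; along = along σ≡±1 ; long = ≤-decided ; wide = wide σ≡±1 }
    where
    along : ∀ {σ} → σ ≡ + 1 ⊎ σ ≡ -[1+ 0 ] → linear (pairList (+ 0) (+ 1) σ 2 4) ≡ (+ 2 , + 4)
    along (inj₁ refl) = refl
    along (inj₂ refl) = refl
    wide : ∀ {σ} → σ ≡ + 1 ⊎ σ ≡ -[1+ 0 ] → 2 ≤ℕ slack 1 (+ 1 , + 2) (pairList (+ 0) (+ 1) σ 2 4)
    wide (inj₁ refl) = ≤-decided
    wide (inj₂ refl) = ≤-decided

  -- Again v is not primitive: it is twice (1 , 3), with which u has area 3.
  certificate-6-2 : ∀ σ → σ ≡ + 1 ⊎ σ ≡ -[1+ 0 ] → Certificate (pairList (+ 0) (+ 1) σ 2 6)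
  certificate-6-2 σ σ≡±1 = record
    { D = 1 ; D>0 = s≤s z≤n ; e = + 1 , + 3 ; e-primitive = (+ 0 , + 1) , refl ; bounded = z≤n ∷ ≤-decided ∷ []
    ; A = + 2 ; along = along σ≡±1 ; long = ≤-decided ; wide = wide σ≡±1 }
    where
    along : ∀ {σ} → σ ≡ + 1 ⊎ σ ≡ -[1+ 0 ] → linear (pairList (+ 0) (+ 1) σ 2 6) ≡ (+ 2 , + 6)
    along (inj₁ refl) = refl
    along (inj₂ refl) = refl
    wide : ∀ {σ} → σ ≡ + 1 ⊎ σ ≡ -[1+ 0 ] → 2 ≤ℕ slack 1 (+ 1 , + 3) (pairList (+ 0) (+ 1) σ 2 6)
    wide (inj₁ refl) = ≤-decided
    wide (inj₂ refl) = ≤-decided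

  -- The vertical strip fails by one, since 2 (7 - 4) = 6. But 2 (1 , 0) + 6 (2 , 7) = 14 (1 , 3),
  -- and what is left is 5 parts of u with area 3 and one part of v with area 1, in total 16 ≥ 14.
  certificate-7-2 : ∀ σ → σ ≡ + 1 ⊎ σ ≡ -[1+ 0 ] → Certificate (pairList (+ 2 ℤ.* σ) (+ 6) σ 2 7)
  certificate-7-2 σ σ≡±1 = record
    { D = 7 ; D>0 = s≤s z≤n ; e = + 1 , + 3 ; e-primitive = (+ 0 , + 1) , refl ; bounded = bound σ≡±1 ∷ ≤-decided ∷ []
    ; A = + 14 ; along = along σ≡±1 ; long = ≤-decided ; wide = wide σ≡±1 }
    where
    bound : ∀ {σ} → σ ≡ + 1 ⊎ σ ≡ -[1+ 0 ] → ∣ + 2 ℤ.* σ ∣ ≤ℕ 7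
    bound (inj₁ refl) = ≤-decided
    bound (inj₂ refl) = ≤-decided
    along : ∀ {σ} → σ ≡ + 1 ⊎ σ ≡ -[1+ 0 ] → linear (pairList (+ 2 ℤ.* σ) (+ 6) σ 2 7) ≡ (+ 14 , + 42)
    along (inj₁ refl) = refl
    along (inj₂ refl) = refl
    wide : ∀ {σ} → σ ≡ + 1 ⊎ σ ≡ -[1+ 0 ] → 14 ≤ℕ slack 7 (+ 1 , + 3) (pairList (+ 2 ℤ.* σ) (+ 6) σ 2 7)
    wide (inj₁ refl) = ≤-decided
    wide (inj₂ refl) = ≤-decided

  slabInCoordinates : ∀ {u v a b} (N : NormalForm u v) →
                      Certificate (pairList a b (NormalForm.σ N) (NormalForm.r N) (NormalForm.n N)) → Slab (u ∷ v ∷ [])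
  slabInCoordinates {a = a} {b} N c =
    subst₂ (λ u v → Slab (u ∷ v ∷ [])) (sym u-eq) (sym v-eq)
      (slab-transform p q unimodular (pairList a b σ r n) c)
    where open NormalForm N

  -- For r ≥ 2 and 2 r ≤ n the inequality n ≤ r (n - 4) of the vertical strip fails only for r = 2
  -- and n = 4, 5, 6, 7. All of these except n = 5 have certificates of their own.
  primitivePair : ∀ {u v} (N : NormalForm u v) → 1 ≤ℕ NormalForm.n N →
                  Slab (u ∷ v ∷ []) ⊎ Exceptional (NormalForm.r N) (NormalForm.n N)
  primitivePair {u} {v} N@(record { p = p; q = q; unimodular = uni; σ = σ; ∣σ∣≡1 = ∣σ∣≡1; r = r; n = n; r+r≤n = r+r≤n
                              ; u-eq = u-eq; v-eq = v-eq; area-eq = area-eq }) n≥1 = cases r n r+r≤n n≥1 λ c → slabInCoordinates N c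
    where
    cases : ∀ r n → r ℕ.+ r ≤ℕ n → 1 ≤ℕ n → (∀ {a b} → Certificate (pairList a b σ r n) → Slab (u ∷ v ∷ [])) →
            Slab (u ∷ v ∷ []) ⊎ Exceptional r n
    cases 0 n _ n≥1 _ = inj₂ (width-one n≥1)
    cases 1 n 2≤n _ _ = inj₂ (width-two 2≤n)
    cases r@(suc (suc r′)) n r+r≤n _ slab with n ℕ.≤? r ℕ.* (n ℕ.∸ 4) | n≥4
      where
      n≥4 : 4 ≤ℕ n
      n≥4 = ℕₚ.≤-trans (ℕₚ.+-mono-≤ {2} {r} {2} {r} (s≤s (s≤s z≤n)) (s≤s (s≤s z≤n))) r+r≤n
    ... | yes n≤  | n≥4 = inj₁ (slab (verticalCertificate σ r n ∣σ∣≡1 (s≤s z≤n) r+r≤n n≥4 n≤))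
    ... | no n≰   | s≤s (s≤s (s≤s (s≤s {n = m} z≤n))) = small r′ m r+r≤n n≰ slab
      where
      ±1 = ∣i∣≡1⇒i≡±1 σ ∣σ∣≡1
      six≤ : ∀ r → 6 ≤ℕ (3 ℕ.+ r) ℕ.+ (3 ℕ.+ r)
      six≤ r = ℕₚ.+-mono-≤ (ℕₚ.m≤m+n 3 r) (ℕₚ.m≤m+n 3 r)
      small : ∀ r m → (2 ℕ.+ r) ℕ.+ (2 ℕ.+ r) ≤ℕ 4 ℕ.+ m → ¬ (4 ℕ.+ m ≤ℕ (2 ℕ.+ r) ℕ.* m) →
              (∀ {a b} → Certificate (pairList a b σ (2 ℕ.+ r) (4 ℕ.+ m)) → Slab (u ∷ v ∷ [])) →
              Slab (u ∷ v ∷ []) ⊎ Exceptional (2 ℕ.+ r) (4 ℕ.+ m)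
      small 0 0 _ _ slab = inj₁ (slab (certificate-4-2 σ ±1))
      small 0 1 _ _ _    = inj₂ width-three
      small 0 2 _ _ slab = inj₁ (slab (certificate-6-2 σ ±1))
      small 0 3 _ _ slab = inj₁ (slab (certificate-7-2 σ ±1))
      small (suc r) 0 6≤4 _ _ = contradiction (ℕₚ.≤-trans (six≤ r) 6≤4) λ { (s≤s (s≤s (s≤s (s≤s ())))) }
      small (suc r) 1 6≤5 _ _ = contradiction (ℕₚ.≤-trans (six≤ r) 6≤5) λ { (s≤s (s≤s (s≤s (s≤s (s≤s ()))))) }
      small (suc r) (suc (suc m)) _ n≰ _ =
        contradiction (ℕₚ.≤-trans (ℕₚ.m≤m+n (6 ℕ.+ m) _) (ℕₚ.≤-reflexive (sym (arith r m)))) n≰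
        where
        arith : ∀ r m → (3 ℕ.+ r) ℕ.* (2 ℕ.+ m) ≡ (6 ℕ.+ m) ℕ.+ (2 ℕ.* m ℕ.+ r ℕ.* (2 ℕ.+ m))
        arith = solve-∀
      small r (suc (suc (suc (suc m)))) _ n≰ _ =
        contradiction (ℕₚ.≤-trans (ℕₚ.m≤m+n (8 ℕ.+ m) _) (ℕₚ.≤-reflexive (sym (arith r m)))) n≰
        where
        arith : ∀ r m → (2 ℕ.+ r) ℕ.* (4 ℕ.+ m) ≡ (8 ℕ.+ m) ℕ.+ (m ℕ.+ r ℕ.* (4 ℕ.+ m))
        arith = solve-∀

  -- Generators left out of the relation, and nonprimitive generators

  totalArea : ℤ² → List ℤ² → ℕ
  totalArea e []      = 0
  totalArea e (u ∷ L) = area e u ℕ.+ totalArea e L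

  zeros : List ℤ² → List (ℤ × ℤ²)
  zeros = map (+ 0 ,_)

  vectors-zeros : ∀ L → map proj₂ (zeros L) ≡ L
  vectors-zeros []      = refl
  vectors-zeros (u ∷ L) = cong (u ∷_) (vectors-zeros L)

  bounded-zeros : ∀ {D} L → All (λ k → ∣ proj₁ k ∣ ≤ℕ D) (zeros L)
  bounded-zeros []      = []
  bounded-zeros (_ ∷ L) = z≤n ∷ bounded-zeros L

  linear-zeros : ∀ L → linear (zeros L) ≡ 0²
  linear-zeros []      = refl
  linear-zeros (_ ∷ L) rewrite linear-zeros L = refl

  slack-zeros : ∀ D e L → slack D e (zeros L) ≡ D ℕ.* totalArea e L
  slack-zeros D e []      = sym (ℕₚ.*-zeroʳ D)
  slack-zeros D e (u ∷ L) =
    trans (cong (D ℕ.* area e u ℕ.+_) (slack-zeros D e L)) (sym (ℕₚ.*-distribˡ-+ D (area e u) (totalArea e L)))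

  -- The ray itself is the long side, so all other generators are spent entirely on the extent.
  slabAlongMultiple : ∀ r L → 1 ≤ℕ excess r → 2 ≤ℕ totalArea (direction r) L → Slab (vector r ∷ L)
  slabAlongMultiple r L g≥1 h =
    subst Slab (cong (vector r ∷_) (vectors-zeros L)) (certificate ((+ 1 , vector r) ∷ zeros L) record
      { D = 1 ; D>0 = s≤s z≤n ; e = direction r ; e-primitive = primitive-direction r
      ; bounded = ≤-decided ∷ bounded-zeros L ; A = + multiplicity r
      ; along = trans (cong₂ _⊕_ (•-identity (vector r)) (linear-zeros L)) (cong₂ _,_ (ℤₚ.+-identityʳ _) (ℤₚ.+-identityʳ _))
      ; long = s≤s g≥1
      ; wide = subst (2 ≤ℕ_) (sym (trans (slack-zeros 1 (direction r) L) (ℕₚ.*-identityˡ _))) h })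

  -- Hexagons

  ∣i*j∣≡1⇒∣i∣≡1 : ∀ i j → ∣ i ℤ.* j ∣ ≡ 1 → ∣ i ∣ ≡ 1
  ∣i*j∣≡1⇒∣i∣≡1 i j eq = ℕₚ.m*n≡1⇒m≡1 ∣ i ∣ ∣ j ∣ (trans (sym (ℤₚ.abs-* i j)) eq)

  primitive-•⇒∣k∣≡1 : ∀ k u → Primitive (k • u) → ∣ k ∣ ≡ 1
  primitive-•⇒∣k∣≡1 k u (f , eq) = ∣i*j∣≡1⇒∣i∣≡1 k (det u f) (trans (cong ∣_∣ (sym (det-•ˡ k u f))) (cong ∣_∣ eq))

  primitive-⟦⟧⇒∣k∣≡1 : ∀ p q k x → Primitive (⟦ p , q ⟧ (k • x)) → ∣ k ∣ ≡ 1
  primitive-⟦⟧⇒∣k∣≡1 p q k x prim = primitive-•⇒∣k∣≡1 k (⟦ p , q ⟧ x) (subst Primitive (⟦⟧-• p q k x) prim)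

  -- A negatively oriented basis is corrected by replacing q with `δ • q`, whose determinant with p
  -- is +1.
  unimodularCoordinates : ∀ p q → area p q ≡ 1 → ∀ u →
    ∃[ a ] ∃[ b ] (u ≡ ⟦ p , q ⟧ (a , b) × ∣ a ∣ ≡ area u q × ∣ b ∣ ≡ area p u)
  unimodularCoordinates p q pq u = δ ℤ.* det u q , δ ℤ.* det p u , eq , abs _ , abs _
    where
    δ = det p q
    abs : ∀ k → ∣ δ ℤ.* k ∣ ≡ ∣ k ∣
    abs k = trans (ℤₚ.abs-* δ k) (trans (cong (ℕ._* ∣ k ∣) pq) (ℕₚ.*-identityˡ ∣ k ∣))
    open ≡-Reasoning
    component : ∀ a b → det u (δ • q) ℤ.* a ℤ.+ det p u ℤ.* (δ ℤ.* b) ≡ δ ℤ.* det u q ℤ.* a ℤ.+ δ ℤ.* det p u ℤ.* b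
    component a b = trans (cong (λ k → k ℤ.* a ℤ.+ det p u ℤ.* (δ ℤ.* b)) (det-•ʳ δ u q))
      (solveℤ 5 (λ δ x y a b → δ :* x :* a :+ y :* (δ :* b) := δ :* x :* a :+ δ :* y :* b) refl δ (det u q) (det p u) a b)
    eq : u ≡ ⟦ p , q ⟧ (δ ℤ.* det u q , δ ℤ.* det p u)
    eq = trans (coordinates p (δ • q) (trans (det-•ʳ δ p q) (∣i∣≡1⇒i*i≡1 δ pq)) u)
      (cong₂ _,_ (component (proj₁ p) (proj₁ q)) (component (proj₂ p) (proj₂ q)))

  -- The areas are sorted decreasingly. `wide-enough` is the width inequality of `slabAlongFirst`
  -- with no further generator; the other constructors are the triples that escape it.
  data Areas : (x y z : ℕ) → Set where
    wide-enough   : ∀ {x y z} → 2 ℕ.* x ≤ℕ (x ℕ.∸ y) ℕ.* z ℕ.+ (x ℕ.∸ z) ℕ.* y → Areas x y z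
    unit          : ∀ {x} → Areas x 1 1
    one-two-three : Areas 3 2 1
    equal         : ∀ {z} → 2 ≤ℕ z → Areas z z z

  -- In terms of the smallest area and the gaps j and i, the inequality becomes a comparison of
  -- polynomials whose difference has nonnegative coefficients outside small cases. The
  -- divisibilities dispose of the isosceles triples (z , z , z + 1) with z ≥ 2 and (z , y , y) with
  -- z < y.
  areas : ∀ z j i → 1 ≤ℕ z → (i ≡ 0 → (z ℕ.+ j) ∣ z) → (j ≡ 0 → z ∣ (z ℕ.+ i)) → Areas (z ℕ.+ j ℕ.+ i) (z ℕ.+ j) z
  areas (suc z) j i z≥1 hi hj = cases z j i hi hj
    where
    cases : ∀ z j i → (i ≡ 0 → (suc z ℕ.+ j) ∣ suc z) → (j ≡ 0 → suc z ∣ (suc z ℕ.+ i)) →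
            Areas (suc z ℕ.+ j ℕ.+ i) (suc z ℕ.+ j) (suc z)
    wideBy : ∀ z j i R → i ℕ.* z ℕ.+ (j ℕ.+ i) ℕ.* (z ℕ.+ j) ≡ 2 ℕ.* (z ℕ.+ j ℕ.+ i) ℕ.+ R → Areas (z ℕ.+ j ℕ.+ i) (z ℕ.+ j) z
    wideBy z j i R eq = wide-enough (ℕₚ.≤-trans (ℕₚ.m≤m+n _ R) (ℕₚ.≤-reflexive (trans (sym eq)
      (cong₂ (λ a b → a ℕ.* z ℕ.+ b ℕ.* (z ℕ.+ j)) (sym (ℕₚ.m+n∸m≡n (z ℕ.+ j) i))
        (sym (trans (cong (ℕ._∸ z) (ℕₚ.+-assoc z j i)) (ℕₚ.m+n∸m≡n z (j ℕ.+ i))))))))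

    cases 0 0 i _ _ = unit
    cases (suc z) 0 0 _ _ =
      subst (λ k → Areas k (suc (suc z) ℕ.+ 0) (suc (suc z))) (sym (ℕₚ.+-identityʳ _))
        (subst (λ k → Areas k k (suc (suc z))) (sym (ℕₚ.+-identityʳ _)) (equal (s≤s (s≤s z≤n))))
    cases (suc z) 0 1 _ hj = contradiction (∣1⇒≡1 (∣m+n∣m⇒∣n (hj refl) ∣-refl)) λ ()
    cases (suc z) 0 (suc (suc i)) _ _ = wideBy (suc (suc z)) 0 (suc (suc i)) _ (arith z i)
      where
      arith : ∀ z i → (2 ℕ.+ i) ℕ.* (2 ℕ.+ z) ℕ.+ (0 ℕ.+ (2 ℕ.+ i)) ℕ.* (2 ℕ.+ z ℕ.+ 0)
            ≡ 2 ℕ.* (2 ℕ.+ z ℕ.+ 0 ℕ.+ (2 ℕ.+ i)) ℕ.+ (2 ℕ.* i ℕ.+ 2 ℕ.* z ℕ.+ 2 ℕ.* i ℕ.* z)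
      arith = solve-∀
    cases z (suc j) 0 hi _ = contradiction (∣⇒≤ (hi refl)) (ℕₚ.<⇒≱ (ℕₚ.m<m+n (suc z) z<s))
    cases 0 1 1 _ _ = one-two-three
    cases 0 1 (suc (suc i)) _ _ = wideBy 1 1 (2 ℕ.+ i) _ (arith i)
      where
      arith : ∀ i → (2 ℕ.+ i) ℕ.* 1 ℕ.+ (1 ℕ.+ (2 ℕ.+ i)) ℕ.* (1 ℕ.+ 1) ≡ 2 ℕ.* (1 ℕ.+ 1 ℕ.+ (2 ℕ.+ i)) ℕ.+ i
      arith = solve-∀
    cases 0 (suc (suc j)) (suc i) _ _ = wideBy 1 (2 ℕ.+ j) (1 ℕ.+ i) _ (arith i j)
      where
      arith : ∀ i j → (1 ℕ.+ i) ℕ.* 1 ℕ.+ (2 ℕ.+ j ℕ.+ (1 ℕ.+ i)) ℕ.* (1 ℕ.+ (2 ℕ.+ j))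
            ≡ 2 ℕ.* (1 ℕ.+ (2 ℕ.+ j) ℕ.+ (1 ℕ.+ i)) ℕ.+ (2 ℕ.+ 2 ℕ.* i ℕ.+ 4 ℕ.* j ℕ.+ i ℕ.* j ℕ.+ j ℕ.* j)
      arith = solve-∀
    cases (suc z) (suc j) (suc i) _ _ = wideBy (2 ℕ.+ z) (1 ℕ.+ j) (1 ℕ.+ i) _ (arith z i j)
      where
      arith : ∀ z i j → (1 ℕ.+ i) ℕ.* (2 ℕ.+ z) ℕ.+ (1 ℕ.+ j ℕ.+ (1 ℕ.+ i)) ℕ.* (2 ℕ.+ z ℕ.+ (1 ℕ.+ j))
            ≡ 2 ℕ.* (2 ℕ.+ z ℕ.+ (1 ℕ.+ j) ℕ.+ (1 ℕ.+ i))
              ℕ.+ (2 ℕ.* i ℕ.* z ℕ.+ 3 ℕ.* i ℕ.+ z ℕ.+ 3 ℕ.* j ℕ.+ i ℕ.* j ℕ.+ j ℕ.* z ℕ.+ j ℕ.* j)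
      arith = solve-∀

  -- The vectors satisfy det v w u + det w u v + det u v w = 0, so k divides a multiple of the primitive vector w.
  area-∣ : ∀ {k} u v w → Primitive w → k ∣ area v w → k ∣ area u w → k ∣ area u v
  area-∣ {k} u v w (f , wf) k∣vw k∣uw = subst (k ∣_) (sym area-eq) (∣-combination (ℤ.- det u f) (ℤ.- det v f) (det v w) (det w u)
      k∣vw (subst (k ∣_) (area-swap w u) k∣uw))
    where
    open ≡-Reasoning
    det-eq : det u v ≡ ℤ.- det u f ℤ.* det v w ℤ.+ ℤ.- det v f ℤ.* det w u
    det-eq = begin
      det u v              ≡⟨ trans (cong (det u v ℤ.*_) wf) (ℤₚ.*-identityʳ (det u v)) ⟨
      det u v ℤ.* det w f  ≡⟨ solveℤ 8 (λ a b c d m n x y → :det (a , b) (c , d) :* :det (m , n) (x , y)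
                                  := :- :det (a , b) (x , y) :* :det (c , d) (m , n) :+ :- :det (c , d) (x , y) :* :det (m , n) (a , b))
                                refl (proj₁ u) (proj₂ u) (proj₁ v) (proj₂ v) (proj₁ w) (proj₂ w) (proj₁ f) (proj₂ f) ⟩
      ℤ.- det u f ℤ.* det v w ℤ.+ ℤ.- det v f ℤ.* det w u ∎
    area-eq = cong ∣_∣ det-eq
    ∣-combination : ∀ a b x y → k ∣ ∣ x ∣ → k ∣ ∣ y ∣ → k ∣ ∣ a ℤ.* x ℤ.+ b ℤ.* y ∣
    ∣-combination a b x y hx hy = ℤᵈ.∣⇒∣ᵤ (ℤᵈ.∣m∣n⇒∣m+n (ℤᵈ.∣n⇒∣m*n a (ℤᵈ.∣ᵤ⇒∣ {+ k} {x} hx)) (ℤᵈ.∣n⇒∣m*n b (ℤᵈ.∣ᵤ⇒∣ {+ k} {y} hy)))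

  -- The relation d₂₃ u₁ = - d₃₁ u₂ - d₁₂ u₃ shows that the hexagon contains the segment 2 u₁.
  slabAlongFirst : ∀ u v w → Primitive u → 1 ≤ℕ area v w → area u w ≤ℕ area v w → area u v ≤ℕ area v w → ∀ L →
    2 ℕ.* area v w ≤ℕ (area v w ℕ.∸ area u w) ℕ.* area u v ℕ.+ ((area v w ℕ.∸ area u v) ℕ.* area u w ℕ.+ area v w ℕ.* totalArea u L) →
    Slab (u ∷ v ∷ w ∷ L)
  slabAlongFirst u v w prim D>0 y≤x z≤x L wide =
    subst (λ M → Slab (u ∷ v ∷ w ∷ M)) (vectors-zeros L) (certificate K record
      { D = area v w ; D>0 = D>0 ; e = u ; e-primitive = prim
      ; bounded = ℕₚ.≤-refl
                ∷ ℕₚ.≤-trans (ℕₚ.≤-reflexive (trans (ℤₚ.∣-i∣≡∣i∣ (det w u)) (area-swap u w))) y≤x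
                ∷ ℕₚ.≤-trans (ℕₚ.≤-reflexive (ℤₚ.∣-i∣≡∣i∣ (det u v))) z≤x ∷ bounded-zeros L
      -- The first row uses u in full, and the rows of v and w together reproduce it once more.
      ; A = + 2 ℤ.* det v w
      ; along = trans (cong (λ l → det v w • u ⊕ (ℤ.- det w u • v ⊕ (ℤ.- det u v • w ⊕ l))) (linear-zeros L)) (along u v w)
      ; long = ℕₚ.≤-reflexive (sym (ℤₚ.abs-* (+ 2) (det v w)))
      ; wide = ℕₚ.≤-trans wide (ℕₚ.≤-reflexive slack-eq)
      })
    where
    K = (det v w , u) ∷ (ℤ.- det w u , v) ∷ (ℤ.- det u v , w) ∷ zeros L
    along : ∀ u v w → det v w • u ⊕ (ℤ.- det w u • v ⊕ (ℤ.- det u v • w ⊕ 0²)) ≡ (+ 2 ℤ.* det v w) • u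
    along (a , b) (c , d) (m , n) = cong₂ _,_
      (solveℤ 6 (λ a b c d m n → :det (c , d) (m , n) :* a :+ (:- :det (m , n) (a , b) :* c :+ (:- :det (a , b) (c , d) :* m :+ con (+ 0)))
        := (con (+ 2) :* :det (c , d) (m , n)) :* a) refl a b c d m n)
      (solveℤ 6 (λ a b c d m n → :det (c , d) (m , n) :* b :+ (:- :det (m , n) (a , b) :* d :+ (:- :det (a , b) (c , d) :* n :+ con (+ 0)))
        := (con (+ 2) :* :det (c , d) (m , n)) :* b) refl a b c d m n)
    slack-eq : (area v w ℕ.∸ area u w) ℕ.* area u v ℕ.+ ((area v w ℕ.∸ area u v) ℕ.* area u w ℕ.+ area v w ℕ.* totalArea u L)
             ≡ slack (area v w) u K
    slack-eq = sym (trans (cong₂ ℕ._+_ (trans (cong ((area v w ℕ.∸ area v w) ℕ.*_) (area-self u)) (ℕₚ.*-zeroʳ (area v w ℕ.∸ area v w)))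
        (cong₂ ℕ._+_ (cong (λ k → (area v w ℕ.∸ k) ℕ.* area u v) (trans (ℤₚ.∣-i∣≡∣i∣ (det w u)) (area-swap u w)))
          (cong₂ ℕ._+_ (cong (λ k → (area v w ℕ.∸ k) ℕ.* area u w) (ℤₚ.∣-i∣≡∣i∣ (det u v))) (slack-zeros (area v w) u L))))
      refl)

  ∣i∣≡n⇒i≡±n : ∀ i {n} → ∣ i ∣ ≡ n → i ≡ + n ⊎ i ≡ ℤ.- + n
  ∣i∣≡n⇒i≡±n (+ n)    refl = inj₁ refl
  ∣i∣≡n⇒i≡±n -[1+ n ] refl = inj₂ refl


  x-axis : ∀ u v → ⟦ u , v ⟧ (+ 1 , + 0) ≡ u
  x-axis (a , b) (c , d) = cong₂ _,_
      (solveℤ 2 (λ a c → con (+ 1) :* a :+ con (+ 0) :* c := a) refl a c)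
      (solveℤ 2 (λ a c → con (+ 1) :* a :+ con (+ 0) :* c := a) refl b d)
  y-axis : ∀ u v → ⟦ u , v ⟧ (+ 0 , + 1) ≡ v
  y-axis (a , b) (c , d) = cong₂ _,_
      (solveℤ 2 (λ a c → con (+ 0) :* a :+ con (+ 1) :* c := c) refl a c)
      (solveℤ 2 (λ a c → con (+ 0) :* a :+ con (+ 1) :* c := c) refl b d)
  K123 : ℤ → ℤ → ℤ → List (ℤ × ℤ²)
  K123 s a b = (s , (+ 1 , + 0)) ∷ (+ 0 , (+ 0 , + 1)) ∷ (+ 1 , (a , b)) ∷ []

  -- Adding u with the sign of a makes both coordinates of w even, so the sum is 2 e with e = (±2 ,
  -- ±1). The untouched (0 , 1) has area 2 with this e.
  certificate-1-2-3 : ∀ a b → a ≡ + 3 ⊎ a ≡ -[1+ 2 ] → b ≡ + 2 ⊎ b ≡ -[1+ 1 ] → ∃[ s ] Certificate (K123 s a b)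
  certificate-1-2-3 _ _ (inj₁ refl) (inj₁ refl) = + 1 , record
      { D = 1 ; D>0 = ≤-decided ; e = + 2 , + 1 ; e-primitive = (+ 1 , + 1) , refl ; bounded = ≤-decided ∷ ≤-decided ∷ ≤-decided ∷ [] ; A = + 2
      ; along = refl ; long = ≤-decided ; wide = ≤-decided }
  certificate-1-2-3 _ _ (inj₁ refl) (inj₂ refl) = + 1 , record
      { D = 1 ; D>0 = ≤-decided ; e = + 2 , -[1+ 0 ] ; e-primitive = (-[1+ 0 ] , + 1) , refl ; bounded = ≤-decided ∷ ≤-decided ∷ ≤-decided ∷ [] ; A = + 2
      ; along = refl ; long = ≤-decided ; wide = ≤-decided }
  certificate-1-2-3 _ _ (inj₂ refl) (inj₁ refl) = -[1+ 0 ] , record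
      { D = 1 ; D>0 = ≤-decided ; e = -[1+ 1 ] , + 1 ; e-primitive = (-[1+ 0 ] , + 0) , refl ; bounded = ≤-decided ∷ ≤-decided ∷ ≤-decided ∷ [] ; A = + 2
      ; along = refl ; long = ≤-decided ; wide = ≤-decided }
  certificate-1-2-3 _ _ (inj₂ refl) (inj₂ refl) = -[1+ 0 ] , record
      { D = 1 ; D>0 = ≤-decided ; e = -[1+ 1 ] , -[1+ 0 ] ; e-primitive = (+ 1 , + 0) , refl ; bounded = ≤-decided ∷ ≤-decided ∷ ≤-decided ∷ [] ; A = + 2
      ; along = refl ; long = ≤-decided ; wide = ≤-decided }

  slab-1-2-3 : ∀ u v w → area v w ≡ 3 → area u w ≡ 2 → area u v ≡ 1 → Slab (u ∷ v ∷ w ∷ [])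
  slab-1-2-3 u v w vw≡3 uw≡2 uv≡1 = inCoordinates (unimodularCoordinates u v uv≡1 w)
    where
    inCoordinates : ∃[ a ] ∃[ b ] (w ≡ ⟦ u , v ⟧ (a , b) × ∣ a ∣ ≡ area w v × ∣ b ∣ ≡ area u w) → Slab (u ∷ v ∷ w ∷ [])
    inCoordinates (a , b , w≡ , ∣a∣ , ∣b∣) =
      subst (λ l → Slab (u ∷ v ∷ l ∷ [])) (sym w≡)
        (subst₂ (λ k l → Slab (k ∷ l ∷ ⟦ u , v ⟧ (a , b) ∷ [])) (x-axis u v) (y-axis u v)
          (slab-transform u v uv≡1 (K123 (proj₁ c) a b) (proj₂ c)))
      where
      c = certificate-1-2-3 a b (∣i∣≡n⇒i≡±n a (trans ∣a∣ (trans (area-swap v w) vw≡3))) (∣i∣≡n⇒i≡±n b (trans ∣b∣ uw≡2))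

  -- The strip in the direction (0 , 1); the relation v + β w - m σ u = 2 n (0 , 1) bounds it.
  equalCertificate : ∀ σ β s t n → ∣ σ ∣ ≡ 1 → ∣ β ∣ ≡ 1 → 3 ≤ℕ s ℕ.+ t → s ℕ.+ t ≤ℕ n →
    Certificate ((+ (s ℕ.+ t) ℤ.* ℤ.- σ , (σ , + 0)) ∷ (+ 1 , (+ s , + n)) ∷ (β , β • (+ t , + n)) ∷ [])
  equalCertificate σ β s t n ∣σ∣≡1 ∣β∣≡1 3≤m m≤n = record
    { D = n ; D>0 = n>0 ; e = + 0 , + 1 ; e-primitive = (-[1+ 0 ] , + 0) , refl
    ; bounded = ℕₚ.≤-trans (ℕₚ.≤-reflexive abs-a) m≤n ∷ n>0 ∷ ℕₚ.≤-trans (ℕₚ.≤-reflexive ∣β∣≡1) n>0 ∷ []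
    ; A = + 2 ℤ.* + n
    ; along = cong₂ _,_ x-eq y-eq
    ; long = ℕₚ.≤-reflexive (sym (ℤₚ.abs-* (+ 2) (+ n)))
    ; wide = wide
    }
    where
    open ≡-Reasoning
    m = s ℕ.+ t
    n>0 : 1 ≤ℕ n
    n>0 = ℕₚ.≤-trans (ℕₚ.≤-trans ≤-decided 3≤m) m≤n
    abs-a : ∣ + m ℤ.* ℤ.- σ ∣ ≡ m
    abs-a = trans (ℤₚ.abs-* (+ m) (ℤ.- σ))
      (trans (cong (m ℕ.*_) (trans (ℤₚ.∣-i∣≡∣i∣ σ) ∣σ∣≡1)) (ℕₚ.*-identityʳ m))
    x-eq : + m ℤ.* ℤ.- σ ℤ.* σ ℤ.+ (+ 1 ℤ.* + s ℤ.+ (β ℤ.* (β ℤ.* + t) ℤ.+ + 0)) ≡ (+ 2 ℤ.* + n) ℤ.* + 0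
    x-eq = begin
      (+ s ℤ.+ + t) ℤ.* ℤ.- σ ℤ.* σ ℤ.+ (+ 1 ℤ.* + s ℤ.+ (β ℤ.* (β ℤ.* + t) ℤ.+ + 0))
        ≡⟨ solveℤ 4 (λ s t σ β → (s :+ t) :* (:- σ) :* σ :+ (con (+ 1) :* s :+ (β :* (β :* t) :+ con (+ 0)))
             := (s :+ t) :* (con (+ 1) :- σ :* σ) :+ t :* (β :* β :- con (+ 1))) refl (+ s) (+ t) σ β ⟩
      (+ s ℤ.+ + t) ℤ.* (+ 1 ℤ.- σ ℤ.* σ) ℤ.+ + t ℤ.* (β ℤ.* β ℤ.- + 1)
        ≡⟨ cong₂ (λ k l → (+ s ℤ.+ + t) ℤ.* (+ 1 ℤ.- k) ℤ.+ + t ℤ.* (l ℤ.- + 1)) (∣i∣≡1⇒i*i≡1 σ ∣σ∣≡1) (∣i∣≡1⇒i*i≡1 β ∣β∣≡1) ⟩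
      (+ s ℤ.+ + t) ℤ.* + 0 ℤ.+ + t ℤ.* + 0
        ≡⟨ solveℤ 3 (λ s t n → (s :+ t) :* con (+ 0) :+ t :* con (+ 0) := con (+ 2) :* n :* con (+ 0)) refl (+ s) (+ t) (+ n) ⟩
      + 2 ℤ.* + n ℤ.* + 0 ∎
    y-eq : + m ℤ.* ℤ.- σ ℤ.* + 0 ℤ.+ (+ 1 ℤ.* + n ℤ.+ (β ℤ.* (β ℤ.* + n) ℤ.+ + 0)) ≡ (+ 2 ℤ.* + n) ℤ.* + 1
    y-eq = begin
      + m ℤ.* ℤ.- σ ℤ.* + 0 ℤ.+ (+ 1 ℤ.* + n ℤ.+ (β ℤ.* (β ℤ.* + n) ℤ.+ + 0))
        ≡⟨ solveℤ 4 (λ m σ β n → m :* (:- σ) :* con (+ 0) :+ (con (+ 1) :* n :+ (β :* (β :* n) :+ con (+ 0)))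
             := (con (+ 1) :+ β :* β) :* n) refl (+ m) σ β (+ n) ⟩
      (+ 1 ℤ.+ β ℤ.* β) ℤ.* + n
        ≡⟨ cong (λ k → (+ 1 ℤ.+ k) ℤ.* + n) (∣i∣≡1⇒i*i≡1 β ∣β∣≡1) ⟩
      + 2 ℤ.* + n
        ≡⟨ ℤₚ.*-identityʳ (+ 2 ℤ.* + n) ⟨
      + 2 ℤ.* + n ℤ.* + 1 ∎
    area-e : ∀ x y → area (+ 0 , + 1) (x , y) ≡ ∣ x ∣
    area-e x y = trans (cong ∣_∣ (solveℤ 2 (λ r n → con (+ 0) :* n :- con (+ 1) :* r := :- r) refl x y)) (ℤₚ.∣-i∣≡∣i∣ x)
    K = (+ m ℤ.* ℤ.- σ , (σ , + 0)) ∷ (+ 1 , (+ s , + n)) ∷ (β , β • (+ t , + n)) ∷ []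
    slack-eq : slack n (+ 0 , + 1) K ≡ (n ℕ.∸ m) ℕ.* 1 ℕ.+ ((n ℕ.∸ 1) ℕ.* s ℕ.+ ((n ℕ.∸ 1) ℕ.* t ℕ.+ 0))
    slack-eq = cong₂ ℕ._+_ (cong₂ (λ i j → (n ℕ.∸ i) ℕ.* j) abs-a (trans (area-e σ (+ 0)) ∣σ∣≡1))
      (cong₂ ℕ._+_ (cong ((n ℕ.∸ 1) ℕ.*_) (area-e (+ s) (+ n)))
        (cong (ℕ._+ 0) (cong₂ (λ i j → (n ℕ.∸ i) ℕ.* j) ∣β∣≡1
          (trans (area-e (β ℤ.* + t) (β ℤ.* + n)) (trans (ℤₚ.abs-* β (+ t)) (trans (cong (ℕ._* t) ∣β∣≡1) (ℕₚ.*-identityˡ t)))))))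
    -- With m = s + t the slack is n + m (n - 2), which reaches 2 n as soon as n ≥ m ≥ 3.
    bound : ∀ s t n → 3 ≤ℕ s ℕ.+ t → s ℕ.+ t ≤ℕ n →
      2 ℕ.* n ≤ℕ (n ℕ.∸ (s ℕ.+ t)) ℕ.* 1 ℕ.+ ((n ℕ.∸ 1) ℕ.* s ℕ.+ ((n ℕ.∸ 1) ℕ.* t ℕ.+ 0))
    bound s t n 3≤ ≤n with ℕₚ.m≤n⇒∃[o]m+o≡n 3≤ | ℕₚ.m≤n⇒∃[o]m+o≡n ≤n
    ... | k , eq | c , refl = subst (λ i → 2 ℕ.* (i ℕ.+ c) ≤ℕ lhs) eq
        (ℕₚ.≤-trans (ℕₚ.m≤m+n (2 ℕ.* (3 ℕ.+ k ℕ.+ c)) (k ℕ.* (2 ℕ.+ k ℕ.+ c) ℕ.+ k ℕ.+ 2 ℕ.* c)) (ℕₚ.≤-reflexive (sym lhs-eq)))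
      where
      factor : ∀ a s t → a ℕ.* s ℕ.+ (a ℕ.* t ℕ.+ 0) ≡ a ℕ.* (s ℕ.+ t)
      factor = solve-∀
      arith : ∀ k c → c ℕ.* 1 ℕ.+ (2 ℕ.+ k ℕ.+ c) ℕ.* (3 ℕ.+ k)
            ≡ 2 ℕ.* (3 ℕ.+ k ℕ.+ c) ℕ.+ (k ℕ.* (2 ℕ.+ k ℕ.+ c) ℕ.+ k ℕ.+ 2 ℕ.* c)
      arith = solve-∀
      lhs = (s ℕ.+ t ℕ.+ c ℕ.∸ (s ℕ.+ t)) ℕ.* 1 ℕ.+ ((s ℕ.+ t ℕ.+ c ℕ.∸ 1) ℕ.* s ℕ.+ ((s ℕ.+ t ℕ.+ c ℕ.∸ 1) ℕ.* t ℕ.+ 0))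
      lhs-eq : lhs ≡ 2 ℕ.* (3 ℕ.+ k ℕ.+ c) ℕ.+ (k ℕ.* (2 ℕ.+ k ℕ.+ c) ℕ.+ k ℕ.+ 2 ℕ.* c)
      lhs-eq = begin
        lhs
          ≡⟨ cong₂ (λ i j → i ℕ.* 1 ℕ.+ j) (ℕₚ.m+n∸m≡n (s ℕ.+ t) c) (factor (s ℕ.+ t ℕ.+ c ℕ.∸ 1) s t) ⟩
        c ℕ.* 1 ℕ.+ (s ℕ.+ t ℕ.+ c ℕ.∸ 1) ℕ.* (s ℕ.+ t)
          ≡⟨ cong (λ i → c ℕ.* 1 ℕ.+ (i ℕ.+ c ℕ.∸ 1) ℕ.* i) eq ⟨
        c ℕ.* 1 ℕ.+ (2 ℕ.+ k ℕ.+ c) ℕ.* (3 ℕ.+ k)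
          ≡⟨ arith k c ⟩
        2 ℕ.* (3 ℕ.+ k ℕ.+ c) ℕ.+ (k ℕ.* (2 ℕ.+ k ℕ.+ c) ℕ.+ k ℕ.+ 2 ℕ.* c) ∎
    wide : 2 ℕ.* n ≤ℕ slack n (+ 0 , + 1) K
    wide = ℕₚ.≤-trans (bound s t n 3≤m m≤n) (ℕₚ.≤-reflexive (sym slack-eq))

  -- In normal form, equal areas force w to be, up to sign, (t , n) with t = r + 1 or t = r - 1.
  -- Primitivity of v and w together with n ≥ 2 then keeps r + t between 3 and n, the range in which
  -- `equalCertificate` works.
  slab-equal : ∀ {u v w} → Primitive v → Primitive w → (N : NormalForm u v) → 2 ≤ℕ NormalForm.n N →
               area u w ≡ NormalForm.n N → area v w ≡ NormalForm.n N → Slab (u ∷ v ∷ w ∷ [])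
  slab-equal {u} {v} {w} v-prim w-prim record { p = p; q = q; unimodular = uni; σ = σ; ∣σ∣≡1 = ∣σ∣≡1; r = r; n = n
      ; r+r≤n = r+r≤n; u-eq = refl; v-eq = refl; area-eq = _ } n≥2 uw≡n vw≡n =
    inCoordinates (unimodularCoordinates p q uni w)
    where
    notMultiple : ∀ {v} → Primitive v → ∀ k x → ∣ k ∣ ≢ 1 → v ≢ ⟦ p , q ⟧ (k • x)
    notMultiple prim k x k≢1 eq = k≢1 (primitive-⟦⟧⇒∣k∣≡1 p q k x (subst Primitive eq prim))

    multiple : ∀ k a b {a′ b′} → k ℤ.* a ≡ a′ → k ℤ.* b ≡ b′ → ⟦ p , q ⟧ (a′ , b′) ≡ ⟦ p , q ⟧ (k • (a , b))
    multiple k a b refl refl = refl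

    n≢1 : n ≢ 1
    n≢1 refl = contradiction n≥2 λ { (s≤s ()) }

    slab : ∀ β t → ∣ β ∣ ≡ 1 → w ≡ ⟦ p , q ⟧ (β • (+ t , + n)) → 3 ≤ℕ r ℕ.+ t → r ℕ.+ t ≤ℕ n → Slab (u ∷ v ∷ w ∷ [])
    slab β t ∣β∣≡1 w≡ 3≤ ≤n = subst (λ w → Slab (u ∷ v ∷ w ∷ [])) (sym w≡)
      (slab-transform p q uni ((+ (r ℕ.+ t) ℤ.* ℤ.- σ , (σ , + 0)) ∷ (+ 1 , (+ r , + n)) ∷ (β , β • (+ t , + n)) ∷ [])
        (equalCertificate σ β r t n ∣σ∣≡1 ∣β∣≡1 3≤ ≤n))

    r≢0 : r ≢ 0
    r≢0 refl = notMultiple v-prim (+ n) (+ 0 , + 1) n≢1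
      (multiple (+ n) (+ 0) (+ 1) (ℤₚ.*-zeroʳ (+ n)) (ℤₚ.*-identityʳ (+ n)))

    *-assoc-cancel : ∀ β k → ∣ β ∣ ≡ 1 → β ℤ.* (β ℤ.* k) ≡ k
    *-assoc-cancel β k ∣β∣≡1 = trans (sym (ℤₚ.*-assoc β β k)) (trans (cong (ℤ._* k) (∣i∣≡1⇒i*i≡1 β ∣β∣≡1)) (ℤₚ.*-identityˡ k))

    above : ∀ β → ∣ β ∣ ≡ 1 → w ≡ ⟦ p , q ⟧ (β • (+ suc r , + n)) → Slab (u ∷ v ∷ w ∷ [])
    above β ∣β∣≡1 w≡ = slab β (suc r) ∣β∣≡1 w≡ (3≤ r r≢0) (subst (_≤ℕ n) (sym (ℕₚ.+-suc r r)) (ℕₚ.≤∧≢⇒< r+r≤n r+r≢n))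
      where
      3≤ : ∀ r → r ≢ 0 → 3 ≤ℕ r ℕ.+ suc r
      3≤ 0 r≢0 = contradiction refl r≢0
      3≤ (suc r) _ = ℕₚ.+-mono-≤ {1} {suc r} {2} {suc (suc r)} (s≤s z≤n) (s≤s (s≤s z≤n))
      2β≢1 : ∣ β ℤ.* + 2 ∣ ≢ 1
      2β≢1 eq = contradiction (trans (sym eq) (trans (ℤₚ.abs-* β (+ 2)) (cong (ℕ._* 2) ∣β∣≡1))) λ ()
      double : ∀ r → + r ℤ.* + 2 ≡ + (r ℕ.+ r)
      double r = solveℤ 1 (λ r → r :* con (+ 2) := r :+ r) refl (+ r)
      -- If 2 r = n then v = r (1 , 2), which forces r = 1 and n = 2; but then w is, up to sign,
      -- twice (1 , 1).
      r+r≢n : r ℕ.+ r ≢ n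
      r+r≢n eq with r ℕ.≟ 1
      ... | no r≢1 = notMultiple v-prim (+ r) (+ 1 , + 2) r≢1
        (multiple (+ r) (+ 1) (+ 2) (ℤₚ.*-identityʳ (+ r)) (trans (double r) (cong +_ eq)))
      ... | yes r≡1 = notMultiple w-prim (β ℤ.* + 2) (+ 1 , + 1) 2β≢1 (trans w≡
        (multiple (β ℤ.* + 2) (+ 1) (+ 1)
          (trans (ℤₚ.*-identityʳ (β ℤ.* + 2)) (cong (λ r → β ℤ.* + suc r) (sym r≡1)))
          (trans (ℤₚ.*-identityʳ (β ℤ.* + 2)) (cong (λ m → β ℤ.* + m) (trans (cong (λ r → r ℕ.+ r) (sym r≡1)) eq)))))

    below : ∀ β → ∣ β ∣ ≡ 1 → ∀ s → r ≡ suc s → w ≡ ⟦ p , q ⟧ (β • (+ s , + n)) → Slab (u ∷ v ∷ w ∷ [])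
    below β ∣β∣≡1 0 _ w≡ = contradiction
      (trans w≡ (multiple (β ℤ.* + n) (+ 0) (+ 1) (trans (ℤₚ.*-zeroʳ (β ℤ.* + n)) (sym (ℤₚ.*-zeroʳ β))) (ℤₚ.*-identityʳ (β ℤ.* + n))))
      (notMultiple w-prim (β ℤ.* + n) (+ 0 , + 1)
        λ eq → n≢1 (trans (sym (trans (ℤₚ.abs-* β (+ n)) (trans (cong (ℕ._* n) ∣β∣≡1) (ℕₚ.*-identityˡ n)))) eq))
    below β ∣β∣≡1 (suc s) r≡ w≡ = slab β (suc s) ∣β∣≡1 w≡
      (subst (λ r → 3 ≤ℕ r ℕ.+ suc s) (sym r≡) (ℕₚ.+-mono-≤ {2} {suc (suc s)} {1} {suc s} (s≤s (s≤s z≤n)) (s≤s z≤n)))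
      (ℕₚ.≤-trans (ℕₚ.+-monoʳ-≤ r (ℕₚ.≤-trans (ℕₚ.n≤1+n (suc s)) (ℕₚ.≤-reflexive (sym r≡)))) r+r≤n)

    inCoordinates : ∃[ a ] ∃[ b ] (w ≡ ⟦ p , q ⟧ (a , b) × ∣ a ∣ ≡ area w q × ∣ b ∣ ≡ area p w) → Slab (u ∷ v ∷ w ∷ [])
    inCoordinates (a , b , w≡ , _ , _) = choose (∣i∣≡1⇒i≡±1 κ ∣κ∣≡1)
      where
      open ≡-Reasoning
      β = proj₁ (signed b)
      ∣β∣≡1 = proj₁ (proj₂ (signed b))
      ∣b∣≡n : ∣ b ∣ ≡ n
      ∣b∣≡n = begin
        ∣ b ∣                                        ≡⟨ ℕₚ.*-identityˡ ∣ b ∣ ⟨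
        1 ℕ.* ∣ b ∣                                  ≡⟨ cong (ℕ._* ∣ b ∣) ∣σ∣≡1 ⟨
        ∣ σ ∣ ℕ.* ∣ b ∣                              ≡⟨ ℤₚ.abs-* σ b ⟨
        ∣ σ ℤ.* b ∣                                  ≡⟨ cong ∣_∣ (solveℤ 3 (λ σ a b → σ :* b := σ :* b :- con (+ 0) :* a) refl σ a b) ⟩
        area (σ , + 0) (a , b)                       ≡⟨ area-⟦⟧ p q uni (σ , + 0) (a , b) ⟨
        area u (⟦ p , q ⟧ (a , b))                   ≡⟨ cong (area u) w≡ ⟨
        area u w                                     ≡⟨ uw≡n ⟩
        n                                            ∎
      b-eq : b ≡ β ℤ.* + n
      b-eq = trans (proj₂ (proj₂ (signed b))) (trans (cong (λ k → + k ℤ.* β) ∣b∣≡n) (ℤₚ.*-comm (+ n) β))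
      -- Writing w = β (t , n) gives γ = β (t - r) and κ = t - r. The area of v and w is n times the
      -- absolute value of γ, so κ is a sign.
      γ = a ℤ.- + r ℤ.* β
      κ = β ℤ.* γ
      n*∣γ∣≡n : n ℕ.* ∣ γ ∣ ≡ n
      n*∣γ∣≡n = begin
        n ℕ.* ∣ γ ∣                                  ≡⟨ ℤₚ.abs-* (+ n) γ ⟨
        ∣ + n ℤ.* γ ∣                                ≡⟨ ℤₚ.∣-i∣≡∣i∣ (+ n ℤ.* γ) ⟨
        ∣ ℤ.- (+ n ℤ.* γ) ∣                          ≡⟨ cong ∣_∣ (solveℤ 4 (λ n a r β → :- (n :* (a :- r :* β)) := r :* (β :* n) :- n :* a)
                                                          refl (+ n) a (+ r) β) ⟩
        area (+ r , + n) (a , β ℤ.* + n)             ≡⟨ cong (λ b → area (+ r , + n) (a , b)) b-eq ⟨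
        area (+ r , + n) (a , b)                     ≡⟨ area-⟦⟧ p q uni (+ r , + n) (a , b) ⟨
        area v (⟦ p , q ⟧ (a , b))                   ≡⟨ cong (area v) w≡ ⟨
        area v w                                     ≡⟨ vw≡n ⟩
        n                                            ∎
      ∣γ∣≡1 : ∣ γ ∣ ≡ 1
      ∣γ∣≡1 = ℕₚ.*-cancelˡ-≡ ∣ γ ∣ 1 n {{ℕ.>-nonZero (ℕₚ.≤-trans ≤-decided n≥2)}} (trans n*∣γ∣≡n (sym (ℕₚ.*-identityʳ n)))
      ∣κ∣≡1 : ∣ κ ∣ ≡ 1
      ∣κ∣≡1 = trans (ℤₚ.abs-* β γ) (cong₂ ℕ._*_ ∣β∣≡1 ∣γ∣≡1)
      a-eq : a ≡ β ℤ.* (+ r ℤ.+ κ)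
      a-eq = begin
        a                              ≡⟨ solveℤ 3 (λ a r β → a := β :* r :+ (a :- r :* β)) refl a (+ r) β ⟩
        β ℤ.* + r ℤ.+ γ                ≡⟨ cong (λ k → β ℤ.* + r ℤ.+ k) (*-assoc-cancel β γ ∣β∣≡1) ⟨
        β ℤ.* + r ℤ.+ β ℤ.* κ          ≡⟨ ℤₚ.*-distribˡ-+ β (+ r) κ ⟨
        β ℤ.* (+ r ℤ.+ κ)              ∎
      w-eq : ∀ t → + r ℤ.+ κ ≡ t → w ≡ ⟦ p , q ⟧ (β • (t , + n))
      w-eq t eq = trans w≡ (cong₂ (λ a b → ⟦ p , q ⟧ (a , b)) (trans a-eq (cong (β ℤ.*_) eq)) b-eq)
      choose : κ ≡ + 1 ⊎ κ ≡ -[1+ 0 ] → Slab (u ∷ v ∷ w ∷ [])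
      choose (inj₁ κ≡1) = above β ∣β∣≡1 (w-eq (+ suc r) (trans (cong (λ k → + r ℤ.+ k) κ≡1) (cong +_ (ℕₚ.+-comm r 1))))
      choose (inj₂ κ≡-1) = predecessor r refl
        where
        predecessor : ∀ m → m ≡ r → Slab (u ∷ v ∷ w ∷ [])
        predecessor 0       eq = contradiction (sym eq) r≢0
        predecessor (suc s) eq = below β ∣β∣≡1 s (sym eq) (w-eq (+ s) (trans (cong₂ (λ i j → + i ℤ.+ j) (sym eq) κ≡-1) refl))

  -- The three alternatives record which generator belongs to both unit areas; the narrow direction
  -- and the pair of equal coefficients in a dependence are read off from it.
  TwoUnit : ℤ² → ℤ² → ℤ² → Set
  TwoUnit u v w = (area u v ≡ 1 × area u w ≡ 1) ⊎ (area u v ≡ 1 × area v w ≡ 1) ⊎ (area u w ≡ 1 × area v w ≡ 1)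

  Hexagon : ℤ² → ℤ² → ℤ² → Set
  Hexagon u v w = Slab (u ∷ v ∷ w ∷ []) ⊎ TwoUnit u v w

  hexagon-swap₁ : ∀ u v w → Hexagon v u w → Hexagon u v w
  hexagon-swap₁ u v w (inj₁ s)                      = inj₁ (permute (swap v u ↭-refl) s)
  hexagon-swap₁ u v w (inj₂ (inj₁ (vu , vw)))        = inj₂ (inj₂ (inj₁ (trans (area-swap v u) vu , vw)))
  hexagon-swap₁ u v w (inj₂ (inj₂ (inj₁ (vu , uw)))) = inj₂ (inj₁ (trans (area-swap v u) vu , uw))
  hexagon-swap₁ u v w (inj₂ (inj₂ (inj₂ (vw , uw)))) = inj₂ (inj₂ (inj₂ (uw , vw)))

  hexagon-swap₂ : ∀ u v w → Hexagon u w v → Hexagon u v w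
  hexagon-swap₂ u v w (inj₁ s)                      = inj₁ (permute (prep u (swap w v ↭-refl)) s)
  hexagon-swap₂ u v w (inj₂ (inj₁ (uw , uv)))        = inj₂ (inj₁ (uv , uw))
  hexagon-swap₂ u v w (inj₂ (inj₂ (inj₁ (uw , wv)))) = inj₂ (inj₂ (inj₂ (uw , trans (area-swap w v) wv)))
  hexagon-swap₂ u v w (inj₂ (inj₂ (inj₂ (uv , wv)))) = inj₂ (inj₂ (inj₁ (uv , trans (area-swap w v) wv)))

  -- When two areas coincide, `area-∣` shows that their common value divides the third. These are
  -- the two divisibilities that `areas` asks for.
  hexagon-sorted : ∀ u v w → Primitive u → Primitive v → Primitive w →
                   1 ≤ℕ area u v → area u v ≤ℕ area u w → area u w ≤ℕ area v w → Hexagon u v w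
  hexagon-sorted u v w u-prim v-prim w-prim uv≥1 uv≤uw uw≤vw =
    gaps (area u v) (area u w) (area v w) refl refl refl (ℕₚ.m≤n⇒∃[o]m+o≡n uv≤uw) (ℕₚ.m≤n⇒∃[o]m+o≡n uw≤vw)
    where
    conclude : ∀ {x y z} → Areas x y z → area u v ≡ z → area u w ≡ y → area v w ≡ x → Hexagon u v w
    conclude (wide-enough le) refl refl refl =
      inj₁ (slabAlongFirst u v w u-prim (ℕₚ.≤-trans uv≥1 (ℕₚ.≤-trans uv≤uw uw≤vw)) uw≤vw (ℕₚ.≤-trans uv≤uw uw≤vw) []
        (ℕₚ.≤-trans le (ℕₚ.+-monoʳ-≤ ((area v w ℕ.∸ area u w) ℕ.* area u v) (ℕₚ.m≤m+n ((area v w ℕ.∸ area u v) ℕ.* area u w) _))))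
    conclude unit          uv uw vw = inj₂ (inj₁ (uv , uw))
    conclude one-two-three uv uw vw = inj₁ (slab-1-2-3 u v w vw uw uv)
    conclude (equal z≥2)   uv uw vw = inj₁ (slab-equal v-prim w-prim N (subst (2 ≤ℕ_) z≡n z≥2) (trans uw z≡n) (trans vw z≡n))
      where
      N = normalForm u v u-prim uv≥1
      z≡n = trans (sym uv) (NormalForm.area-eq N)

    gaps : ∀ z y x → area u v ≡ z → area u w ≡ y → area v w ≡ x →
           ∃[ j ] z ℕ.+ j ≡ y → ∃[ i ] y ℕ.+ i ≡ x → Hexagon u v w
    gaps z _ _ uv uw vw (j , refl) (i , refl) =
      conclude (areas z j i (subst (1 ≤ℕ_) uv uv≥1) y∣z z∣x) uv uw vw
      where
      y∣z : i ≡ 0 → (z ℕ.+ j) ∣ z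
      y∣z refl = subst ((z ℕ.+ j) ∣_) uv (area-∣ u v w w-prim
        (subst ((z ℕ.+ j) ∣_) (sym (trans vw (ℕₚ.+-identityʳ _))) ∣-refl) (subst ((z ℕ.+ j) ∣_) (sym uw) ∣-refl))
      z∣x : j ≡ 0 → z ∣ (z ℕ.+ i)
      z∣x refl = subst (z ∣_) (trans vw (cong (ℕ._+ i) (ℕₚ.+-identityʳ z))) (area-∣ v w u u-prim
        (subst (z ∣_) (sym (trans (area-swap u w) (trans uw (ℕₚ.+-identityʳ z)))) ∣-refl)
        (subst (z ∣_) (sym (trans (area-swap u v) uv)) ∣-refl))

  hexagon-primitive : ∀ u v w → Primitive u → Primitive v → Primitive w →
                      1 ≤ℕ area u v → 1 ≤ℕ area u w → 1 ≤ℕ area v w → Hexagon u v w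
  hexagon-primitive u v w pu pv pw uv uw vw =
    sort (ℕₚ.≤-total (area u v) (area u w)) (ℕₚ.≤-total (area u w) (area v w)) (ℕₚ.≤-total (area u v) (area v w))
    where
    le : ∀ {a a′ b b′} → a ≡ a′ → b ≡ b′ → a′ ≤ℕ b′ → a ≤ℕ b
    le refl refl h = h
    pos : ∀ {a a′} → a ≡ a′ → 1 ≤ℕ a′ → 1 ≤ℕ a
    pos refl h = h
    vu = area-swap u v
    wu = area-swap u w
    wv = area-swap v w
    sort : area u v ≤ℕ area u w ⊎ area u w ≤ℕ area u v → area u w ≤ℕ area v w ⊎ area v w ≤ℕ area u w →
           area u v ≤ℕ area v w ⊎ area v w ≤ℕ area u v → Hexagon u v w
    sort (inj₁ uv≤uw) (inj₁ uw≤vw) _ = hexagon-sorted u v w pu pv pw uv uv≤uw uw≤vw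
    sort (inj₁ uv≤uw) (inj₂ vw≤uw) (inj₁ uv≤vw) = hexagon-swap₁ u v w
      (hexagon-sorted v u w pv pu pw (pos vu uv) (le vu refl uv≤vw) vw≤uw)
    sort (inj₁ uv≤uw) (inj₂ vw≤uw) (inj₂ vw≤uv) = hexagon-swap₁ u v w (hexagon-swap₂ v u w
      (hexagon-sorted v w u pv pw pu vw (le refl vu vw≤uv) (le vu wu uv≤uw)))
    sort (inj₂ uw≤uv) (inj₁ uw≤vw) (inj₁ uv≤vw) = hexagon-swap₂ u v w
      (hexagon-sorted u w v pu pw pv uw uw≤uv (le refl wv uv≤vw))
    sort (inj₂ uw≤uv) (inj₁ uw≤vw) (inj₂ vw≤uv) = hexagon-swap₂ u v w (hexagon-swap₁ u w v
      (hexagon-sorted w u v pw pu pv (pos wu uw) (le wu wv uw≤vw) (le wv refl vw≤uv)))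
    sort (inj₂ uw≤uv) (inj₂ vw≤uw) _ = hexagon-swap₁ u v w (hexagon-swap₂ v u w (hexagon-swap₁ v w u
      (hexagon-sorted w v u pw pv pu (pos wv vw) (le wv wu vw≤uw) (le wu vu uw≤uv))))

  -- Pairs and triples of rays

  Independent : Ray → Ray → Set
  Independent r s = 1 ≤ℕ area (direction r) (direction s)

  area-vector : ∀ r s → area (vector r) (vector s) ≡ multiplicity r ℕ.* (multiplicity s ℕ.* area (direction r) (direction s))
  area-vector r s = trans (area-•ˡ (+ multiplicity r) (direction r) (vector s))
    (cong (multiplicity r ℕ.*_) (area-•ʳ (+ multiplicity s) (direction r) (direction s)))

  direction≤vector : ∀ r s → area (direction r) (direction s) ≤ℕ area (direction r) (vector s)
  direction≤vector r s = ℕₚ.≤-trans (ℕₚ.m≤n*m _ (multiplicity s))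
    (ℕₚ.≤-reflexive (sym (area-•ʳ (+ multiplicity s) (direction r) (direction s))))

  independent-area : ∀ r s → Independent r s → 1 ≤ℕ area (vector r) (vector s)
  independent-area r s rs = ℕₚ.≤-trans rs (ℕₚ.≤-trans (direction≤vector r s) (ℕₚ.≤-trans (ℕₚ.m≤n*m _ (multiplicity r))
    (ℕₚ.≤-reflexive (sym (area-•ˡ (+ multiplicity r) (direction r) (vector s))))))

  independent-sym : ∀ {r s} → Independent r s → Independent s r
  independent-sym {r} {s} = subst (1 ≤ℕ_) (sym (area-swap (direction r) (direction s)))

  vector-primitive : ∀ r → excess r ≡ 0 → Primitive (vector r)
  vector-primitive r refl = subst Primitive (sym (•-identity (direction r))) (primitive-direction r)

  -- Each of the two other rays contributes at least 1 to the extent.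
  slabOfTriple : ∀ r s t → 1 ≤ℕ excess r → Independent r s → Independent r t → Slab (vector r ∷ vector s ∷ vector t ∷ [])
  slabOfTriple r s t g≥1 rs rt = slabAlongMultiple r (vector s ∷ vector t ∷ []) g≥1
    (ℕₚ.+-mono-≤ (ℕₚ.≤-trans rs (direction≤vector r s)) (ℕₚ.≤-trans (ℕₚ.≤-trans rt (direction≤vector r t)) (ℕₚ.m≤m+n _ 0)))

  -- The second ray has lattice length at least 2, so it alone provides the extent.
  slabOfPair : ∀ r s → 1 ≤ℕ excess r → 1 ≤ℕ excess s → Independent r s → Slab (vector r ∷ vector s ∷ [])
  slabOfPair r s r≥1 s≥1 rs = slabAlongMultiple r (vector s ∷ []) r≥1
    (ℕₚ.≤-trans (ℕₚ.*-mono-≤ (s≤s s≥1) rs)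
      (ℕₚ.≤-trans (ℕₚ.≤-reflexive (sym (area-•ʳ (+ multiplicity s) (direction r) (direction s)))) (ℕₚ.m≤m+n _ 0)))

  hexagon : ∀ r s t → Independent r s → Independent r t → Independent s t → Hexagon (vector r) (vector s) (vector t)
  hexagon r s t rs rt st = cases (excess r) (excess s) (excess t) refl refl refl
    where
    positive : ∀ {g k} → g ≡ suc k → 1 ≤ℕ g
    positive refl = s≤s z≤n
    cases : ∀ i j k → excess r ≡ i → excess s ≡ j → excess t ≡ k → Hexagon (vector r) (vector s) (vector t)
    cases (suc _) _ _ eq _ _ = inj₁ (slabOfTriple r s t (positive eq) rs rt)
    cases 0 (suc _) _ _ eq _ = hexagon-swap₁ (vector r) (vector s) (vector t)
      (inj₁ (slabOfTriple s r t (positive eq) (independent-sym {r} {s} rs) st))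
    cases 0 0 (suc _) _ _ eq = hexagon-swap₂ (vector r) (vector s) (vector t) (hexagon-swap₁ (vector r) (vector t) (vector s)
      (inj₁ (slabOfTriple t r s (positive eq) (independent-sym {r} {t} rt) (independent-sym {s} {t} st))))
    cases 0 0 0 r≡ s≡ t≡ = hexagon-primitive (vector r) (vector s) (vector t)
      (vector-primitive r r≡) (vector-primitive s s≡) (vector-primitive t t≡)
      (independent-area r s rs) (independent-area r t rt) (independent-area s t st)

  -- Four directions

  AllUnit : ℤ² → ℤ² → ℤ² → Set
  AllUnit u v w = area u v ≡ 1 × area u w ≡ 1 × area v w ≡ 1

  -- For areas (1 , 1 , x) the hexagon's slack 2 (x - 1) misses the required 2 x by only 2, and a
  -- fourth generator spent on the extent alone adds at least x. So only x = 1 resists.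
  allUnitOrSlab : ∀ u v w z → 1 ≤ℕ area u v → 1 ≤ℕ area u w → 1 ≤ℕ area v w →
                  1 ≤ℕ area u z → 1 ≤ℕ area v z → 1 ≤ℕ area w z →
                  Hexagon u v w → Slab (u ∷ v ∷ w ∷ z ∷ []) ⊎ AllUnit u v w
  allUnitOrSlab u v w z uv≥1 uw≥1 vw≥1 uz≥1 vz≥1 wz≥1 = cases
    where
    slab : ∀ u v w → area u v ≡ 1 → area u w ≡ 1 → 2 ≤ℕ area v w → 1 ≤ℕ area u z → Slab (u ∷ v ∷ w ∷ z ∷ [])
    slab u v w uv uw vw uz = slabAlongFirst u v w (area≡1⇒Primitive u v uv) vw>0
        (ℕₚ.≤-trans (ℕₚ.≤-reflexive uw) vw>0) (ℕₚ.≤-trans (ℕₚ.≤-reflexive uv) vw>0) (z ∷ [])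
        (subst₂ (λ i j → 2 ℕ.* area v w ≤ℕ (area v w ℕ.∸ j) ℕ.* i ℕ.+ ((area v w ℕ.∸ i) ℕ.* j ℕ.+ area v w ℕ.* (area u z ℕ.+ 0)))
          (sym uv) (sym uw) (bound (area v w) (area u z) vw uz))
      where
      vw>0 : 1 ≤ℕ area v w
      vw>0 = ℕₚ.≤-trans (s≤s z≤n) vw
      bound : ∀ x a → 2 ≤ℕ x → 1 ≤ℕ a → 2 ℕ.* x ≤ℕ (x ℕ.∸ 1) ℕ.* 1 ℕ.+ ((x ℕ.∸ 1) ℕ.* 1 ℕ.+ x ℕ.* (a ℕ.+ 0))
      bound (suc (suc x)) (suc a) _ _ = ℕₚ.≤-trans (ℕₚ.m≤m+n (2 ℕ.* (2 ℕ.+ x)) _) (ℕₚ.≤-reflexive (sym (arith x a)))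
        where
        arith : ∀ x a → (1 ℕ.+ x) ℕ.* 1 ℕ.+ ((1 ℕ.+ x) ℕ.* 1 ℕ.+ (2 ℕ.+ x) ℕ.* (1 ℕ.+ a ℕ.+ 0))
              ≡ 2 ℕ.* (2 ℕ.+ x) ℕ.+ (x ℕ.+ (2 ℕ.+ x) ℕ.* a)
        arith = solve-∀
      bound 0 _ () _
      bound 1 _ (s≤s ()) _
    oneOrMore : ∀ {n} → 1 ≤ℕ n → n ≡ 1 ⊎ 2 ≤ℕ n
    oneOrMore {1}           _ = inj₁ refl
    oneOrMore {suc (suc n)} _ = inj₂ (s≤s (s≤s z≤n))
    shared₁ : area u v ≡ 1 → area u w ≡ 1 → area v w ≡ 1 ⊎ 2 ≤ℕ area v w → Slab (u ∷ v ∷ w ∷ z ∷ []) ⊎ AllUnit u v w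
    shared₁ uv uw (inj₁ vw) = inj₂ (uv , uw , vw)
    shared₁ uv uw (inj₂ vw) = inj₁ (slab u v w uv uw vw uz≥1)
    shared₂ : area u v ≡ 1 → area v w ≡ 1 → area u w ≡ 1 ⊎ 2 ≤ℕ area u w → Slab (u ∷ v ∷ w ∷ z ∷ []) ⊎ AllUnit u v w
    shared₂ uv vw (inj₁ uw) = inj₂ (uv , uw , vw)
    shared₂ uv vw (inj₂ uw) = inj₁ (permute (swap v u ↭-refl) (slab v u w (trans (area-swap u v) uv) vw uw vz≥1))
    shared₃ : area u w ≡ 1 → area v w ≡ 1 → area u v ≡ 1 ⊎ 2 ≤ℕ area u v → Slab (u ∷ v ∷ w ∷ z ∷ []) ⊎ AllUnit u v w
    shared₃ uw vw (inj₁ uv) = inj₂ (uv , uw , vw)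
    shared₃ uw vw (inj₂ uv) = inj₁ (permute (↭-trans (swap w u ↭-refl) (prep u (swap w v ↭-refl)))
      (slab w u v (trans (area-swap u w) uw) (trans (area-swap v w) vw) uv wz≥1))
    cases : Hexagon u v w → Slab (u ∷ v ∷ w ∷ z ∷ []) ⊎ AllUnit u v w
    cases (inj₁ s) = inj₁ (permute (↭-trans (swap z u ↭-refl) (prep u (↭-trans (swap z v ↭-refl) (prep v (swap z w ↭-refl))))) (weaken s))
    cases (inj₂ (inj₁ (uv , uw)))        = shared₁ uv uw (oneOrMore vw≥1)
    cases (inj₂ (inj₂ (inj₁ (uv , vw)))) = shared₂ uv vw (oneOrMore uw≥1)
    cases (inj₂ (inj₂ (inj₂ (uw , vw)))) = shared₃ uw vw (oneOrMore uv≥1)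

  -- Modulo 2 the Plücker relation would read 1 + 1 + 1 = 0.
  ¬allUnit : ∀ u v w z → AllUnit u v w → area u z ≡ 1 → area v z ≡ 1 → area w z ≡ 1 → ⊥
  ¬allUnit u v w z (uv , uw , vw) uz vz wz =
    odd _ _ _ (±1 (det u v) (det w z) uv wz) (±1 (det u w) (det v z) uw vz) (±1 (det u z) (det v w) uz vw) (plücker u v w z)
    where
    ±1 : ∀ i j → ∣ i ∣ ≡ 1 → ∣ j ∣ ≡ 1 → i ℤ.* j ≡ + 1 ⊎ i ℤ.* j ≡ -[1+ 0 ]
    ±1 i j i≡ j≡ = ∣i∣≡1⇒i≡±1 (i ℤ.* j) (trans (ℤₚ.abs-* i j) (cong₂ ℕ._*_ i≡ j≡))
    plücker : ∀ u v w z → det u v ℤ.* det w z ℤ.- det u w ℤ.* det v z ℤ.+ det u z ℤ.* det v w ≡ + 0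
    plücker (a , b) (c , d) (m , n) (x , y) = solveℤ 8 (λ a b c d m n x y →
      :det (a , b) (c , d) :* :det (m , n) (x , y) :- :det (a , b) (m , n) :* :det (c , d) (x , y)
        :+ :det (a , b) (x , y) :* :det (c , d) (m , n) := con (+ 0)) refl a b c d m n x y
    odd : ∀ i j k → i ≡ + 1 ⊎ i ≡ -[1+ 0 ] → j ≡ + 1 ⊎ j ≡ -[1+ 0 ] → k ≡ + 1 ⊎ k ≡ -[1+ 0 ] → i ℤ.- j ℤ.+ k ≢ + 0
    odd _ _ _ (inj₁ refl) (inj₁ refl) (inj₁ refl) ()
    odd _ _ _ (inj₁ refl) (inj₁ refl) (inj₂ refl) ()
    odd _ _ _ (inj₁ refl) (inj₂ refl) (inj₁ refl) ()
    odd _ _ _ (inj₁ refl) (inj₂ refl) (inj₂ refl) ()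
    odd _ _ _ (inj₂ refl) (inj₁ refl) (inj₁ refl) ()
    odd _ _ _ (inj₂ refl) (inj₁ refl) (inj₂ refl) ()
    odd _ _ _ (inj₂ refl) (inj₂ refl) (inj₁ refl) ()
    odd _ _ _ (inj₂ refl) (inj₂ refl) (inj₂ refl) ()

  -- The three triples through r contain all six pairs of rays; if none of them yields a
  -- certificate, all six areas are 1.
  slabOfFour : ∀ r s t q → Independent r s → Independent r t → Independent r q →
               Independent s t → Independent s q → Independent t q →
               Slab (vector r ∷ vector s ∷ vector t ∷ vector q ∷ [])
  slabOfFour r s t q rs rt rq st sq tq = cases
    (allUnitOrSlab u v w z uv uw vw uz vz wz (hexagon r s t rs rt st))
    (allUnitOrSlab u v z w uv uz vz uw vw (sw w z wz) (hexagon r s q rs rq sq))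
    (allUnitOrSlab u w z v uw uz wz uv (sw v w vw) (sw v z vz) (hexagon r t q rt rq tq))
    where
    u = vector r
    v = vector s
    w = vector t
    z = vector q
    uv = independent-area r s rs
    uw = independent-area r t rt
    uz = independent-area r q rq
    vw = independent-area s t st
    vz = independent-area s q sq
    wz = independent-area t q tq
    sw : ∀ u v → 1 ≤ℕ area u v → 1 ≤ℕ area v u
    sw u v = subst (1 ≤ℕ_) (sym (area-swap u v))
    cases : Slab (u ∷ v ∷ w ∷ z ∷ []) ⊎ AllUnit u v w → Slab (u ∷ v ∷ z ∷ w ∷ []) ⊎ AllUnit u v z →
            Slab (u ∷ w ∷ z ∷ v ∷ []) ⊎ AllUnit u w z → Slab (u ∷ v ∷ w ∷ z ∷ [])
    cases (inj₁ l) _ _ = l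
    cases (inj₂ _) (inj₁ l) _ = permute (prep u (prep v (swap z w ↭-refl))) l
    cases (inj₂ _) (inj₂ _) (inj₁ l) = permute (prep u (↭-trans (prep w (swap z v ↭-refl)) (swap w v ↭-refl))) l
    cases (inj₂ uvw) (inj₂ (_ , uz , vz)) (inj₂ (_ , _ , wz)) = ⊥-elim (¬allUnit u v w z uvw uz vz wz)

  slab-++ : ∀ {L} M → Slab L → Slab (L ++ M)
  slab-++ {L} M s = permute (++-comm M L) (weakenBy M s)
    where
    weakenBy : ∀ M → Slab L → Slab (M ++ L)
    weakenBy []      s = s
    weakenBy (_ ∷ M) s = weaken (weakenBy M s)

  excessOfUnit : ∀ r s → area (vector r) (vector s) ≡ 1 → excess r ≡ 0 × excess s ≡ 0
  excessOfUnit r s rs = ℕₚ.suc-injective (ℕₚ.m*n≡1⇒m≡1 (multiplicity r) _ eq) ,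
    ℕₚ.suc-injective (ℕₚ.m*n≡1⇒m≡1 (multiplicity s) _ (ℕₚ.m*n≡1⇒n≡1 (multiplicity r) _ eq))
    where
    eq = trans (sym (area-vector r s)) rs

  zeroOrPositive : ∀ n → n ≡ 0 ⊎ 1 ≤ℕ n
  zeroOrPositive 0       = inj₁ refl
  zeroOrPositive (suc n) = inj₂ (s≤s z≤n)

  -- Lattice widths computed with integers

  dot : ℤ² → ℤ² → ℤ
  dot (a , b) (c , d) = a ℤ.* c ℤ.+ b ℤ.* d

  widthAlong : ℤ² → List ℤ² → ℕ
  widthAlong z []      = 0
  widthAlong z (u ∷ L) = ∣ dot z u ∣ ℕ.+ widthAlong z L

  rotate : ℤ² → ℤ²
  rotate (a , b) = ℤ.- b , a

  dot-rotate : ∀ u v → dot (rotate u) v ≡ det u v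
  dot-rotate (a , b) (c , d) = solveℤ 4 (λ a b c d → (:- b) :* c :+ a :* d := a :* d :- b :* c) refl a b c d

  rotate-nonzero : ∀ u v → area u v ≡ 1 → rotate u ≢ 0²
  rotate-nonzero u v uv≡1 eq = contradiction
    (trans (sym uv≡1) (cong ∣_∣ (trans (sym (dot-rotate u v)) (cong (λ z → dot z v) eq)))) λ ()

  -- Across u the generators have widths equal to their areas with u, here 0, 1 and 1.
  widthOfShared : ∀ u v w → area u v ≡ 1 → area u w ≡ 1 → widthAlong (rotate u) (u ∷ v ∷ w ∷ []) ≡ 2
  widthOfShared u v w uv uw = cong₂ ℕ._+_ (trans (abs u) (area-self u))
    (cong₂ ℕ._+_ (trans (abs v) uv) (cong (ℕ._+ 0) (trans (abs w) uw)))
    where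
    abs : ∀ v → ∣ dot (rotate u) v ∣ ≡ area u v
    abs v = cong ∣_∣ (dot-rotate u v)

  orthogonalToTwo : ∀ z u v → 1 ≤ℕ area u v → dot z u ≡ + 0 → dot z v ≡ + 0 → z ≡ 0²
  orthogonalToTwo (x , y) (a , b) (c , d) uv≥1 zu zv = cong₂ _,_
    (cancel x (trans (solveℤ 6 (λ a b c d x y → (a :* d :- b :* c) :* x := d :* (x :* a :+ y :* b) :- b :* (x :* c :+ y :* d))
      refl a b c d x y) (vanish d b zu zv)))
    (cancel y (trans (solveℤ 6 (λ a b c d x y → (a :* d :- b :* c) :* y := a :* (x :* c :+ y :* d) :- c :* (x :* a :+ y :* b))
      refl a b c d x y) (vanish a c zv zu)))
    where
    vanish : ∀ i j {k l} → k ≡ + 0 → l ≡ + 0 → i ℤ.* k ℤ.- j ℤ.* l ≡ + 0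
    vanish i j refl refl = cong₂ ℤ._-_ (ℤₚ.*-zeroʳ i) (ℤₚ.*-zeroʳ j)
    cancel : ∀ x → det (a , b) (c , d) ℤ.* x ≡ + 0 → x ≡ + 0
    cancel x eq with ℤₚ.i*j≡0⇒i≡0∨j≡0 (det (a , b) (c , d)) eq
    ... | inj₁ det≡0 = contradiction (subst (1 ≤ℕ_) (cong ∣_∣ det≡0) uv≥1) λ ()
    ... | inj₂ x≡0   = x≡0

  -- A nonzero functional vanishes on at most one of three pairwise independent generators, and each
  -- of the others adds at least 1.
  hexagonWidth≥2 : ∀ u v w → 1 ≤ℕ area u v → 1 ≤ℕ area u w → 1 ≤ℕ area v w → ∀ z → z ≢ 0² → 2 ≤ℕ widthAlong z (u ∷ v ∷ w ∷ [])
  hexagonWidth≥2 u v w uv uw vw z z≢0 = bound (∣ dot z u ∣) (∣ dot z v ∣) (∣ dot z w ∣)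
      (λ zu zv → z≢0 (orthogonalToTwo z u v uv (ℤₚ.∣i∣≡0⇒i≡0 {dot z u} zu) (ℤₚ.∣i∣≡0⇒i≡0 {dot z v} zv)))
      (λ zu zw → z≢0 (orthogonalToTwo z u w uw (ℤₚ.∣i∣≡0⇒i≡0 {dot z u} zu) (ℤₚ.∣i∣≡0⇒i≡0 {dot z w} zw)))
      (λ zv zw → z≢0 (orthogonalToTwo z v w vw (ℤₚ.∣i∣≡0⇒i≡0 {dot z v} zv) (ℤₚ.∣i∣≡0⇒i≡0 {dot z w} zw)))
    where
    bound : ∀ i j k → (i ≡ 0 → j ≢ 0) → (i ≡ 0 → k ≢ 0) → (j ≡ 0 → k ≢ 0) → 2 ≤ℕ i ℕ.+ (j ℕ.+ (k ℕ.+ 0))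
    bound 0 0 _ ij _ _ = contradiction refl (ij refl)
    bound 0 (suc j) 0 _ ik _ = contradiction refl (ik refl)
    bound 0 (suc j) (suc k) _ _ _ = s≤s (ℕₚ.≤-trans (s≤s z≤n) (ℕₚ.m≤n+m (suc (k ℕ.+ 0)) j))
    bound (suc i) 0 0 _ _ jk = contradiction refl (jk refl)
    bound (suc i) 0 (suc k) _ _ _ = s≤s (ℕₚ.≤-trans (s≤s z≤n) (ℕₚ.m≤n+m (suc (k ℕ.+ 0)) i))
    bound (suc i) (suc j) k _ _ _ = s≤s (ℕₚ.≤-trans (s≤s z≤n) (ℕₚ.m≤n+m (suc (j ℕ.+ (k ℕ.+ 0))) i))

  -- For b ≠ 0 the triangle inequality gives k ≤ |k b| ≤ p |a| + |p a + k b|.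
  parallelogramWidth≥ : ∀ p k m → m ≤ℕ suc p → (∀ i j → k ≤ℕ p ℕ.* i ℕ.+ j → m ≤ℕ i ℕ.+ (j ℕ.+ 0)) →
    ∀ z → z ≢ 0² → m ≤ℕ widthAlong z (e₁ ∷ (+ p , + k) ∷ [])
  parallelogramWidth≥ p k m m≤ bound z z≢0 = cases z z≢0
    where
    first : ∀ a b → dot (a , b) e₁ ≡ a
    first a b = solveℤ 2 (λ a b → a :* con (+ 1) :+ b :* con (+ 0) := a) refl a b
    axis : ∀ a → ∣ dot (a , + 0) (+ p , + k) ∣ ≡ ∣ a ∣ ℕ.* p
    axis a = trans (cong ∣_∣ (solveℤ 3 (λ a p k → a :* p :+ con (+ 0) :* k := a :* p) refl a (+ p) (+ k))) (ℤₚ.abs-* a (+ p))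
    onAxis : ∀ a → a ≢ + 0 → m ≤ℕ widthAlong (a , + 0) (e₁ ∷ (+ p , + k) ∷ [])
    onAxis a a≢0 = subst₂ (λ i j → m ≤ℕ i ℕ.+ (j ℕ.+ 0)) (cong ∣_∣ (sym (first a (+ 0)))) (sym (axis a))
      (atLeast ∣ a ∣ (λ eq → a≢0 (ℤₚ.∣i∣≡0⇒i≡0 eq)))
      where
      atLeast : ∀ i → i ≢ 0 → m ≤ℕ i ℕ.+ (i ℕ.* p ℕ.+ 0)
      atLeast 0       i≢0 = contradiction refl i≢0
      atLeast (suc i) _   = ℕₚ.≤-trans m≤ (s≤s (ℕₚ.≤-trans (ℕₚ.≤-trans (ℕₚ.m≤m+n p (i ℕ.* p)) (ℕₚ.m≤m+n _ 0)) (ℕₚ.m≤n+m _ i)))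
    offAxis : ∀ a b → b ≢ + 0 → m ≤ℕ widthAlong (a , b) (e₁ ∷ (+ p , + k) ∷ [])
    offAxis a b b≢0 = subst (λ i → m ≤ℕ i ℕ.+ (c ℕ.+ 0)) (cong ∣_∣ (sym (first a b)))
      (bound ∣ a ∣ c (ℕₚ.≤-trans (k≤ ∣ b ∣ (λ eq → b≢0 (ℤₚ.∣i∣≡0⇒i≡0 eq))) triangle))
      where
      c = ∣ dot (a , b) (+ p , + k) ∣
      k≤ : ∀ i → i ≢ 0 → k ≤ℕ k ℕ.* i
      k≤ 0       i≢0 = contradiction refl i≢0
      k≤ (suc i) _   = ℕₚ.m≤m*n k (suc i)
      triangle : k ℕ.* ∣ b ∣ ≤ℕ p ℕ.* ∣ a ∣ ℕ.+ c
      triangle = ℕₚ.≤-trans (ℕₚ.≤-reflexive (trans (sym (ℤₚ.abs-* (+ k) b)) (cong ∣_∣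
          (solveℤ 4 (λ a b p k → k :* b := :- (p :* a) :+ (a :* p :+ b :* k)) refl a b (+ p) (+ k)))))
        (ℕₚ.≤-trans (ℤₚ.∣i+j∣≤∣i∣+∣j∣ (ℤ.- (+ p ℤ.* a)) (dot (a , b) (+ p , + k)))
          (ℕₚ.≤-reflexive (cong (ℕ._+ c) (trans (ℤₚ.∣-i∣≡∣i∣ (+ p ℤ.* a)) (ℤₚ.abs-* (+ p) a)))))
    cases : ∀ z → z ≢ 0² → m ≤ℕ widthAlong z (e₁ ∷ (+ p , + k) ∷ [])
    cases (a , + 0)         z≢0 = onAxis a λ a≡0 → z≢0 (cong (_, + 0) a≡0)
    cases (a , b@(+ suc _)) _   = offAxis a b λ ()
    cases (a , b@(-[1+ _ ])) _  = offAxis a b λ ()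

  width-e₁ : ∀ p k → widthAlong e₁ (e₁ ∷ (+ p , + k) ∷ []) ≡ suc p
  width-e₁ p k = cong suc (trans (ℕₚ.+-identityʳ _)
    (cong ∣_∣ (solveℤ 2 (λ p k → con (+ 1) :* p :+ con (+ 0) :* k := p) refl (+ p) (+ k))))

  narrowDirection : ∀ u v w → TwoUnit u v w → ∃[ z ] (z ≢ 0² × widthAlong z (u ∷ v ∷ w ∷ []) ≡ 2)
  narrowDirection u v w (inj₁ (uv , uw)) = rotate u , rotate-nonzero u v uv , widthOfShared u v w uv uw
  narrowDirection u v w (inj₂ (inj₁ (uv , vw))) = rotate v , rotate-nonzero v w vw ,
    trans (exchangeℕ (∣ dot (rotate v) u ∣) (∣ dot (rotate v) v ∣) _) (widthOfShared v u w (trans (area-swap u v) uv) vw)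
    where
    exchangeℕ : ∀ a b c → a ℕ.+ (b ℕ.+ c) ≡ b ℕ.+ (a ℕ.+ c)
    exchangeℕ = solve-∀
  narrowDirection u v w (inj₂ (inj₂ (uw , vw))) = rotate w , rotate-nonzero w v (trans (area-swap v w) vw) ,
    trans (cycle (∣ dot (rotate w) u ∣) (∣ dot (rotate w) v ∣) (∣ dot (rotate w) w ∣))
      (widthOfShared w u v (trans (area-swap u w) uw) (trans (area-swap v w) vw))
    where
    cycle : ∀ a b c → a ℕ.+ (b ℕ.+ (c ℕ.+ 0)) ≡ c ℕ.+ (a ℕ.+ (b ℕ.+ 0))
    cycle = solve-∀

  area-e₁ : ∀ p k → area e₁ (p , + k) ≡ k
  area-e₁ p k = cong ∣_∣ (solveℤ 2 (λ p k → con (+ 1) :* k :- con (+ 0) :* p := k) refl p (+ k))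

  volumes : ∀ u v w → 1 ≤ℕ area u v → 1 ≤ℕ area u w → 1 ≤ℕ area v w → TwoUnit u v w →
            ∃[ k ] (1 ≤ℕ k × area u v ∷ area u w ∷ area v w ∷ [] ↭ 1 ∷ 1 ∷ k ∷ [])
  volumes u v w uv≥1 uw≥1 vw≥1 (inj₁ (uv , uw)) = area v w , vw≥1 ,
    subst₂ (λ i j → i ∷ j ∷ area v w ∷ [] ↭ 1 ∷ 1 ∷ area v w ∷ []) (sym uv) (sym uw) ↭-refl
  volumes u v w uv≥1 uw≥1 vw≥1 (inj₂ (inj₁ (uv , vw))) = area u w , uw≥1 ,
    subst₂ (λ i j → i ∷ area u w ∷ j ∷ [] ↭ 1 ∷ 1 ∷ area u w ∷ []) (sym uv) (sym vw) (prep 1 (swap (area u w) 1 ↭-refl))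
  volumes u v w uv≥1 uw≥1 vw≥1 (inj₂ (inj₂ (uw , vw))) = area u v , uv≥1 ,
    subst₂ (λ i j → area u v ∷ i ∷ j ∷ [] ↭ 1 ∷ 1 ∷ area u v ∷ []) (sym uw) (sym vw)
      (↭-trans (swap (area u v) 1 ↭-refl) (prep 1 (swap (area u v) 1 ↭-refl)))

  ⟦⟧-standard : ∀ u → ⟦ (+ 1 , + 0) , (+ 0 , + 1) ⟧ u ≡ u
  ⟦⟧-standard u = sym (trans (coordinates (+ 1 , + 0) (+ 0 , + 1) refl u)
      (cong₂ (λ a b → ⟦ (+ 1 , + 0) , (+ 0 , + 1) ⟧ (a , b)) (first (proj₁ u) (proj₂ u)) (second (proj₁ u) (proj₂ u))))
    where
    first : ∀ a b → a ℤ.* + 1 ℤ.- b ℤ.* + 0 ≡ a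
    first a b = solveℤ 2 (λ a b → a :* con (+ 1) :- b :* con (+ 0) := a) refl a b
    second : ∀ a b → + 1 ℤ.* b ℤ.- + 0 ℤ.* a ≡ b
    second a b = solveℤ 2 (λ a b → con (+ 1) :* b :- con (+ 0) :* a := b) refl a b

open Lattice
open Lattice.Ray

module Plane (𝓡 : RealNumbers) where

  open Geometry 𝓡
  open RealNumbers 𝓡 using (1≉0; inverseʳ; +-monoˡ; *-nonNeg; supremum)
  open CommutativeRing (RealNumbers.commutativeRing 𝓡) using
    ( refl; sym; trans; reflexive; setoid; ring; semiring; +-cong; +-congˡ; +-congʳ; *-cong; *-congˡ; *-congʳ; -‿cong
    ; +-assoc; +-comm; +-identityˡ; +-identityʳ; -‿inverseʳ; *-assoc; *-comm; *-identityˡ; *-identityʳ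
    ; zeroˡ; zeroʳ; distribˡ; distribʳ)
  open DecTotalOrder (RealNumbers.decTotalOrder 𝓡) using (antisym; total)
    renaming (refl to ≤-refl; trans to ≤-trans; reflexive to ≤-reflexive; ≤-respˡ-≈ to ≤-respˡ; ≤-respʳ-≈ to ≤-respʳ)
  open Max (DecTotalOrder.totalOrder (RealNumbers.decTotalOrder 𝓡)) using (⊔-cong; ⊔-comm)
  open RingProperties ring using (-‿distribˡ-*; -‿distribʳ-*; -‿involutive; -0#≈0#; -‿+-comm)
  open Mult semiring using (×-homo-+; ×1-homo-*)
  open SetoidReasoning setoid

  -- The embedding of the integers into the reals

  fromℤ-⊖ : ∀ m n → fromℤ (m ⊖ n) ≈ m · 1# - n · 1#
  fromℤ-⊖ m       zero    = begin
    fromℤ (m ⊖ 0)     ≡⟨ ≡.cong fromℤ (ℤₚ.⊖-≥ {m} z≤n) ⟩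
    m · 1#            ≈⟨ +-identityʳ (m · 1#) ⟨
    m · 1# + 0#       ≈⟨ +-congˡ -0#≈0# ⟨
    m · 1# - 0#       ∎
  fromℤ-⊖ zero    (suc n) = sym (+-identityˡ (- (suc n · 1#)))
  fromℤ-⊖ (suc m) (suc n) = begin
    fromℤ (suc m ⊖ suc n)                    ≡⟨ ≡.cong fromℤ (ℤₚ.[1+m]⊖[1+n]≡m⊖n m n) ⟩
    fromℤ (m ⊖ n)                            ≈⟨ fromℤ-⊖ m n ⟩
    m · 1# - n · 1#                          ≈⟨ +-congʳ (+-identityˡ (m · 1#)) ⟨
    (0# + m · 1#) - n · 1#                   ≈⟨ +-congʳ (+-congʳ (-‿inverseʳ 1#)) ⟨
    (1# - 1# + m · 1#) - n · 1#              ≈⟨ +-congʳ (+-assoc 1# (- 1#) (m · 1#)) ⟩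
    (1# + (- 1# + m · 1#)) - n · 1#          ≈⟨ +-congʳ (+-congˡ (+-comm (- 1#) (m · 1#))) ⟩
    (1# + (m · 1# - 1#)) - n · 1#            ≈⟨ +-congʳ (+-assoc 1# (m · 1#) (- 1#)) ⟨
    ((1# + m · 1#) - 1#) - n · 1#            ≈⟨ +-assoc (1# + m · 1#) (- 1#) (- (n · 1#)) ⟩
    (1# + m · 1#) + (- 1# - n · 1#)          ≈⟨ +-congˡ (-‿+-comm 1# (n · 1#)) ⟩
    (1# + m · 1#) - (1# + n · 1#)            ∎

  fromℤ-+ : ∀ i j → fromℤ (i ℤ.+ j) ≈ fromℤ i + fromℤ j
  fromℤ-+ (+ m)    (+ n)    = ×-homo-+ 1# m n
  fromℤ-+ (+ m)    -[1+ n ] = fromℤ-⊖ m (suc n)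
  fromℤ-+ -[1+ m ] (+ n)    = trans (fromℤ-⊖ n (suc m)) (+-comm (n · 1#) (- (suc m · 1#)))
  fromℤ-+ -[1+ m ] -[1+ n ] = begin
    - (suc (suc (m ℕ.+ n)) · 1#)             ≡⟨ ≡.cong (λ k → - (k · 1#)) (≡.sym (ℕₚ.+-suc (suc m) n)) ⟩
    - ((suc m ℕ.+ suc n) · 1#)               ≈⟨ -‿cong (×-homo-+ 1# (suc m) (suc n)) ⟩
    - (suc m · 1# + suc n · 1#)              ≈⟨ -‿+-comm (suc m · 1#) (suc n · 1#) ⟨
    - (suc m · 1#) - suc n · 1#              ∎

  fromℤ-neg : ∀ i → fromℤ (ℤ.- i) ≈ - fromℤ i
  fromℤ-neg (+ 0)       = sym -0#≈0#
  fromℤ-neg (+ suc n)   = refl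
  fromℤ-neg -[1+ n ]    = sym (-‿involutive (suc n · 1#))

  fromℤ-*⁺ : ∀ m n → fromℤ (+ m ℤ.* + n) ≈ fromℤ (+ m) * fromℤ (+ n)
  fromℤ-*⁺ m n = trans (reflexive (≡.cong fromℤ (≡.sym (ℤₚ.pos-* m n)))) (×1-homo-* m n)

  fromℤ-* : ∀ i j → fromℤ (i ℤ.* j) ≈ fromℤ i * fromℤ j
  fromℤ-* (+ m)    (+ n)    = fromℤ-*⁺ m n
  fromℤ-* (+ m)    -[1+ n ] = begin
    fromℤ (+ m ℤ.* -[1+ n ])                 ≡⟨ ≡.cong fromℤ (ℤₚ.neg-distribʳ-* (+ m) (+ suc n)) ⟨
    fromℤ (ℤ.- (+ m ℤ.* + suc n))            ≈⟨ fromℤ-neg (+ m ℤ.* + suc n) ⟩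
    - fromℤ (+ m ℤ.* + suc n)                ≈⟨ -‿cong (fromℤ-*⁺ m (suc n)) ⟩
    - (m · 1# * suc n · 1#)                  ≈⟨ -‿distribʳ-* (m · 1#) (suc n · 1#) ⟩
    m · 1# * - (suc n · 1#)                  ∎
  fromℤ-* -[1+ m ] (+ n)    = begin
    fromℤ (-[1+ m ] ℤ.* + n)                 ≡⟨ ≡.cong fromℤ (ℤₚ.neg-distribˡ-* (+ suc m) (+ n)) ⟨
    fromℤ (ℤ.- (+ suc m ℤ.* + n))            ≈⟨ fromℤ-neg (+ suc m ℤ.* + n) ⟩
    - fromℤ (+ suc m ℤ.* + n)                ≈⟨ -‿cong (fromℤ-*⁺ (suc m) n) ⟩
    - (suc m · 1# * n · 1#)                  ≈⟨ -‿distribˡ-* (suc m · 1#) (n · 1#) ⟩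
    - (suc m · 1#) * n · 1#                  ∎
  fromℤ-* -[1+ m ] -[1+ n ] = begin
    fromℤ (+ suc m ℤ.* + suc n)              ≈⟨ fromℤ-*⁺ (suc m) (suc n) ⟩
    suc m · 1# * suc n · 1#                  ≈⟨ -‿involutive (suc m · 1# * suc n · 1#) ⟨
    - - (suc m · 1# * suc n · 1#)            ≈⟨ -‿cong (-‿distribˡ-* (suc m · 1#) (suc n · 1#)) ⟩
    - (- (suc m · 1#) * suc n · 1#)          ≈⟨ -‿distribʳ-* (- (suc m · 1#)) (suc n · 1#) ⟩
    - (suc m · 1#) * - (suc n · 1#)          ∎

  almostCommutativeRing : AlmostCommutativeRing 0ℓ 0ℓ
  almostCommutativeRing = fromCommutativeRing (RealNumbers.commutativeRing 𝓡)

  -- Lets the ring solver for real identities compute with integer coefficients, for which `fromℤ≟`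
  -- decides equality.
  fromℤ-morphism : CommutativeRing.rawRing ℤₚ.+-*-commutativeRing -Raw-AlmostCommutative⟶ almostCommutativeRing
  fromℤ-morphism = record
    { ⟦_⟧    = fromℤ
    ; +-homo = fromℤ-+
    ; *-homo = fromℤ-*
    ; -‿homo = fromℤ-neg
    ; 0-homo = refl
    ; 1-homo = +-identityʳ 1#
    }

  fromℤ≟ : ∀ i j → Maybe (fromℤ i ≈ fromℤ j)
  fromℤ≟ i j with i ℤ.≟ j
  ... | yes i≡j = just (reflexive (≡.cong fromℤ i≡j))
  ... | no  _   = nothing

  module ℝ-Solver = RingSolver (CommutativeRing.rawRing ℤₚ.+-*-commutativeRing) almostCommutativeRing fromℤ-morphism fromℤ≟
  open ℝ-Solver using (solve; con; _:+_; _:*_; _:-_; :-_; _:=_)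

  fromℤ-1 : fromℤ (+ 1) ≈ 1#
  fromℤ-1 = +-identityʳ 1#

  -- Ordered-field arithmetic and the floor

  ≤-resp : ∀ {x x′ y y′} → x ≈ x′ → y ≈ y′ → x ≤ y → x′ ≤ y′
  ≤-resp p q = λ h → ≤-respʳ q (≤-respˡ p h)

  +-mono-≤ : ∀ {x x′ y y′} → x ≤ x′ → y ≤ y′ → x + y ≤ x′ + y′
  +-mono-≤ {x} {x′} {y} {y′} p q = ≤-trans (+-monoˡ y p)
    (≤-resp (+-comm y x′) (+-comm y′ x′) (+-monoˡ x′ q))

  0≤⇒≤ : ∀ {x y} → 0# ≤ y - x → x ≤ y
  0≤⇒≤ {x} {y} h = ≤-resp (+-identityˡ x) (solve 2 (λ x y → (y :- x) :+ x := y) refl x y) (+-monoˡ x h)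

  ≤⇒0≤ : ∀ {x y} → x ≤ y → 0# ≤ y - x
  ≤⇒0≤ {x} h = ≤-respˡ (-‿inverseʳ x) (+-monoˡ (- x) h)

  neg-mono-≤ : ∀ {x y} → x ≤ y → - y ≤ - x
  neg-mono-≤ {x} {y} h = 0≤⇒≤ (≤-respʳ (solve 2 (λ x y → y :- x := (:- x) :- (:- y)) refl x y) (≤⇒0≤ h))

  *-monoʳ-≤ : ∀ {x y} z → 0# ≤ z → x ≤ y → z * x ≤ z * y
  *-monoʳ-≤ {x} {y} z z≥0 h = 0≤⇒≤ (≤-respʳ (solve 3 (λ x y z → z :* (y :- x) := z :* y :- z :* x) refl x y z)
    (*-nonNeg z≥0 (≤⇒0≤ h)))

  0≤+ : ∀ {x y} → 0# ≤ x → 0# ≤ y → 0# ≤ x + y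
  0≤+ p q = ≤-respˡ (+-identityˡ 0#) (+-mono-≤ p q)

  0≤1 : 0# ≤ 1#
  0≤1 with total 0# 1#
  ... | inj₁ h = h
  ... | inj₂ h = ≤-respʳ (trans (solve 1 (λ x → (:- x) :* (:- x) := x :* x) refl 1#) (*-identityˡ 1#))
                   (*-nonNeg (≤-respˡ -0#≈0# (neg-mono-≤ h)) (≤-respˡ -0#≈0# (neg-mono-≤ h)))

  ≰⇒≥ : ∀ {x y} → ¬ (x ≤ y) → y ≤ x
  ≰⇒≥ {x} {y} h with total x y
  ... | inj₁ le = ⊥-elim (h le)
  ... | inj₂ ge = ge

  0≤fromℕ : ∀ n → 0# ≤ n · 1#
  0≤fromℕ zero    = ≤-refl
  0≤fromℕ (suc n) = 0≤+ 0≤1 (0≤fromℕ n)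

  1≤fromℕ : ∀ n → 1# ≤ suc n · 1#
  1≤fromℕ n = ≤-respˡ (+-identityʳ 1#) (+-mono-≤ ≤-refl (0≤fromℕ n))

  1≰0 : ¬ (1# ≤ 0#)
  1≰0 h = 1≉0 (antisym h 0≤1)

  fromℕ≉0 : ∀ n → ¬ (suc n · 1# ≈ 0#)
  fromℕ≉0 n eq = 1≰0 (≤-respʳ eq (1≤fromℕ n))

  fromℤ≉0 : ∀ i → i ≢ + 0 → ¬ (fromℤ i ≈ 0#)
  fromℤ≉0 (+ 0)     i≢0 _  = i≢0 ≡.refl
  fromℤ≉0 (+ suc n) _   eq = fromℕ≉0 n eq
  fromℤ≉0 -[1+ n ]  _   eq = fromℕ≉0 n (trans (sym (-‿involutive _)) (trans (-‿cong eq) -0#≈0#))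

  fromℕ-mono : ∀ {m n} → m ≤ℕ n → fromℤ (+ m) ≤ fromℤ (+ n)
  fromℕ-mono {n = n} z≤n     = 0≤fromℕ n
  fromℕ-mono         (s≤s h) = +-mono-≤ ≤-refl (fromℕ-mono h)

  inverseˡ : ∀ x → ¬ (x ≈ 0#) → x ⁻¹ * x ≈ 1#
  inverseˡ x x≉0 = trans (*-comm (x ⁻¹) x) (inverseʳ x x≉0)

  0≤⁻¹ : ∀ x → ¬ (x ≈ 0#) → 0# ≤ x → 0# ≤ x ⁻¹
  0≤⁻¹ x x≉0 x≥0 with total 0# (x ⁻¹)
  ... | inj₁ h = h
  ... | inj₂ h = ⊥-elim (1≰0 (≤-resp (inverseʳ x x≉0) (zeroʳ x) (*-monoʳ-≤ x x≥0 h)))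

  *-cancelˡ : ∀ x {y z} → ¬ (x ≈ 0#) → x * y ≈ x * z → y ≈ z
  *-cancelˡ x {y} {z} x≉0 eq = begin
    y                ≈⟨ trans (sym (*-assoc _ _ _)) (trans (*-congʳ (inverseˡ x x≉0)) (*-identityˡ y)) ⟨
    x ⁻¹ * (x * y)   ≈⟨ *-congˡ eq ⟩
    x ⁻¹ * (x * z)   ≈⟨ trans (sym (*-assoc _ _ _)) (trans (*-congʳ (inverseˡ x x≉0)) (*-identityˡ z)) ⟩
    z                ∎

  -- The supremum s of the naturals below x is approached by some n > s - 1, and then n + 1 exceeds x.
  floor⁺ : ∀ x → 0# ≤ x → ∃[ n ] (fromℤ (+ n) ≤ x × x ≤ fromℤ (+ n) + 1#)
  floor⁺ x x≥0 = body (supremum P (0# , 0 , refl , x≥0) (x , λ y (_ , y≈ , n≤x) → ≤-respˡ (sym y≈) n≤x))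
    where
    P : ℝ → Set
    P y = ∃[ n ] (y ≈ fromℤ (+ n) × fromℤ (+ n) ≤ x)
    body : ∃[ s ] ((∀ y → P y → y ≤ s) × (∀ y → y < s → ∃[ z ] (P z × y < z))) →
           ∃[ n ] (fromℤ (+ n) ≤ x × x ≤ fromℤ (+ n) + 1#)
    body (s , upper , approached) with approached (s - 1#) s-1<s
      where
      s-1<s : s - 1# < s
      s-1<s = 0≤⇒≤ (≤-respʳ (solve 2 (λ s i → i := s :- (s :- i)) refl s 1#) 0≤1) ,
              λ eq → 1≉0 (trans (solve 2 (λ s i → i := s :- (s :- i)) refl s 1#) (trans (+-congˡ (-‿cong eq)) (-‿inverseʳ s)))
    ... | z , (n , z≈ , n≤x) , (s-1≤z , s-1≉z) = n , n≤x , ≰⇒≥ λ n+1≤x →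
      s-1≉z (antisym s-1≤z (≤-resp
        (trans (+-congʳ (+-comm 1# (fromℤ (+ n)))) (trans (solve 2 (λ a i → (a :+ i) :- i := a) refl (fromℤ (+ n)) 1#) (sym z≈)))
        refl
        (+-monoˡ (- 1#) (upper (fromℤ (+ suc n)) (suc n , refl , ≤-respˡ (+-comm (fromℤ (+ n)) 1#) n+1≤x)))))

  -- Both bounds are weak, so negation carries the nonnegative case over without separate treatment
  -- of integers.
  floor : ∀ x → ∃[ i ] (fromℤ i ≤ x × x ≤ fromℤ i + 1#)
  floor x with total 0# x
  ... | inj₁ x≥0 = let n , lo , hi = floor⁺ x x≥0 in + n , lo , hi
  ... | inj₂ x≤0 = let n , lo , hi = floor⁺ (- x) (≤-respˡ -0#≈0# (neg-mono-≤ x≤0)) in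
    -[1+ n ] , ≤-resp (-‿cong (+-comm (fromℤ (+ n)) 1#)) (-‿involutive x) (neg-mono-≤ hi) ,
    ≤-resp (-‿involutive x) (solve 2 (λ a i → :- a := (:- (i :+ a)) :+ i) refl (fromℤ (+ n)) 1#) (neg-mono-≤ lo)

  -- Zonotopes and coverings

  ≈ᴹ-refl : ∀ {x : ℝ²} → x ≈ᴹ x
  ≈ᴹ-refl = refl , refl

  ≈ᴹ-sym : ∀ {x y : ℝ²} → x ≈ᴹ y → y ≈ᴹ x
  ≈ᴹ-sym (p , q) = sym p , sym q

  ≈ᴹ-trans : ∀ {x y z : ℝ²} → x ≈ᴹ y → y ≈ᴹ z → x ≈ᴹ z
  ≈ᴹ-trans (p , q) (p′ , q′) = trans p p′ , trans q q′

  +ᴹ-cong : ∀ {x y x′ y′ : ℝ²} → x ≈ᴹ x′ → y ≈ᴹ y′ → (x +ᴹ y) ≈ᴹ (x′ +ᴹ y′)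
  +ᴹ-cong (p , q) (p′ , q′) = +-cong p p′ , +-cong q q′

  exchange : ∀ a b c → a + (b + c) ≈ b + (a + c)
  exchange = solve 3 (λ a b c → a :+ (b :+ c) := b :+ (a :+ c)) refl

  -- The zonotope by recursion on a list of generators, which suits permuting, merging and appending
  -- them.
  Zon : List ℤ² → ℝ² → Set
  Zon []      x = x ≈ᴹ 0ᴹ
  Zon (u ∷ L) x = ∃[ c ] ∃[ y ] ((0# ≤ c × c ≤ 1#) × Zon L y × x ≈ᴹ (c *ₗ fromℤ² u) +ᴹ y)

  Zon-resp : ∀ L {x y} → x ≈ᴹ y → Zon L x → Zon L y
  Zon-resp []      x≈y x∈                  = ≈ᴹ-trans (≈ᴹ-sym x≈y) x∈
  Zon-resp (u ∷ L) x≈y (c , z , b , z∈ , eq) = c , z , b , z∈ , ≈ᴹ-trans (≈ᴹ-sym x≈y) eq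

  Zon-↭ : ∀ {L M} → L ↭ M → ∀ {x} → Zon L x → Zon M x
  Zon-↭ Perm.refl        x∈ = x∈
  Zon-↭ (prep u p)       (c , y , b , y∈ , eq) = c , y , b , Zon-↭ p y∈ , eq
  Zon-↭ (swap u v p)     (c , y , b , (d , z , b′ , z∈ , eq′) , eq) =
    d , _ , b′ , (c , z , b , Zon-↭ p z∈ , ≈ᴹ-refl) ,
    ≈ᴹ-trans eq (≈ᴹ-trans (+ᴹ-cong ≈ᴹ-refl eq′) (exchange _ _ _ , exchange _ _ _))
  Zon-↭ (Perm.trans p q) x∈ = Zon-↭ q (Zon-↭ p x∈)

  zonotope⇒Zon : ∀ {n} (u : Vector ℤ² n) {x} → zonotope u x → Zon (tabulate u) x
  zonotope⇒Zon {zero}  u (c , b , eq) = eq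
  zonotope⇒Zon {suc n} u (c , b , eq) =
    c zero , _ , b zero , zonotope⇒Zon (λ i → u (suc i)) ((λ i → c (suc i)) , (λ i → b (suc i)) , ≈ᴹ-refl) , eq

  Zon⇒zonotope : ∀ {n} (u : Vector ℤ² n) {x} → Zon (tabulate u) x → zonotope u x
  Zon⇒zonotope {zero}  u eq = (λ ()) , (λ ()) , eq
  Zon⇒zonotope {suc n} u (c , y , b , y∈ , eq) with Zon⇒zonotope (λ i → u (suc i)) y∈
  ... | d , b′ , eq′ = (c Vector.∷ d) , (λ { zero → b ; (suc i) → b′ i }) , ≈ᴹ-trans eq (+ᴹ-cong ≈ᴹ-refl eq′)

  -- Zon L + 2ℤ² = ℝ², that is, ½ Zon L + ℤ² = ℝ².
  Cov : List ℤ² → Set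
  Cov L = ∀ x → ∃[ y ] ∃[ z ] (Zon L y × x ≈ᴹ y +ᴹ fromℤ² (+ 2 • z))

  negativePart : ℤ → ℕ
  negativePart (+ _)    = 0
  negativePart -[1+ n ] = suc n

  -- The segment from 0 to a has minus the negative part of a as its lower end and the absolute
  -- value of a as its length.
  shift-bounds : ∀ a θ → 0# ≤ θ → θ ≤ 1# →
    0# ≤ fromℤ (+ negativePart a) + θ * fromℤ a × fromℤ (+ negativePart a) + θ * fromℤ a ≤ fromℤ (+ ℤ.∣ a ∣)
  shift-bounds (+ n) θ θ≥0 θ≤1 =
    ≤-respʳ (sym (+-identityˡ _)) (*-nonNeg θ≥0 (0≤fromℕ n)) ,
    ≤-resp (trans (*-comm _ _) (sym (+-identityˡ _))) (*-identityʳ _) (*-monoʳ-≤ (fromℤ (+ n)) (0≤fromℕ n) θ≤1)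
  shift-bounds -[1+ n ] θ θ≥0 θ≤1 =
    ≤-respʳ (trans (solve 3 (λ m θ i → m :* (i :- θ) := m :* i :+ θ :* (:- m)) refl m θ 1#) (+-congʳ (*-identityʳ m)))
      (*-nonNeg m≥0 (≤⇒0≤ θ≤1)) ,
    0≤⇒≤ (≤-respʳ (solve 2 (λ m θ → θ :* m := m :- (m :+ θ :* (:- m))) refl m θ) (*-nonNeg θ≥0 m≥0))
    where
    m = fromℤ (+ suc n)
    m≥0 = 0≤fromℕ (suc n)

  -- The values α S fill an interval of length at least 2 D, which meets every class modulo 2 D.
  residue : ∀ D → 0 <ℕ D → ∀ S → 2 ℕ.* D ≤ℕ ℤ.∣ S ∣ → ∀ x →
            ∃[ α ] ∃[ z ] ((0# ≤ α × α ≤ 1#) × x ≈ α * fromℤ S + fromℤ (+ (2 ℕ.* D)) * fromℤ z)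
  residue D D>0 S 2D≤S = byStep (2 ℕ.* D) (ℕₚ.≤-trans D>0 (ℕₚ.m≤m+n D _)) S 2D≤S
    where
    positive : ∀ m → 0 <ℕ m → ∀ n → m ≤ℕ n → ∀ x →
               ∃[ α ] ∃[ z ] ((0# ≤ α × α ≤ 1#) × x ≈ α * fromℤ (+ n) + fromℤ (+ m) * fromℤ z)
    positive (suc m) _ (suc n) m≤n x = α , z , (α≥0 , α≤1) , eq
      where
      M = fromℤ (+ suc m)
      N = fromℤ (+ suc n)
      M⁻¹*M = inverseˡ M (fromℕ≉0 m)
      N⁻¹*N = inverseˡ N (fromℕ≉0 n)
      N⁻¹≥0 = 0≤⁻¹ N (fromℕ≉0 n) (0≤fromℕ (suc n))
      -- Division with remainder by M: the remainder lies between 0 and M ≤ N, so it is a fraction α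
      -- of N.
      z  = proj₁ (floor (M ⁻¹ * x))
      lo = proj₁ (proj₂ (floor (M ⁻¹ * x)))
      hi = proj₂ (proj₂ (floor (M ⁻¹ * x)))
      α = N ⁻¹ * (x - M * fromℤ z)
      M*M⁻¹x : M * (M ⁻¹ * x) ≈ x
      M*M⁻¹x = trans (sym (*-assoc M (M ⁻¹) x)) (trans (*-congʳ (inverseʳ M (fromℕ≉0 m))) (*-identityˡ x))
      r≥0 : 0# ≤ x - M * fromℤ z
      r≥0 = ≤⇒0≤ (≤-respʳ M*M⁻¹x (*-monoʳ-≤ M (0≤fromℕ (suc m)) lo))
      r≤M : x - M * fromℤ z ≤ M
      r≤M = 0≤⇒≤ (≤-respʳ (begin
          M * (fromℤ z + 1#) - x           ≈⟨ solve 4 (λ M z i x → M :* (z :+ i) :- x := M :* i :- (x :- M :* z)) refl M (fromℤ z) 1# x ⟩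
          M * 1# - (x - M * fromℤ z)       ≈⟨ +-congʳ (*-identityʳ M) ⟩
          M - (x - M * fromℤ z)            ∎)
        (≤⇒0≤ (≤-respˡ M*M⁻¹x (*-monoʳ-≤ M (0≤fromℕ (suc m)) hi))))
      α≥0 : 0# ≤ α
      α≥0 = *-nonNeg N⁻¹≥0 r≥0
      α≤1 : α ≤ 1#
      α≤1 = ≤-respʳ N⁻¹*N (*-monoʳ-≤ (N ⁻¹) N⁻¹≥0 (≤-trans r≤M (fromℕ-mono m≤n)))
      eq : x ≈ α * N + M * fromℤ z
      eq = begin
        x                                              ≈⟨ solve 2 (λ x y → x := (x :- y) :+ y) refl x (M * fromℤ z) ⟩
        (x - M * fromℤ z) + M * fromℤ z                ≈⟨ +-congʳ (trans (*-congʳ N⁻¹*N) (*-identityˡ _)) ⟨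
        N ⁻¹ * N * (x - M * fromℤ z) + M * fromℤ z     ≈⟨ +-congʳ (solve 3 (λ a b c → a :* b :* c := a :* c :* b) refl (N ⁻¹) N
            (x - M * fromℤ z)) ⟩
        α * N + M * fromℤ z                            ∎
    byStep : ∀ m → 0 <ℕ m → ∀ S → m ≤ℕ ℤ.∣ S ∣ → ∀ x →
             ∃[ α ] ∃[ z ] ((0# ≤ α × α ≤ 1#) × x ≈ α * fromℤ S + fromℤ (+ m) * fromℤ z)
    byStep m m>0 (+ n)    m≤n x = positive m m>0 n m≤n x
    byStep m m>0 -[1+ n ] m≤n x with positive m m>0 (suc n) m≤n (- x)
    ... | α , z , b , eq = α , ℤ.- z , b , (begin
      x                                          ≈⟨ -‿involutive x ⟨
      - - x                                      ≈⟨ -‿cong eq ⟩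
      - (α * N + fromℤ (+ m) * fromℤ z)          ≈⟨ solve 4 (λ α N M z → :- (α :* N :+ M :* z) := α :* (:- N) :+ M :* (:- z)) refl α N
          (fromℤ (+ m)) (fromℤ z) ⟩
      α * (- N) + fromℤ (+ m) * (- fromℤ z)      ≈⟨ +-congˡ (*-congˡ (fromℤ-neg z)) ⟨
      α * (- N) + fromℤ (+ m) * fromℤ (ℤ.- z)    ∎)
      where N = fromℤ (+ suc n)

  affinePoint : ℝ → ℝ → ℝ → (O L B : ℤ²) → ℝ²
  affinePoint D⁻¹ θ α (o₁ , o₂) (l₁ , l₂) (b₁ , b₂) =
    D⁻¹ * (fromℤ o₁ + θ * fromℤ l₁ + α * fromℤ b₁) , D⁻¹ * (fromℤ o₂ + θ * fromℤ l₂ + α * fromℤ b₂)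

  -- Each generator receives the coefficient (o + θ a + α b) / D, where the absolute values of a and
  -- b add up to D. The offset o, the sum of the negative parts of a and b, puts it into [0 , 1].
  -- The sign of b is that of `det e u`, so all heights add up to the full slack.
  innerParallelogram : ∀ D → 0 <ℕ D → ∀ e K → All (λ k → ℤ.∣ proj₁ k ∣ ≤ℕ D) K →
    ∃[ O ] ∃[ B ] (det e B ≡ + slack D e K ×
      (∀ θ α → 0# ≤ θ → θ ≤ 1# → 0# ≤ α → α ≤ 1# →
        Zon (map proj₂ K) (affinePoint (fromℤ (+ D) ⁻¹) θ α O (linear K) B)))
  innerParallelogram D _ e [] [] = 0² , 0² , det-0 e , λ θ α _ _ _ _ → vanish θ α , vanish θ α
    where
    det-0 : ∀ e → det e 0² ≡ + 0
    det-0 (a , b) = ≡.cong₂ ℤ._-_ (ℤₚ.*-zeroʳ a) (ℤₚ.*-zeroʳ b)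
    vanish : ∀ θ α → fromℤ (+ D) ⁻¹ * (fromℤ (+ 0) + θ * fromℤ (+ 0) + α * fromℤ (+ 0)) ≈ 0#
    vanish = solve 3 (λ d θ α → d :* (con (+ 0) :+ θ :* con (+ 0) :+ α :* con (+ 0)) := con (+ 0)) refl (fromℤ (+ D) ⁻¹)
  innerParallelogram D@(suc D′) D>0 e ((a , u) ∷ K) (a≤D ∷ bounded) with innerParallelogram D D>0 e K bounded
  ... | O , B , height , inside = o • u ⊕ O , b • u ⊕ B , height′ , inside′
    where
    s  = proj₁ (signed (det e u))
    ∣s∣≡1 = proj₁ (proj₂ (signed (det e u)))
    m = D ℕ.∸ ℤ.∣ a ∣
    b = + m ℤ.* s
    o = + (negativePart a ℕ.+ negativePart b)
    ∣b∣≡m : ℤ.∣ b ∣ ≡ m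
    ∣b∣≡m = ≡.trans (ℤₚ.abs-* (+ m) s) (≡.trans (≡.cong (m ℕ.*_) ∣s∣≡1) (ℕₚ.*-identityʳ m))
    height′ : det e (b • u ⊕ B) ≡ + (m ℕ.* area e u ℕ.+ slack D e K)
    height′ = ≡.trans (det-⊕ʳ e (b • u) B) (≡.trans (≡.cong₂ ℤ._+_ (≡.trans (det-•ʳ b e u) (*-signed m (det e u))) height)
        (≡.sym (ℤₚ.pos-+ (m ℕ.* area e u) (slack D e K))))
    inside′ : ∀ θ α → 0# ≤ θ → θ ≤ 1# → 0# ≤ α → α ≤ 1# →
      Zon (u ∷ map proj₂ K) (affinePoint (fromℤ (+ D) ⁻¹) θ α (o • u ⊕ O) (a • u ⊕ linear K) (b • u ⊕ B))
    inside′ θ α θ≥0 θ≤1 α≥0 α≤1 =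
      c , _ , (*-nonNeg D⁻¹≥0 t≥0 , ≤-respʳ (inverseˡ _ D≉0) (*-monoʳ-≤ _ D⁻¹≥0 t≤D)) , inside θ α θ≥0 θ≤1 α≥0 α≤1 ,
      (component (proj₁ u) (proj₁ O) (proj₁ (linear K)) (proj₁ B) , component (proj₂ u) (proj₂ O) (proj₂ (linear K)) (proj₂ B))
      where
      D≉0 = fromℕ≉0 D′
      D⁻¹≥0 = 0≤⁻¹ (fromℤ (+ D)) D≉0 (0≤fromℕ D)
      t = fromℤ o + θ * fromℤ a + α * fromℤ b
      c = fromℤ (+ D) ⁻¹ * t
      t-eq : (fromℤ (+ negativePart a) + θ * fromℤ a) + (fromℤ (+ negativePart b) + α * fromℤ b) ≈ t
      t-eq = trans (solve 4 (λ p x q y → (p :+ x) :+ (q :+ y) := p :+ q :+ x :+ y) refl _ _ _ _)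
        (+-congʳ (+-congʳ (sym (fromℤ-+ (+ negativePart a) (+ negativePart b)))))
      t≥0 : 0# ≤ t
      t≥0 = ≤-respʳ t-eq (0≤+ (proj₁ (shift-bounds a θ θ≥0 θ≤1)) (proj₁ (shift-bounds b α α≥0 α≤1)))
      t≤D : t ≤ fromℤ (+ D)
      t≤D = ≤-resp t-eq (trans (sym (fromℤ-+ (+ ℤ.∣ a ∣) (+ ℤ.∣ b ∣)))
          (reflexive (≡.cong (λ k → fromℤ (+ k)) (≡.trans (≡.cong (ℤ.∣ a ∣ ℕ.+_) ∣b∣≡m) (ℕₚ.m+[n∸m]≡n a≤D)))))
        (+-mono-≤ (proj₂ (shift-bounds a θ θ≥0 θ≤1)) (proj₂ (shift-bounds b α α≥0 α≤1)))
      component : ∀ x y l z → fromℤ (+ D) ⁻¹ * (fromℤ (o ℤ.* x ℤ.+ y) + θ * fromℤ (a ℤ.* x ℤ.+ l) + α * fromℤ (b ℤ.* x ℤ.+ z))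
                            ≈ c * fromℤ x + fromℤ (+ D) ⁻¹ * (fromℤ y + θ * fromℤ l + α * fromℤ z)
      component x y l z = trans
        (*-congˡ (+-cong (+-cong (expand o y) (*-congˡ (expand a l))) (*-congˡ (expand b z))))
        (solve 10 (λ d θ α o a b x y l z → d :* (o :* x :+ y :+ θ :* (a :* x :+ l) :+ α :* (b :* x :+ z))
            := d :* (o :+ θ :* a :+ α :* b) :* x :+ d :* (y :+ θ :* l :+ α :* z))
          refl (fromℤ (+ D) ⁻¹) θ α (fromℤ o) (fromℤ a) (fromℤ b) (fromℤ x) (fromℤ y) (fromℤ l) (fromℤ z))
        where
        expand : ∀ k w → fromℤ (k ℤ.* x ℤ.+ w) ≈ fromℤ k * fromℤ x + fromℤ w
        expand k w = trans (fromℤ-+ (k ℤ.* x) w) (+-congʳ (fromℤ-* k x))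

  -- In the basis (e , f), first α matches the height modulo 2 D, then θ matches the coordinate
  -- along e modulo 2 D; division by D leaves a translate in 2ℤ².
  certificate⇒Cov : ∀ K → Certificate K → Cov (map proj₂ K)
  certificate⇒Cov K cert x =
    _ , z , inside θ α (proj₁ θ-bounds) (proj₂ θ-bounds) (proj₁ α-bounds) (proj₂ α-bounds) ,
    (component (proj₁ x) (proj₁ e) (proj₁ f) (proj₁ O) (proj₁ (linear K)) (proj₁ B) (≡.cong proj₁ along) (≡.cong proj₁ B-eq) (proj₁ W-eq) ,
     component (proj₂ x) (proj₂ e) (proj₂ f) (proj₂ O) (proj₂ (linear K)) (proj₂ B) (≡.cong proj₂ along) (≡.cong proj₂ B-eq) (proj₂ W-eq))
    where
    open Certificate cert
    f  = proj₁ e-primitive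
    ef = proj₂ e-primitive
    parallelogramInside = innerParallelogram D D>0 e K bounded
    O = proj₁ parallelogramInside
    B = proj₁ (proj₂ parallelogramInside)
    inside = proj₂ (proj₂ (proj₂ parallelogramInside))
    S = + slack D e K
    B-eq : B ≡ ⟦ e , f ⟧ (det B f , S)
    B-eq = ≡.trans (coordinates e f ef B) (≡.cong (λ h → ⟦ e , f ⟧ (det B f , h)) (proj₁ (proj₂ (proj₂ parallelogramInside))))

    d = fromℤ (+ D)
    d≉0 : ¬ (d ≈ 0#)
    d≉0 = fromℤ≉0 (+ D) λ { ≡.refl → contradiction D>0 λ () }
    e₁′ = fromℤ (proj₁ e)
    e₂′ = fromℤ (proj₂ e)
    f₁′ = fromℤ (proj₁ f)
    f₂′ = fromℤ (proj₂ f)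
    w₁ = d * proj₁ x - fromℤ (proj₁ O)
    w₂ = d * proj₂ x - fromℤ (proj₂ O)
    -- The coordinates of D x - O in the basis (e , f).
    W₁ = w₁ * f₂′ - w₂ * f₁′
    W₂ = e₁′ * w₂ - e₂′ * w₁

    ef′ : e₁′ * f₂′ - e₂′ * f₁′ ≈ 1#
    ef′ = begin
      e₁′ * f₂′ - e₂′ * f₁′                                              ≈⟨ +-cong (fromℤ-* (proj₁ e) (proj₂ f))
          (-‿cong (fromℤ-* (proj₂ e) (proj₁ f))) ⟨
      fromℤ (proj₁ e ℤ.* proj₂ f) - fromℤ (proj₂ e ℤ.* proj₁ f)           ≈⟨ +-congˡ (fromℤ-neg (proj₂ e ℤ.* proj₁ f)) ⟨
      fromℤ (proj₁ e ℤ.* proj₂ f) + fromℤ (ℤ.- (proj₂ e ℤ.* proj₁ f))     ≈⟨ fromℤ-+ (proj₁ e ℤ.* proj₂ f) (ℤ.- (proj₂ e ℤ.* proj₁ f)) ⟨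
      fromℤ (det e f)                                                    ≡⟨ ≡.cong fromℤ ef ⟩
      fromℤ (+ 1)                                                        ≈⟨ fromℤ-1 ⟩
      1#                                                                 ∎

    W-eq : w₁ ≈ W₁ * e₁′ + W₂ * f₁′ × w₂ ≈ W₁ * e₂′ + W₂ * f₂′
    W-eq = trans (sym (trans (*-congʳ ef′) (*-identityˡ w₁)))
             (solve 6 (λ a b m n x y → (a :* n :- b :* m) :* x
                 := (x :* n :- y :* m) :* a :+ (a :* y :- b :* x) :* m) refl e₁′ e₂′ f₁′ f₂′ w₁ w₂)
         , trans (sym (trans (*-congʳ ef′) (*-identityˡ w₂)))
             (solve 6 (λ a b m n x y → (a :* n :- b :* m) :* y
                 := (x :* n :- y :* m) :* b :+ (a :* y :- b :* x) :* n) refl e₁′ e₂′ f₁′ f₂′ w₁ w₂)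

    height : ∃[ α ] ∃[ z ] ((0# ≤ α × α ≤ 1#) × W₂ ≈ α * fromℤ S + fromℤ (+ (2 ℕ.* D)) * fromℤ z)
    height = residue D D>0 S wide W₂
    α  = proj₁ height
    z₂ = proj₁ (proj₂ height)
    α-bounds = proj₁ (proj₂ (proj₂ height))

    -- The side B need not be transverse in any normalised way: its component `det B f` along e,
    -- already scaled by the chosen α, is removed first.
    shift : ∃[ θ ] ∃[ z ] ((0# ≤ θ × θ ≤ 1#) × W₁ - α * fromℤ (det B f) ≈ θ * fromℤ A + fromℤ (+ (2 ℕ.* D)) * fromℤ z)
    shift = residue D D>0 A long (W₁ - α * fromℤ (det B f))
    θ  = proj₁ shift
    z₁ = proj₁ (proj₂ shift)
    θ-bounds = proj₁ (proj₂ (proj₂ shift))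

    z = ⟦ e , f ⟧ (z₁ , z₂)
    2d : fromℤ (+ (2 ℕ.* D)) ≈ fromℤ (+ 2) * d
    2d = trans (reflexive (≡.cong fromℤ (ℤₚ.pos-* 2 D))) (fromℤ-* (+ 2) (+ D))

    component : ∀ x a b o l β → l ≡ A ℤ.* a → β ≡ det B f ℤ.* a ℤ.+ S ℤ.* b → d * x - fromℤ o ≈ W₁ * fromℤ a + W₂ * fromℤ b →
                x ≈ d ⁻¹ * (fromℤ o + θ * fromℤ l + α * fromℤ β) + fromℤ (+ 2 ℤ.* (z₁ ℤ.* a ℤ.+ z₂ ℤ.* b))
    component x a b o l β l-eq β-eq w-eq = *-cancelˡ d d≉0 (begin
      d * x
        ≈⟨ solve 2 (λ y o → y := o :+ (y :- o)) refl (d * x) o′ ⟩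
      o′ + (d * x - o′)
        ≈⟨ +-congˡ w-eq ⟩
      o′ + (W₁ * a′ + W₂ * b′)
        ≈⟨ +-congˡ (+-cong (*-congʳ W₁-eq) (*-congʳ (proj₂ (proj₂ (proj₂ height))))) ⟩
      o′ + ((β₁ + (θ * A′ + m * ζ₁)) * a′ + (α * S′ + m * ζ₂) * b′)
        ≈⟨ +-congˡ (+-cong (*-congʳ (+-congˡ (+-congˡ (*-congʳ 2d)))) (*-congʳ (+-congˡ (*-congʳ 2d)))) ⟩
      o′ + ((β₁ + (θ * A′ + fromℤ (+ 2) * d * ζ₁)) * a′ + (α * S′ + fromℤ (+ 2) * d * ζ₂) * b′)
        ≈⟨ solve 11 (λ o α bf θ A d ζ₁ a S ζ₂ b →
             o :+ ((α :* bf :+ (θ :* A :+ con (+ 2) :* d :* ζ₁)) :* a :+ (α :* S :+ con (+ 2) :* d :* ζ₂) :* b)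
               := (o :+ θ :* (A :* a) :+ α :* (bf :* a :+ S :* b)) :+ d :* (con (+ 2) :* (ζ₁ :* a :+ ζ₂ :* b)))
             refl o′ α (fromℤ (det B f)) θ A′ d ζ₁ a′ S′ ζ₂ b′ ⟩
      (o′ + θ * (A′ * a′) + α * (fromℤ (det B f) * a′ + S′ * b′)) + d * (fromℤ (+ 2) * (ζ₁ * a′ + ζ₂ * b′))
        ≈⟨ +-cong (+-cong (+-congˡ (*-congˡ l-eq′)) (*-congˡ β-eq′)) (*-congˡ z-eq) ⟨
      (o′ + θ * fromℤ l + α * fromℤ β) + d * fromℤ (+ 2 ℤ.* (z₁ ℤ.* a ℤ.+ z₂ ℤ.* b))
        ≈⟨ +-congʳ (trans (sym (*-assoc d (d ⁻¹) _)) (trans (*-congʳ (inverseʳ d d≉0)) (*-identityˡ _))) ⟨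
      d * (d ⁻¹ * (o′ + θ * fromℤ l + α * fromℤ β)) + d * fromℤ (+ 2 ℤ.* (z₁ ℤ.* a ℤ.+ z₂ ℤ.* b))
        ≈⟨ distribˡ d _ _ ⟨
      d * (d ⁻¹ * (o′ + θ * fromℤ l + α * fromℤ β) + fromℤ (+ 2 ℤ.* (z₁ ℤ.* a ℤ.+ z₂ ℤ.* b))) ∎)
      where
      a′ = fromℤ a
      b′ = fromℤ b
      o′ = fromℤ o
      A′ = fromℤ A
      S′ = fromℤ S
      m  = fromℤ (+ (2 ℕ.* D))
      ζ₁ = fromℤ z₁
      ζ₂ = fromℤ z₂
      β₁ = α * fromℤ (det B f)
      W₁-eq : W₁ ≈ β₁ + (θ * A′ + m * ζ₁)
      W₁-eq = trans (solve 2 (λ w β → w := β :+ (w :- β)) refl W₁ β₁) (+-congˡ (proj₂ (proj₂ (proj₂ shift))))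
      l-eq′ : fromℤ l ≈ A′ * a′
      l-eq′ = trans (reflexive (≡.cong fromℤ l-eq)) (fromℤ-* A a)
      pairing : ∀ i j → fromℤ (i ℤ.* a ℤ.+ j ℤ.* b) ≈ fromℤ i * a′ + fromℤ j * b′
      pairing i j = trans (fromℤ-+ (i ℤ.* a) (j ℤ.* b)) (+-cong (fromℤ-* i a) (fromℤ-* j b))
      β-eq′ : fromℤ β ≈ fromℤ (det B f) * a′ + S′ * b′
      β-eq′ = trans (reflexive (≡.cong fromℤ β-eq)) (pairing (det B f) S)
      z-eq : fromℤ (+ 2 ℤ.* (z₁ ℤ.* a ℤ.+ z₂ ℤ.* b)) ≈ fromℤ (+ 2) * (ζ₁ * a′ + ζ₂ * b′)
      z-eq = trans (fromℤ-* (+ 2) (z₁ ℤ.* a ℤ.+ z₂ ℤ.* b)) (*-congˡ (pairing z₁ z₂))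

  Cov-weaken : ∀ u L → Cov L → Cov (u ∷ L)
  Cov-weaken u L cov x with cov x
  ... | y , z , y∈ , eq = y , z , (0# , y , (≤-refl , 0≤1) , y∈ , (vanish (proj₁ u) (proj₁ y) , vanish (proj₂ u) (proj₂ y))) , eq
    where
    vanish : ∀ a y → y ≈ 0# * fromℤ a + y
    vanish a y = trans (sym (+-identityˡ y)) (+-congʳ (sym (zeroˡ (fromℤ a))))

  slab⇒Cov : ∀ {L} → Slab L → Cov L
  slab⇒Cov (certificate K c) = certificate⇒Cov K c
  slab⇒Cov (permute p s) x with slab⇒Cov s x
  ... | y , z , y∈ , eq = y , z , Zon-↭ p y∈ , eq
  slab⇒Cov (weaken {u} {L} s) = Cov-weaken u L (slab⇒Cov s)

  -- Reduction to pairwise independent rays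

  infix 4 _≃_
  -- Equality up to a lattice translation rather than equality of sets, because reversing a
  -- generator moves the zonotope.
  record _≃_ (L M : List ℤ²) : Set where
    constructor translation
    field
      t    : ℤ²
      from : ∀ {y} → Zon M y → Zon L (y +ᴹ fromℤ² t)
      to   : ∀ {x} → Zon L x → ∃[ y ] (Zon M y × x ≈ᴹ y +ᴹ fromℤ² t)

  +ᴹ-0² : ∀ (x : ℝ²) → x ≈ᴹ x +ᴹ fromℤ² 0²
  +ᴹ-0² x = sym (+-identityʳ _) , sym (+-identityʳ _)

  ≃-from⇔ : ∀ {L M} → (∀ {x} → Zon M x → Zon L x) → (∀ {x} → Zon L x → Zon M x) → L ≃ M
  ≃-from⇔ {L} from to = translation 0² (λ {y} y∈ → Zon-resp L (+ᴹ-0² y) (from y∈)) (λ {x} x∈ → x , to x∈ , +ᴹ-0² x)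

  ≃-refl : ∀ {L} → L ≃ L
  ≃-refl = ≃-from⇔ (λ z → z) (λ z → z)

  ≃-↭ : ∀ {L M} → L ↭ M → L ≃ M
  ≃-↭ p = ≃-from⇔ (Zon-↭ (↭-sym p)) (Zon-↭ p)

  fromℤ²-⊕ : ∀ s t → fromℤ² (s ⊕ t) ≈ᴹ fromℤ² s +ᴹ fromℤ² t
  fromℤ²-⊕ (a , b) (c , d) = fromℤ-+ a c , fromℤ-+ b d

  +ᴹ-⊕ : ∀ (y : ℝ²) s t → (y +ᴹ fromℤ² s) +ᴹ fromℤ² t ≈ᴹ y +ᴹ fromℤ² (s ⊕ t)
  +ᴹ-⊕ y s t = trans (+-assoc _ _ _) (+-congˡ (sym (proj₁ (fromℤ²-⊕ s t)))) ,
               trans (+-assoc _ _ _) (+-congˡ (sym (proj₂ (fromℤ²-⊕ s t))))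

  ≃-trans : ∀ {L M N} → L ≃ M → M ≃ N → L ≃ N
  ≃-trans {L} (translation t from to) (translation t′ from′ to′) = translation (t′ ⊕ t)
    (λ {y} y∈ → Zon-resp L (+ᴹ-⊕ y t′ t) (from (from′ y∈)))
    λ x∈ → let y , y∈ , eq = to x∈ ; z , z∈ , eq′ = to′ y∈ in
      z , z∈ , ≈ᴹ-trans eq (≈ᴹ-trans (+ᴹ-cong eq′ ≈ᴹ-refl) (+ᴹ-⊕ z t′ t))

  ≃-cons : ∀ {L M} u → L ≃ M → u ∷ L ≃ u ∷ M
  ≃-cons u (translation t from to) = translation t
    (λ (c , y , b , y∈ , eq) → c , _ , b , from y∈ ,
       ≈ᴹ-trans (+ᴹ-cong eq ≈ᴹ-refl) (+-assoc _ _ _ , +-assoc _ _ _))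
    λ (c , y , b , y∈ , eq) → let z , z∈ , eq′ = to y∈ in
      _ , (c , z , b , z∈ , ≈ᴹ-refl) , ≈ᴹ-trans eq (≈ᴹ-trans (+ᴹ-cong ≈ᴹ-refl eq′) (sym (+-assoc _ _ _) , sym (+-assoc _ _ _)))

  ≃-zero : ∀ {L} → 0² ∷ L ≃ L
  ≃-zero {L} = ≃-from⇔
    (λ {x} x∈ → 0# , x , (≤-refl , 0≤1) , x∈ , ≈ᴹ-sym (vanish 0# (proj₁ x) , vanish 0# (proj₂ x)))
    (λ (c , y , b , y∈ , eq) → Zon-resp L (≈ᴹ-sym (≈ᴹ-trans eq (vanish c (proj₁ y) , vanish c (proj₂ y)))) y∈)
    where
    vanish : ∀ c y → c * fromℤ (+ 0) + y ≈ y
    vanish c y = trans (+-congʳ (zeroʳ c)) (+-identityˡ y)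

  -- c (- u) = (1 - c) u - u
  ≃-negate : ∀ {L} u → -[1+ 0 ] • u ∷ L ≃ u ∷ L
  ≃-negate {L} u@(a , b) = translation (-[1+ 0 ] • u)
    (λ {x} (c , y , bounds , y∈ , eq) → 1# - c , y , flip bounds , y∈ ,
       ≈ᴹ-trans (+ᴹ-cong eq ≈ᴹ-refl) (reflect c a (proj₁ y) , reflect c b (proj₂ y)))
    (λ (c , y , bounds , y∈ , eq) → _ , (1# - c , y , flip bounds , y∈ , ≈ᴹ-refl) ,
       ≈ᴹ-trans eq (reflect′ c a (proj₁ y) , reflect′ c b (proj₂ y)))
    where
    flip : ∀ {c} → 0# ≤ c × c ≤ 1# → 0# ≤ 1# - c × 1# - c ≤ 1#
    flip {c} (c≥0 , c≤1) = ≤⇒0≤ c≤1 , 0≤⇒≤ (≤-respʳ (solve 2 (λ c i → c := i :- (i :- c)) refl c 1#) c≥0)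
    neg : ∀ a → fromℤ (-[1+ 0 ] ℤ.* a) ≈ - fromℤ a
    neg a = trans (reflexive (≡.cong fromℤ (ℤₚ.-1*i≡-i a))) (fromℤ-neg a)
    shift : ∀ c a → (1# - c) * - a ≈ c * a - a
    shift c a = trans (solve 3 (λ c a i → (i :- c) :* (:- a) := c :* a :- i :* a) refl c a 1#)
                  (+-congˡ (-‿cong (*-identityˡ a)))
    reflect : ∀ c a y → (c * fromℤ a + y) + fromℤ (-[1+ 0 ] ℤ.* a) ≈ (1# - c) * fromℤ (-[1+ 0 ] ℤ.* a) + y
    reflect c a y = trans (+-congˡ (neg a)) (trans
      (solve 3 (λ p a y → (p :+ y) :+ (:- a) := (p :- a) :+ y) refl (c * fromℤ a) (fromℤ a) y)
      (+-congʳ (sym (trans (*-congˡ (neg a)) (shift c (fromℤ a))))))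
    reflect′ : ∀ c a y → c * fromℤ (-[1+ 0 ] ℤ.* a) + y ≈ ((1# - c) * fromℤ a + y) + fromℤ (-[1+ 0 ] ℤ.* a)
    reflect′ c a y = trans (+-congʳ (*-congˡ (neg a))) (trans
      (solve 3 (λ c a y → c :* (:- a) :+ y := (:- (c :* a) :+ a :+ y) :- a) refl c (fromℤ a) y)
      (+-cong (+-congʳ (sym (trans (solve 3 (λ c a i → (i :- c) :* a := :- (c :* a) :+ i :* a) refl c (fromℤ a) 1#)
        (+-congˡ (*-identityˡ (fromℤ a)))))) (sym (neg a))))

  -- A point of the long segment splits by using its coefficient on both pieces; conversely two
  -- coefficients merge into their mean weighted by the two lengths, which stays in [0 , 1].
  ≃-merge : ∀ {L} m n e → + m • e ∷ + suc n • e ∷ L ≃ + suc (n ℕ.+ m) • e ∷ L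
  ≃-merge {L} m n (a , b) = ≃-from⇔
    (λ (c , y , bounds , y∈ , eq) → c , _ , bounds , (c , y , bounds , y∈ , ≈ᴹ-refl) ,
       ≈ᴹ-trans eq (split c a (proj₁ y) , split c b (proj₂ y)))
    (λ (c , _ , (c≥0 , c≤1) , (d , y , (d≥0 , d≤1) , y∈ , eq′) , eq) →
       S ⁻¹ * (c * M + d * N) , y ,
       (*-nonNeg S⁻¹≥0 (0≤+ (*-nonNeg c≥0 (0≤fromℕ m)) (*-nonNeg d≥0 (0≤fromℕ (suc n)))) ,
        ≤-respʳ (inverseˡ S S≉0) (*-monoʳ-≤ (S ⁻¹) S⁻¹≥0
          (≤-respʳ (trans (+-comm M N) (sym S-eq)) (+-mono-≤ (scaled M (0≤fromℕ m) c≤1) (scaled N (0≤fromℕ (suc n)) d≤1))))) ,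
       y∈ , ≈ᴹ-trans eq (≈ᴹ-trans (+ᴹ-cong ≈ᴹ-refl eq′) (join c d a (proj₁ y) , join c d b (proj₂ y))))
    where
    M = fromℤ (+ m)
    N = fromℤ (+ suc n)
    S = fromℤ (+ suc (n ℕ.+ m))
    S≉0 = fromℕ≉0 (n ℕ.+ m)
    S⁻¹≥0 = 0≤⁻¹ S S≉0 (0≤fromℕ (suc (n ℕ.+ m)))
    S-eq : S ≈ N + M
    S-eq = fromℤ-+ (+ suc n) (+ m)
    scaled : ∀ M {c} → 0# ≤ M → c ≤ 1# → c * M ≤ M
    scaled M M≥0 c≤1 = ≤-resp (*-comm _ _) (*-identityʳ M) (*-monoʳ-≤ M M≥0 c≤1)
    split : ∀ c a y → c * fromℤ (+ suc (n ℕ.+ m) ℤ.* a) + y ≈ c * fromℤ (+ m ℤ.* a) + (c * fromℤ (+ suc n ℤ.* a) + y)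
    split c a y = begin
      c * fromℤ (+ suc (n ℕ.+ m) ℤ.* a) + y            ≈⟨ +-congʳ (*-congˡ (trans (fromℤ-* (+ suc (n ℕ.+ m)) a) (*-congʳ S-eq))) ⟩
      c * ((N + M) * fromℤ a) + y                      ≈⟨ solve 5
          (λ c N M a y → c :* ((N :+ M) :* a) :+ y := c :* (M :* a) :+ (c :* (N :* a) :+ y)) refl c N M (fromℤ a) y ⟩
      c * (M * fromℤ a) + (c * (N * fromℤ a) + y)      ≈⟨ +-cong (*-congˡ (fromℤ-* (+ m) a)) (+-congʳ (*-congˡ (fromℤ-* (+ suc n) a))) ⟨
      c * fromℤ (+ m ℤ.* a) + (c * fromℤ (+ suc n ℤ.* a) + y) ∎
    join : ∀ c d a y → c * fromℤ (+ m ℤ.* a) + (d * fromℤ (+ suc n ℤ.* a) + y)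
                     ≈ S ⁻¹ * (c * M + d * N) * fromℤ (+ suc (n ℕ.+ m) ℤ.* a) + y
    join c d a y = begin
      c * fromℤ (+ m ℤ.* a) + (d * fromℤ (+ suc n ℤ.* a) + y)
        ≈⟨ +-cong (*-congˡ (fromℤ-* (+ m) a)) (+-congʳ (*-congˡ (fromℤ-* (+ suc n) a))) ⟩
      c * (M * fromℤ a) + (d * (N * fromℤ a) + y)
        ≈⟨ solve 6 (λ c d N M a y → c :* (M :* a) :+ (d :* (N :* a) :+ y) := (c :* M :+ d :* N) :* a :+ y) refl c d N M (fromℤ a) y ⟩
      (c * M + d * N) * fromℤ a + y
        ≈⟨ +-congʳ (trans (*-congʳ (inverseˡ S S≉0)) (*-identityˡ _)) ⟨
      S ⁻¹ * S * ((c * M + d * N) * fromℤ a) + y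
        ≈⟨ solve 5 (λ i S w a y → i :* S :* (w :* a) :+ y := i :* w :* (S :* a) :+ y) refl (S ⁻¹) S (c * M + d * N) (fromℤ a) y ⟩
      S ⁻¹ * (c * M + d * N) * (S * fromℤ a) + y
        ≈⟨ +-congʳ (*-congˡ (fromℤ-* (+ suc (n ℕ.+ m)) a)) ⟨
      S ⁻¹ * (c * M + d * N) * fromℤ (+ suc (n ℕ.+ m) ℤ.* a) + y ∎

  ≃-mergeSigned : ∀ {L} k n e → k • e ∷ + suc n • e ∷ L ≃ + suc (n ℕ.+ ℤ.∣ k ∣) • e ∷ L
  ≃-mergeSigned (+ m)    n e = ≃-merge m n e
  ≃-mergeSigned {L} -[1+ m ] n e@(a , b) =
    ≃-trans (≡.subst (λ u → u ∷ + suc n • e ∷ L ≃ + suc m • e ∷ + suc n • e ∷ L) (≡.cong₂ _,_ (assoc a) (assoc b))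
              (≃-negate (+ suc m • e)))
            (≃-merge (suc m) n e)
    where
    assoc : ∀ a → -[1+ 0 ] ℤ.* (+ suc m ℤ.* a) ≡ -[1+ m ] ℤ.* a
    assoc a = ≡.trans (≡.sym (ℤₚ.*-assoc -[1+ 0 ] (+ suc m) a)) (≡.cong (ℤ._* a) (ℤₚ.-1*i≡-i (+ suc m)))

  mergedCoefficients : ∀ {a b c k g s} → c * fromℤ s ≈ a * fromℤ k + b * fromℤ g → ∀ x y →
                       c * fromℤ (s ℤ.* x) + y ≈ a * fromℤ (k ℤ.* x) + (b * fromℤ (g ℤ.* x) + y)
  mergedCoefficients {a} {b} {c} {k} {g} {s} eq x y = begin
    c * fromℤ (s ℤ.* x) + y
      ≈⟨ +-congʳ (trans (*-congˡ (fromℤ-* s x)) (sym (*-assoc _ _ _))) ⟩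
    c * fromℤ s * fromℤ x + y
      ≈⟨ +-congʳ (*-congʳ eq) ⟩
    (a * fromℤ k + b * fromℤ g) * fromℤ x + y
      ≈⟨ solve 6 (λ a k b g x y → (a :* k :+ b :* g) :* x :+ y := a :* (k :* x) :+ (b :* (g :* x) :+ y)) refl a (fromℤ k) b (fromℤ g)
          (fromℤ x) y ⟩
    a * (fromℤ k * fromℤ x) + (b * (fromℤ g * fromℤ x) + y)
      ≈⟨ +-cong (*-congˡ (fromℤ-* k x)) (+-congʳ (*-congˡ (fromℤ-* g x))) ⟨
    a * fromℤ (k ℤ.* x) + (b * fromℤ (g ℤ.* x) + y) ∎

  mergedCoefficient : ∀ a b k g → ∃[ c ] c * fromℤ (+ suc g) ≈ a * fromℤ k + b
  mergedCoefficient a b k g = s ⁻¹ * w ,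
    trans (trans (*-comm _ _) (sym (*-assoc s (s ⁻¹) w))) (trans (*-congʳ (inverseʳ s (fromℕ≉0 g))) (*-identityˡ w))
    where
    s = fromℤ (+ suc g)
    w = a * fromℤ k + b

  -- The coefficients only matter for cosimple collections, where they form a linear dependence.
  Item : Set
  Item = ℝ × Ray

  vectors : List Item → List ℤ²
  vectors = map (λ i → vector (proj₂ i))

  weightedSum : List Item → ℝ²
  weightedSum []            = 0ᴹ
  weightedSum ((a , r) ∷ I) = (a *ₗ fromℤ² (vector r)) +ᴹ weightedSum I

  -- A trace of the insertion, so that each invariant (zonotope, weighted sum, span, independence,
  -- separation of coefficients) has its own induction, free of the decisions made by `insert`.
  data Insert (a : ℝ) (v : ℤ²) : List Item → List Item → Set where
    new   : ∀ r → vector r ≡ v → Insert a v [] ((a , r) ∷ [])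
    merge : ∀ {b r I} c k → v ≡ k • direction r → k ≢ + 0 →
            c * fromℤ (+ suc (excess r ℕ.+ ℤ.∣ k ∣)) ≈ a * fromℤ k + b * fromℤ (+ suc (excess r)) →
            Insert a v ((b , r) ∷ I) ((c , ray (excess r ℕ.+ ℤ.∣ k ∣) (direction r) (primitive-direction r)) ∷ I)
    skip  : ∀ {b r I J} → 1 ≤ℕ area (direction r) v → Insert a v I J → Insert a v ((b , r) ∷ I) ((b , r) ∷ J)

  insert : ∀ a v → v ≢ 0² → ∀ I → ∃[ J ] Insert a v I J
  insert a v v≢0 []            = let r , eq = toRay v v≢0 in _ , new r eq
  insert a v v≢0 ((b , r) ∷ I) = choose (area (direction r) v) ≡.refl
    where
    f = proj₁ (primitive-direction r)
    k = det v f
    choose : ∀ h → area (direction r) v ≡ h → ∃[ J ] Insert a v ((b , r) ∷ I) J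
    choose (suc h) eq = let J , i = insert a v v≢0 I in _ , skip (≡.subst (1 ≤ℕ_) (≡.sym eq) (s≤s z≤n)) i
    -- Area zero kills the coordinate of v across the direction of r, so v is the direction times
    -- its other coordinate k.
    choose zero    eq = _ , merge (proj₁ merged) k v≡ k≢0 (proj₂ merged)
      where
      merged = mergedCoefficient a (b * fromℤ (+ suc (excess r))) k (excess r ℕ.+ ℤ.∣ k ∣)
      onAxis : ∀ k (e f : ℤ²) → ⟦ e , f ⟧ (k , + 0) ≡ k • e
      onAxis k e f = ≡.cong₂ _,_ (ℤₚ.+-identityʳ _) (ℤₚ.+-identityʳ _)
      v≡ : v ≡ k • direction r
      v≡ = ≡.trans (coordinates (direction r) f (proj₂ (primitive-direction r)) v)
        (≡.trans (≡.cong (λ h → ⟦ direction r , f ⟧ (k , h)) (ℤₚ.∣i∣≡0⇒i≡0 {det (direction r) v} eq)) (onAxis k (direction r) f))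
      k≢0 : k ≢ + 0
      k≢0 k≡0 = v≢0 (≡.trans v≡ (≡.cong (_• direction r) k≡0))

  insert-≃ : ∀ {a v I J} → Insert a v I J → v ∷ vectors I ≃ vectors J
  insert-≃ (new r ≡.refl)                = ≃-refl
  insert-≃ (merge {r = r} c k ≡.refl _ _) = ≃-mergeSigned k (excess r) (direction r)
  insert-≃ {v = v} (skip {r = r} _ i)    = ≃-trans (≃-↭ (swap v (vector r) ↭-refl)) (≃-cons (vector r) (insert-≃ i))

  -- Carried through the reduction in order to exclude fewer than two directions for a cosimple
  -- collection.
  Span : List ℤ² → ℝ² → Set
  Span []      x = x ≈ᴹ 0ᴹ
  Span (u ∷ L) x = ∃[ c ] ∃[ y ] (Span L y × x ≈ᴹ (c *ₗ fromℤ² u) +ᴹ y)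

  Span-resp : ∀ L {x y} → x ≈ᴹ y → Span L x → Span L y
  Span-resp []      x≈y x∈              = ≈ᴹ-trans (≈ᴹ-sym x≈y) x∈
  Span-resp (u ∷ L) x≈y (c , z , z∈ , eq) = c , z , z∈ , ≈ᴹ-trans (≈ᴹ-sym x≈y) eq

  insert-weightedSum : ∀ {a v I J} → Insert a v I J → weightedSum J ≈ᴹ (a *ₗ fromℤ² v) +ᴹ weightedSum I
  insert-weightedSum (new r ≡.refl) = ≈ᴹ-refl
  insert-weightedSum {a} (merge {b} {r} {I} c k ≡.refl _ eq) =
    mergedCoefficients {a} {b} {c} {k} {+ suc (excess r)} {+ suc (excess r ℕ.+ ℤ.∣ k ∣)} eq (proj₁ (direction r)) (proj₁ (weightedSum I)) ,
    mergedCoefficients {a} {b} {c} {k} {+ suc (excess r)} {+ suc (excess r ℕ.+ ℤ.∣ k ∣)} eq (proj₂ (direction r)) (proj₂ (weightedSum I))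
  insert-weightedSum (skip _ i) = ≈ᴹ-trans (+ᴹ-cong ≈ᴹ-refl (insert-weightedSum i)) (exchange _ _ _ , exchange _ _ _)

  insert-Span : ∀ {a v I J} → Insert a v I J → ∀ {x} → Span (v ∷ vectors I) x → Span (vectors J) x
  insert-Span (new r ≡.refl) x∈ = x∈
  insert-Span (merge {r = r} _ k ≡.refl _ _) (c , _ , (d , y , y∈ , eq′) , eq) =
    let e , e-eq = mergedCoefficient c (d * fromℤ (+ suc (excess r))) k (excess r ℕ.+ ℤ.∣ k ∣)
        split    = mergedCoefficients {c} {d} {e} {k} {+ suc (excess r)} {+ suc (excess r ℕ.+ ℤ.∣ k ∣)} e-eq in
    e , y , y∈ , ≈ᴹ-trans eq (≈ᴹ-trans (+ᴹ-cong ≈ᴹ-refl eq′)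
      (sym (split (proj₁ (direction r)) (proj₁ y)) , sym (split (proj₂ (direction r)) (proj₂ y))))
  insert-Span (skip _ i) (c , _ , (d , y , y∈ , eq′) , eq) =
    d , _ , insert-Span i (c , y , y∈ , ≈ᴹ-refl) , ≈ᴹ-trans eq (≈ᴹ-trans (+ᴹ-cong ≈ᴹ-refl eq′) (exchange _ _ _ , exchange _ _ _))

  IndependentItems : Item → Item → Set
  IndependentItems i j = Independent (proj₂ i) (proj₂ j)

  insert-All-independent : ∀ {a v I J} z → Insert a v I J → 1 ≤ℕ area (direction (proj₂ z)) v →
                           All (IndependentItems z) I → All (IndependentItems z) J
  insert-All-independent z (new r ≡.refl) zv [] = nonzero (multiplicity r) (area (direction (proj₂ z)) (direction r))
      (ℕₚ.≤-trans zv (ℕₚ.≤-reflexive (area-•ʳ (+ multiplicity r) (direction (proj₂ z)) (direction r)))) ∷ []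
    where
    nonzero : ∀ m n → 1 ≤ℕ m ℕ.* n → 1 ≤ℕ n
    nonzero m zero    h = contradiction (ℕₚ.≤-trans h (ℕₚ.≤-reflexive (ℕₚ.*-zeroʳ m))) λ ()
    nonzero m (suc n) h = s≤s z≤n
  insert-All-independent z (merge _ _ _ _ _) zv (h ∷ hs) = h ∷ hs
  insert-All-independent z (skip _ i)        zv (h ∷ hs) = h ∷ insert-All-independent z i zv hs

  insert-independent : ∀ {a v I J} → Insert a v I J → AllPairs IndependentItems I → AllPairs IndependentItems J
  insert-independent (new _ _)           []       = [] ∷ []
  insert-independent (merge _ _ _ _ _)   (h ∷ hs) = h ∷ hs
  insert-independent (skip {b} {r} rv i) (h ∷ hs) = insert-All-independent (b , r) i rv h ∷ insert-independent i hs

  -- A ray of excess zero carries the coefficient of a single original vector.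
  Apart : ℝ → Item → Set
  Apart a (b , s) = excess s ≡ 0 → ¬ (∣ a ∣ ≈ ∣ b ∣)

  ApartItems : Item → Item → Set
  ApartItems (a , r) j = excess r ≡ 0 → Apart a j

  NonzeroItem : Item → Set
  NonzeroItem (a , r) = excess r ≡ 0 → ¬ (a ≈ 0#)

  -- A merged ray has positive excess, so every condition on its coefficient holds vacuously.
  merged-excess : ∀ g k → k ≢ + 0 → g ℕ.+ ℤ.∣ k ∣ ≢ 0
  merged-excess g k k≢0 eq = k≢0 (ℤₚ.∣i∣≡0⇒i≡0 (ℕₚ.m+n≡0⇒n≡0 g eq))

  insert-All-apart : ∀ {a v I J} z → Insert a v I J → ¬ (∣ z ∣ ≈ ∣ a ∣) → All (Apart z) I → All (Apart z) J
  insert-All-apart z (new _ _)             z≉a []       = (λ _ → z≉a) ∷ []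
  insert-All-apart z (merge {r = r} _ k _ k≢0 _) z≉a (_ ∷ hs) = (λ eq → contradiction eq (merged-excess (excess r) k k≢0)) ∷ hs
  insert-All-apart z (skip _ i)            z≉a (h ∷ hs) = h ∷ insert-All-apart z i z≉a hs

  insert-apart : ∀ {a v I J} → Insert a v I J → All (Apart a) I → AllPairs ApartItems I → AllPairs ApartItems J
  insert-apart (new _ _) _ [] = [] ∷ []
  insert-apart (merge {r = r} _ k _ k≢0 _) (_ ∷ as) (h ∷ hs) =
    All.map (λ _ eq → contradiction eq (merged-excess (excess r) k k≢0)) as ∷ hs
  insert-apart {a} {J = _ ∷ J} (skip {b} {r} _ i) (a-apart ∷ as) (h ∷ hs) = head (excess r) ≡.refl ∷ insert-apart i as hs
    where
    -- For excess zero, the comparison of b with the inserted coefficient is the given one with its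
    -- sides exchanged; for positive excess every condition of this row is vacuous.
    head : ∀ g → excess r ≡ g → All (ApartItems (b , r)) J
    head 0       r≡0 = All.map (λ h _ → h) (insert-All-apart b i (λ eq → a-apart r≡0 (sym eq)) (All.map (λ h → h r≡0) h))
    head (suc g) r≡  = All.universal (λ _ r≡0 → contradiction (≡.trans (≡.sym r≡0) r≡) λ ()) J

  insert-nonzero : ∀ {a v I J} → Insert a v I J → ¬ (a ≈ 0#) → All NonzeroItem I → All NonzeroItem J
  insert-nonzero (new _ _)                     a≉0 []       = (λ _ → a≉0) ∷ []
  insert-nonzero (merge {r = r} _ k _ k≢0 _)   a≉0 (_ ∷ hs) = (λ eq → contradiction eq (merged-excess (excess r) k k≢0)) ∷ hs
  insert-nonzero (skip _ i)                    a≉0 (h ∷ hs) = h ∷ insert-nonzero i a≉0 hs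

  -- The classification instantiates c with zeros, the cosimple bound with the coefficients of a
  -- dependence. `all-apart` carries the induction for `apart`: it compares the coefficient of the
  -- next vector with all items formed so far.
  record Reduction {n} (c : Vector ℝ n) (u : Vector ℤ² n) : Set where
    field
      items       : List Item
      equivalent  : tabulate u ≃ vectors items
      weightedSum-eq    : weightedSum items ≈ᴹ combination c u
      spanning    : ∀ d → Span (vectors items) (combination d u)
      independent : AllPairs IndependentItems items
      apart       : (∀ i j → i ≢ j → ¬ (∣ c i ∣ ≈ ∣ c j ∣)) → AllPairs ApartItems items
      all-apart   : ∀ a → (∀ i → ¬ (∣ a ∣ ≈ ∣ c i ∣)) → All (Apart a) items
      nonzero     : (∀ i → ¬ (c i ≈ 0#)) → All NonzeroItem items

  reduce : ∀ {n} (c : Vector ℝ n) (u : Vector ℤ² n) → Reduction c u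
  reduce {zero} c u = record
    { items = [] ; equivalent = ≃-refl ; weightedSum-eq = ≈ᴹ-refl ; spanning = λ _ → ≈ᴹ-refl ; independent = [] ; apart = λ _ → []
    ; all-apart = λ _ _ → [] ; nonzero = λ _ → [] }
  reduce {suc n} c u = extend (u zero) ≡.refl (reduce (λ i → c (suc i)) (λ i → u (suc i)))
    where
    extendNonzero : u zero ≢ 0² → Reduction (λ i → c (suc i)) (λ i → u (suc i)) → Reduction c u
    extendNonzero u≢0 R = record
      { items       = proj₁ inserted
      ; equivalent  = ≃-trans (≃-cons (u zero) R.equivalent) (insert-≃ i)
      ; weightedSum-eq    = ≈ᴹ-trans (insert-weightedSum i) (+ᴹ-cong ≈ᴹ-refl R.weightedSum-eq)
      ; spanning    = λ d → insert-Span i (d zero , _ , R.spanning (λ j → d (suc j)) , ≈ᴹ-refl)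
      ; independent = insert-independent i R.independent
      ; apart       = λ h → insert-apart i (R.all-apart (c zero) (λ j → h zero (suc j) λ ())) (R.apart (λ j k j≢k → h (suc j) (suc k) λ { ≡.refl → j≢k ≡.refl }))
      ; all-apart   = λ a h → insert-All-apart a i (h zero) (R.all-apart a (λ j → h (suc j)))
      ; nonzero     = λ h → insert-nonzero i (h zero) (R.nonzero (λ j → h (suc j)))
      }
      where
      module R = Reduction R
      inserted = insert (c zero) (u zero) u≢0 R.items
      i = proj₂ inserted
    extendZero : u zero ≡ 0² → Reduction (λ i → c (suc i)) (λ i → u (suc i)) → Reduction c u
    extendZero u≡0 R = record
      { items       = R.items
      ; equivalent  = ≡.subst (λ v → v ∷ tabulate (λ i → u (suc i)) ≃ vectors R.items) (≡.sym u≡0) (≃-trans ≃-zero R.equivalent)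
      ; weightedSum-eq    = ≈ᴹ-trans R.weightedSum-eq
          (≡.subst (λ v → combination (λ i → c (suc i)) (λ i → u (suc i)) ≈ᴹ (c zero *ₗ fromℤ² v) +ᴹ combination (λ i → c (suc i))
              (λ i → u (suc i))) (≡.sym u≡0)
            (vanish (c zero) , vanish (c zero)))
      ; spanning    = λ d → Span-resp (vectors R.items)
          (≡.subst (λ v → combination (λ i → d (suc i)) (λ i → u (suc i)) ≈ᴹ (d zero *ₗ fromℤ² v) +ᴹ combination (λ i → d (suc i))
              (λ i → u (suc i))) (≡.sym u≡0)
            (vanish (d zero) , vanish (d zero)))
          (R.spanning (λ j → d (suc j)))
      ; independent = R.independent
      ; apart       = λ h → R.apart (λ j k j≢k → h (suc j) (suc k) λ { ≡.refl → j≢k ≡.refl })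
      ; all-apart   = λ a h → R.all-apart a (λ j → h (suc j))
      ; nonzero     = λ h → R.nonzero (λ j → h (suc j))
      }
      where
      module R = Reduction R
      vanish : ∀ c {y} → y ≈ c * fromℤ (+ 0) + y
      vanish c {y} = sym (trans (+-congʳ (zeroʳ c)) (+-identityˡ y))
    extend : ∀ v → u zero ≡ v → Reduction (λ i → c (suc i)) (λ i → u (suc i)) → Reduction c u
    extend (+ 0 , + 0)        eq = extendZero eq
    extend (+ suc _ , _)      eq = extendNonzero λ eq′ → contradiction (≡.trans (≡.sym eq) eq′) λ ()
    extend (-[1+ _ ] , _)     eq = extendNonzero λ eq′ → contradiction (≡.trans (≡.sym eq) eq′) λ ()
    extend (+ 0 , + suc _)    eq = extendNonzero λ eq′ → contradiction (≡.trans (≡.sym eq) eq′) λ ()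
    extend (+ 0 , -[1+ _ ])   eq = extendNonzero λ eq′ → contradiction (≡.trans (≡.sym eq) eq′) λ ()

  -- Widths

  dot-linear : ∀ z c u (y : ℝ²) → ⟨ z ∙ (c *ₗ fromℤ² u) +ᴹ y ⟩ ≈ c * fromℤ (dot z u) + ⟨ z ∙ y ⟩
  dot-linear (a , b) c (u , v) (x , y) = begin
    fromℤ a * (c * fromℤ u + x) + fromℤ b * (c * fromℤ v + y)
      ≈⟨ solve 7 (λ a b c u v x y → a :* (c :* u :+ x) :+ b :* (c :* v :+ y) := c :* (a :* u :+ b :* v) :+ (a :* x :+ b :* y))
           refl (fromℤ a) (fromℤ b) c (fromℤ u) (fromℤ v) x y ⟩
    c * (fromℤ a * fromℤ u + fromℤ b * fromℤ v) + (fromℤ a * x + fromℤ b * y)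
      ≈⟨ +-congʳ (*-congˡ (trans (fromℤ-+ (a ℤ.* u) (b ℤ.* v)) (+-cong (fromℤ-* a u) (fromℤ-* b v)))) ⟨
    c * fromℤ (a ℤ.* u ℤ.+ b ℤ.* v) + (fromℤ a * x + fromℤ b * y) ∎

  dot-cong : ∀ z {x y} → x ≈ᴹ y → ⟨ z ∙ x ⟩ ≈ ⟨ z ∙ y ⟩
  dot-cong (a , b) (p , q) = +-cong (*-congˡ p) (*-congˡ q)

  -- Minus the minimum of z on the zonotope, which is attained with coefficient 1 on the generators
  -- of negative pairing and 0 on the others.
  depth : ℤ² → List ℤ² → ℕ
  depth z []      = 0
  depth z (u ∷ L) = negativePart (dot z u) ℕ.+ depth z L

  depth-cons : ∀ z u L c (y : ℝ²) → fromℤ (+ depth z (u ∷ L)) + ⟨ z ∙ (c *ₗ fromℤ² u) +ᴹ y ⟩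
             ≈ (fromℤ (+ negativePart (dot z u)) + c * fromℤ (dot z u)) + (fromℤ (+ depth z L) + ⟨ z ∙ y ⟩)
  depth-cons z u L c y = trans (+-cong (fromℤ-+ (+ negativePart (dot z u)) (+ depth z L)) (dot-linear z c u y))
    (solve 4 (λ m n c y → m :+ n :+ (c :+ y) := m :+ c :+ (n :+ y)) refl _ _ _ _)

  dot-0ᴹ : ∀ z → fromℤ (+ 0) + ⟨ z ∙ 0ᴹ ⟩ ≈ 0#
  dot-0ᴹ (a , b) = solve 2 (λ a b → con (+ 0) :+ (a :* con (+ 0) :+ b :* con (+ 0)) := con (+ 0)) refl (fromℤ a) (fromℤ b)

  depth-bounds : ∀ z L {x} → Zon L x → 0# ≤ fromℤ (+ depth z L) + ⟨ z ∙ x ⟩ × fromℤ (+ depth z L) + ⟨ z ∙ x ⟩ ≤ fromℤ (+ widthAlong z L)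
  depth-bounds z [] eq = ≤-reflexive (sym vanish) , ≤-reflexive vanish
    where
    vanish = trans (+-congˡ (dot-cong z eq)) (dot-0ᴹ z)
  depth-bounds z (u ∷ L) (c , y , (c≥0 , c≤1) , y∈ , eq) =
    ≤-respʳ (sym eq′) (0≤+ (proj₁ here) (proj₁ there)) ,
    ≤-resp (sym eq′) (sym (fromℤ-+ (+ ℤ.∣ dot z u ∣) (+ widthAlong z L))) (+-mono-≤ (proj₂ here) (proj₂ there))
    where
    here = shift-bounds (dot z u) c c≥0 c≤1
    there = depth-bounds z L y∈
    eq′ = trans (+-congˡ (dot-cong z eq)) (depth-cons z u L c y)

  lowest : ∀ z L → ∃[ x ] (Zon L x × fromℤ (+ depth z L) + ⟨ z ∙ x ⟩ ≈ 0#)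
  lowest z []      = 0ᴹ , ≈ᴹ-refl , dot-0ᴹ z
  lowest z (u ∷ L) with lowest z L | end (dot z u)
    where
    end : ∀ d → ∃[ c ] ((0# ≤ c × c ≤ 1#) × fromℤ (+ negativePart d) + c * fromℤ d ≈ 0#)
    end (+ n)    = 0# , (≤-refl , 0≤1) , trans (+-identityˡ _) (zeroˡ _)
    end -[1+ n ] = 1# , (0≤1 , ≤-refl) , trans (+-congˡ (*-identityˡ _)) (-‿inverseʳ _)
  ... | y , y∈ , eq | c , bounds , eq′ = _ , (c , y , bounds , y∈ , ≈ᴹ-refl) ,
    trans (depth-cons z u L c y) (trans (+-cong eq′ eq) (+-identityˡ 0#))

  highest : ∀ z L → ∃[ x ] (Zon L x × fromℤ (+ depth z L) + ⟨ z ∙ x ⟩ ≈ fromℤ (+ widthAlong z L))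
  highest z []      = 0ᴹ , ≈ᴹ-refl , dot-0ᴹ z
  highest z (u ∷ L) with highest z L | end (dot z u)
    where
    end : ∀ d → ∃[ c ] ((0# ≤ c × c ≤ 1#) × fromℤ (+ negativePart d) + c * fromℤ d ≈ fromℤ (+ ℤ.∣ d ∣))
    end (+ n)    = 1# , (0≤1 , ≤-refl) , trans (+-identityˡ _) (*-identityˡ _)
    end -[1+ n ] = 0# , (≤-refl , 0≤1) , trans (+-congˡ (zeroˡ _)) (+-identityʳ _)
  ... | y , y∈ , eq | c , bounds , eq′ = _ , (c , y , bounds , y∈ , ≈ᴹ-refl) ,
    trans (depth-cons z u L c y) (trans (+-cong eq′ eq) (sym (fromℤ-+ (+ ℤ.∣ dot z u ∣) (+ widthAlong z L))))

  isolate : ∀ {n x w} → n + x ≈ w → x ≈ w - n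
  isolate {n} {x} {w} eq = trans (solve 2 (λ n x → x := n :+ x :- n) refl n x) (+-congʳ eq)

  isWidthAlong : ∀ {n} (u : Vector ℤ² n) z → IsWidthAlong z (zonotope u) (fromℤ (+ widthAlong z (tabulate u)))
  isWidthAlong u z = W - N , 0# - N ,
    ((xʰ , Zon⇒zonotope u xʰ∈ , sym (isolate xʰ-eq)) ,
     (λ v (x , x∈ , eq) → 0≤⇒≤ (≤-respʳ (trans (solve 3 (λ W N x → W :- (N :+ x) := W :- N :- x) refl W N ⟨ z ∙ x ⟩)
         (+-congˡ (-‿cong (sym eq))))
        (≤⇒0≤ (proj₂ (depth-bounds z L (zonotope⇒Zon u x∈))))))) ,
    ((xˡ , Zon⇒zonotope u xˡ∈ , sym (isolate xˡ-eq)) ,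
     (λ v (x , x∈ , eq) → 0≤⇒≤ (≤-respʳ (trans (solve 2 (λ N x → N :+ x := x :- (con (+ 0) :- N)) refl N ⟨ z ∙ x ⟩) (+-congʳ (sym eq)))
        (proj₁ (depth-bounds z L (zonotope⇒Zon u x∈)))))) ,
    solve 2 (λ W N → W := W :- N :- (con (+ 0) :- N)) refl W N
    where
    L = tabulate u
    W = fromℤ (+ widthAlong z L)
    N = fromℤ (+ depth z L)
    xʰ = proj₁ (highest z L)
    xʰ∈ = proj₁ (proj₂ (highest z L))
    xʰ-eq = proj₂ (proj₂ (highest z L))
    xˡ = proj₁ (lowest z L)
    xˡ∈ = proj₁ (proj₂ (lowest z L))
    xˡ-eq = proj₂ (proj₂ (lowest z L))

  -- A claimed maximum dominates the value attained by `highest`, and a claimed minimum lies below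
  -- that of `lowest`.
  widthAlong≤ : ∀ {n} (u : Vector ℤ² n) z {w} → IsWidthAlong z (zonotope u) w → fromℤ (+ widthAlong z (tabulate u)) ≤ w
  widthAlong≤ u z {w} (M , m , (_ , upper) , (_ , lower) , eq) with isWidthAlong u z
  ... | M′ , m′ , (attained , _) , (attained′ , _) , eq′ = ≤-resp (sym eq′) (sym eq)
    (+-mono-≤ (upper M′ attained) (neg-mono-≤ (lower m′ attained′)))

  isLatticeWidth : ∀ {n} (u : Vector ℤ² n) w z → z ≢ 0² → widthAlong z (tabulate u) ≡ w →
                   (∀ z → z ≢ 0² → w ≤ℕ widthAlong z (tabulate u)) → IsLatticeWidth (zonotope u) (fromℤ (+ w))
  isLatticeWidth u w z z≢0 ≡.refl minimal =
    (z , z≢0 , isWidthAlong u z) ,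
    λ w′ (z′ , z′≢0 , along) → ≤-trans (fromℕ-mono (minimal z′ z′≢0)) (widthAlong≤ u z′ along)

  -- The classification

  1+1≉0 : ¬ (1# + 1# ≈ 0#)
  1+1≉0 eq = fromℕ≉0 1 (trans (+-congˡ (+-identityʳ 1#)) eq)

  double : ∀ x → (1# + 1#) * x ≈ x + x
  double x = trans (distribʳ x 1# 1#) (+-cong (*-identityˡ x) (*-identityˡ x))

  0<½ : 0# < ½
  0<½ = 0≤⁻¹ (1# + 1#) 1+1≉0 (0≤+ 0≤1 0≤1) ,
        λ eq → 1≉0 (trans (sym (inverseʳ (1# + 1#) 1+1≉0)) (trans (*-congˡ (sym eq)) (zeroʳ _)))

  -- Apply the covering modulo 2ℤ² to 2 x - t and halve the result.
  half-Covers : ∀ {C : Pred ℝ² 0ℓ} {M} t → (∀ {y} → Zon M y → C (y +ᴹ fromℤ² t)) → Cov M → Covers ½ C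
  half-Covers t inside cov (x₁ , x₂) with cov (x₁ + x₁ - fromℤ (proj₁ t) , x₂ + x₂ - fromℤ (proj₂ t))
  ... | y , z , y∈ , eq₁ , eq₂ = _ , z , inside y∈ , (halve x₁ (proj₁ t) (proj₁ y) (proj₁ z) eq₁ , halve x₂ (proj₂ t) (proj₂ y)
      (proj₂ z) eq₂)
    where
    halve : ∀ x t y z → x + x - fromℤ t ≈ y + fromℤ (+ 2 ℤ.* z) → x ≈ ½ * (y + fromℤ t) + fromℤ z
    halve x t y z eq = *-cancelˡ (1# + 1#) 1+1≉0 (begin
      (1# + 1#) * x
        ≈⟨ double x ⟩
      x + x
        ≈⟨ solve 2 (λ x t → x := (x :- t) :+ t) refl (x + x) (fromℤ t) ⟩
      (x + x - fromℤ t) + fromℤ t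
        ≈⟨ +-congʳ (trans eq (+-congˡ (trans (fromℤ-* (+ 2) z) (solve 1 (λ z → con (+ 2) :* z := z :+ z) refl (fromℤ z))))) ⟩
      (y + (fromℤ z + fromℤ z)) + fromℤ t
        ≈⟨ solve 3 (λ y z t → (y :+ (z :+ z)) :+ t := (y :+ t) :+ (z :+ z)) refl y (fromℤ z) (fromℤ t) ⟩
      (y + fromℤ t) + (fromℤ z + fromℤ z)
        ≈⟨ +-cong (trans (sym (*-assoc _ _ _)) (trans (*-congʳ (inverseʳ (1# + 1#) 1+1≉0)) (*-identityˡ _))) (double (fromℤ z)) ⟨
      (1# + 1#) * (½ * (y + fromℤ t)) + (1# + 1#) * fromℤ z
        ≈⟨ distribˡ (1# + 1#) _ _ ⟨
      (1# + 1#) * (½ * (y + fromℤ t) + fromℤ z) ∎)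

  slab⇒μ≤½ : ∀ {C : Pred ℝ² 0ℓ} {M μ} t → (∀ {y} → Zon M y → C (y +ᴹ fromℤ² t)) → Slab M → IsCoveringRadius C μ → μ ≤ ½
  slab⇒μ≤½ {C} t inside s (_ , minimal) = minimal ½ (0<½ , half-Covers {C} t inside (slab⇒Cov s))

  -- `pair` holds up to order because `normalForm` wants a primitive first generator, which may be
  -- the second of the list.
  data Outcome : List ℤ² → Set where
    slab   : ∀ {L} → Slab L → Outcome L
    empty  : Outcome []
    single : ∀ {u} → Outcome (u ∷ [])
    pair   : ∀ {L u v} → L ↭ u ∷ v ∷ [] → (N : NormalForm u v) → Exceptional (NormalForm.r N) (NormalForm.n N) → Outcome L
    triple : ∀ {u v w} → 1 ≤ℕ area u v → 1 ≤ℕ area u w → 1 ≤ℕ area v w → TwoUnit u v w → Outcome (u ∷ v ∷ w ∷ [])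

  -- Two nonprimitive rays fall under `slabOfPair`, so in the remaining pairs a primitive ray can be
  -- put first. Four rays have a certificate, and any further ones only enlarge the zonotope.
  outcome : ∀ I → AllPairs IndependentItems I → Outcome (vectors I)
  outcome [] _ = empty
  outcome (_ ∷ []) _ = single
  outcome ((_ , r) ∷ (_ , s) ∷ []) ((rs ∷ []) ∷ _) = cases (zeroOrPositive (excess r)) (zeroOrPositive (excess s))
    where
    normal : ∀ {L} r s → Independent r s → excess r ≡ 0 → (L ↭ vector r ∷ vector s ∷ []) → Outcome L
    normal {L} r s rs r≡0 p = result (primitivePair N (≡.subst (1 ≤ℕ_) (NormalForm.area-eq N) rs′))
      where
      rs′ = independent-area r s rs
      N = normalForm (vector r) (vector s) (vector-primitive r r≡0) rs′
      result : Slab (vector r ∷ vector s ∷ []) ⊎ Exceptional (NormalForm.r N) (NormalForm.n N) → Outcome L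
      result (inj₁ l) = slab (permute (↭-sym p) l)
      result (inj₂ e) = pair p N e
    cases : excess r ≡ 0 ⊎ 1 ≤ℕ excess r → excess s ≡ 0 ⊎ 1 ≤ℕ excess s → Outcome (vector r ∷ vector s ∷ [])
    cases (inj₁ r≡0) _          = normal r s rs r≡0 ↭-refl
    cases (inj₂ _)   (inj₁ s≡0) = normal s r (independent-sym {r} {s} rs) s≡0 (swap (vector r) (vector s) ↭-refl)
    cases (inj₂ r≥1) (inj₂ s≥1) = slab (slabOfPair r s r≥1 s≥1 rs)
  outcome ((_ , r) ∷ (_ , s) ∷ (_ , t) ∷ []) ((rs ∷ rt ∷ []) ∷ (st ∷ []) ∷ _) = cases (hexagon r s t rs rt st)
    where
    cases : Hexagon (vector r) (vector s) (vector t) → Outcome (vector r ∷ vector s ∷ vector t ∷ [])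
    cases (inj₁ l)   = slab l
    cases (inj₂ two) = triple (independent-area r s rs) (independent-area r t rt) (independent-area s t st) two
  outcome ((_ , r) ∷ (_ , s) ∷ (_ , t) ∷ (_ , q) ∷ I) ((rs ∷ rt ∷ rq ∷ _) ∷ (st ∷ sq ∷ _) ∷ (tq ∷ _) ∷ _) =
    slab (slab-++ (vectors I) (slabOfFour r s t q rs rt rq st sq tq))

  linearMap : (p q : ℤ²) → ℝ² → ℝ²
  linearMap p q (x , y) = (x *ₗ fromℤ² p) +ᴹ (y *ₗ fromℤ² q)

  linearMap-cons : ∀ p q c u y → linearMap p q ((c *ₗ fromℤ² u) +ᴹ y) ≈ᴹ (c *ₗ fromℤ² (⟦ p , q ⟧ u)) +ᴹ linearMap p q y
  linearMap-cons (p₁ , p₂) (q₁ , q₂) c (u₁ , u₂) (y₁ , y₂) = component p₁ q₁ , component p₂ q₂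
    where
    component : ∀ p q → (c * fromℤ u₁ + y₁) * fromℤ p + (c * fromℤ u₂ + y₂) * fromℤ q
                      ≈ c * fromℤ (u₁ ℤ.* p ℤ.+ u₂ ℤ.* q) + (y₁ * fromℤ p + y₂ * fromℤ q)
    component p q = trans
      (solve 7 (λ c u v x y p q → (c :* u :+ x) :* p :+ (c :* v :+ y) :* q := c :* (u :* p :+ v :* q) :+ (x :* p :+ y :* q))
        refl c (fromℤ u₁) (fromℤ u₂) y₁ y₂ (fromℤ p) (fromℤ q))
      (+-congʳ (*-congˡ (sym (trans (fromℤ-+ (u₁ ℤ.* p) (u₂ ℤ.* q)) (+-cong (fromℤ-* u₁ p) (fromℤ-* u₂ q))))))

  linearMap-cong : ∀ p q {x y} → x ≈ᴹ y → linearMap p q x ≈ᴹ linearMap p q y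
  linearMap-cong p q (e₁ , e₂) = +-cong (*-congʳ e₁) (*-congʳ e₂) , +-cong (*-congʳ e₁) (*-congʳ e₂)

  linearMap-0 : ∀ p q → linearMap p q 0ᴹ ≈ᴹ 0ᴹ
  linearMap-0 (p₁ , p₂) (q₁ , q₂) = vanish p₁ q₁ , vanish p₂ q₂
    where
    vanish : ∀ p q → 0# * fromℤ p + 0# * fromℤ q ≈ 0#
    vanish p q = trans (+-cong (zeroˡ _) (zeroˡ _)) (+-identityˡ 0#)

  Zon-linearMap : ∀ p q L {x} → Zon L x → Zon (map ⟦ p , q ⟧ L) (linearMap p q x)
  Zon-linearMap p q []      eq = ≈ᴹ-trans (linearMap-cong p q eq) (linearMap-0 p q)
  Zon-linearMap p q (u ∷ L) (c , y , b , y∈ , eq) =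
    c , linearMap p q y , b , Zon-linearMap p q L y∈ , ≈ᴹ-trans (linearMap-cong p q eq) (linearMap-cons p q c u y)

  Zon-linearMap⁻ : ∀ p q L {x} → Zon (map ⟦ p , q ⟧ L) x → ∃[ y ] (Zon L y × x ≈ᴹ linearMap p q y)
  Zon-linearMap⁻ p q []      eq = 0ᴹ , ≈ᴹ-refl , ≈ᴹ-trans eq (≈ᴹ-sym (linearMap-0 p q))
  Zon-linearMap⁻ p q (u ∷ L) (c , y , b , y∈ , eq) =
    let z , z∈ , eq′ = Zon-linearMap⁻ p q L y∈ in
    _ , (c , z , b , z∈ , ≈ᴹ-refl) ,
    ≈ᴹ-trans eq (≈ᴹ-trans (+ᴹ-cong ≈ᴹ-refl eq′) (≈ᴹ-sym (linearMap-cons p q c u z)))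

  module _ {C : Pred ℝ² 0ℓ} {n} {u : Vector ℤ² n} {t} (C≐ : C ≐ image (_+ᴹ fromℤ² t) (zonotope u)) where

    ∈C : ∀ {M} (e : tabulate u ≃ M) → ∀ {y} → Zon M y → C (y +ᴹ fromℤ² (_≃_.t e ⊕ t))
    ∈C (translation s from to) {y} y∈ = proj₂ C≐ (_ , Zon⇒zonotope u (from y∈) , ≈ᴹ-sym (+ᴹ-⊕ y s t))

    C∋ : ∀ {M} (e : tabulate u ≃ M) → ∀ {x} → C x → ∃[ y ] (Zon M y × x ≈ᴹ y +ᴹ fromℤ² (_≃_.t e ⊕ t))
    C∋ (translation s from to) x∈ with proj₁ C≐ x∈
    ... | y , y∈ , eq with to (zonotope⇒Zon u y∈)
    ... | z , z∈ , eq′ = z , z∈ , ≈ᴹ-trans eq (≈ᴹ-trans (+ᴹ-cong eq′ ≈ᴹ-refl) (+ᴹ-⊕ z s t))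

    unimodularlyEquivalent : ∀ {m} {v : Vector ℤ² m} p q → area p q ≡ 1 → tabulate u ≃ map ⟦ p , q ⟧ (tabulate v) →
                             UnimodularlyEquivalent C (zonotope v)
    unimodularlyEquivalent {v = v} p q pq e = p , q , s , pq ,
      (λ x∈ → let y , y∈ , eq = C∋ e x∈ ; z , z∈ , eq′ = Zon-linearMap⁻ p q (tabulate v) y∈ in
        z , Zon⇒zonotope v z∈ , ≈ᴹ-trans eq (+ᴹ-cong eq′ ≈ᴹ-refl)) ,
      λ (y , y∈ , eq) → respects (≈ᴹ-sym eq) (∈C e (Zon-linearMap p q (tabulate v) (zonotope⇒Zon v y∈)))
      where
      s = _≃_.t e ⊕ t
      respects : ∀ {x y} → x ≈ᴹ y → C x → C y
      respects x≈y x∈ = let z , z∈ , eq = proj₁ C≐ x∈ in proj₂ C≐ (z , z∈ , ≈ᴹ-trans (≈ᴹ-sym x≈y) eq)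

  ¬TwoDimensional : ∀ {C : Pred ℝ² 0ℓ} w t → (∀ {x} → C x → ∃[ c ] x ≈ᴹ (c *ₗ w) +ᴹ t) → ¬ TwoDimensional C
  ¬TwoDimensional (w₁ , w₂) (t₁ , t₂) line (x , y , z , x∈ , y∈ , z∈ , independent)
    with line x∈ | line y∈ | line z∈
  ... | a , (x₁ , x₂) | b , (y₁ , y₂) | c , (z₁ , z₂) = independent (begin
    (proj₁ y - proj₁ x) * (proj₂ z - proj₂ x)
      ≈⟨ *-cong (+-cong y₁ (-‿cong x₁)) (+-cong z₂ (-‿cong x₂)) ⟩
    (b * w₁ + t₁ - (a * w₁ + t₁)) * (c * w₂ + t₂ - (a * w₂ + t₂))
      ≈⟨ solve 7 (λ a b c v w s t → (b :* v :+ s :- (a :* v :+ s)) :* (c :* w :+ t :- (a :* w :+ t))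
            := (b :* w :+ t :- (a :* w :+ t)) :* (c :* v :+ s :- (a :* v :+ s))) refl a b c w₁ w₂ t₁ t₂ ⟩
    (b * w₂ + t₂ - (a * w₂ + t₂)) * (c * w₁ + t₁ - (a * w₁ + t₁))
      ≈⟨ *-cong (+-cong y₂ (-‿cong x₂)) (+-cong z₁ (-‿cong x₁)) ⟨
    (proj₂ y - proj₂ x) * (proj₁ z - proj₁ x) ∎)

  -- For σ = -1 the first generator is reversed, at the cost of a translation.
  normalForm-≃ : ∀ {u v} (N : NormalForm u v) → u ∷ v ∷ [] ≃
                 map ⟦ NormalForm.p N , NormalForm.q N ⟧ (e₁ ∷ (+ NormalForm.r N , + NormalForm.n N) ∷ [])
  normalForm-≃ {u} {v} N = ≡.subst (λ v → u ∷ v ∷ [] ≃ map ⟦ p , q ⟧ (e₁ ∷ (+ r , + n) ∷ [])) (≡.sym v-eq) (bySign (∣i∣≡1⇒i≡±1 σ ∣σ∣≡1))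
    where
    open NormalForm N
    w = ⟦ p , q ⟧ (+ r , + n)
    bySign : σ ≡ + 1 ⊎ σ ≡ -[1+ 0 ] → u ∷ w ∷ [] ≃ ⟦ p , q ⟧ e₁ ∷ w ∷ []
    bySign (inj₁ σ≡1)  = ≡.subst (λ x → x ∷ w ∷ [] ≃ ⟦ p , q ⟧ e₁ ∷ w ∷ [])
      (≡.trans (≡.cong (λ σ → ⟦ p , q ⟧ (σ , + 0)) (≡.sym σ≡1)) (≡.sym u-eq)) ≃-refl
    bySign (inj₂ σ≡-1) = ≡.subst (λ x → x ∷ w ∷ [] ≃ ⟦ p , q ⟧ e₁ ∷ w ∷ [])
      (≡.trans (≡.sym (⟦⟧-• p q -[1+ 0 ] e₁)) (≡.trans (≡.cong (λ σ → ⟦ p , q ⟧ (σ , + 0)) (≡.sym σ≡-1)) (≡.sym u-eq)))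
      (≃-negate (⟦ p , q ⟧ e₁))

  parallelogram-width : ∀ p k → suc p ≤ℕ k → (∀ i j → k ≤ℕ p ℕ.* i ℕ.+ j → suc p ≤ℕ i ℕ.+ (j ℕ.+ 0)) →
                        IsLatticeWidth (zonotope ⟪ e₁ , (+ p , + k) ⟫) (fromℤ (+ suc p))
  parallelogram-width p k p<k bound = isLatticeWidth ⟪ e₁ , (+ p , + k) ⟫ (suc p) e₁ (λ ()) (width-e₁ p k)
      (parallelogramWidth≥ p k (suc p) ℕₚ.≤-refl bound)

  width-1 : ∀ k → 1 ≤ℕ k → IsLatticeWidth (zonotope ⟪ e₁ , (+ 0 , + k) ⟫) (fromℤ (+ 1))
  width-1 k k≥1 = parallelogram-width 0 k k≥1 λ i j k≤j →
    ℕₚ.≤-trans (ℕₚ.≤-trans k≥1 k≤j) (ℕₚ.≤-trans (ℕₚ.m≤m+n j 0) (ℕₚ.m≤n+m (j ℕ.+ 0) i))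

  width-2 : ∀ k → 2 ≤ℕ k → IsLatticeWidth (parallelogram (+ 1) (+ k)) (fromℤ (+ 2))
  width-2 k k≥2 = parallelogram-width 1 k k≥2 λ i j k≤i+j →
    ℕₚ.≤-trans (ℕₚ.≤-trans k≥2 k≤i+j) (ℕₚ.≤-reflexive (≡.cong₂ ℕ._+_ (ℕₚ.+-identityʳ i) (≡.sym (ℕₚ.+-identityʳ j))))

  width-3 : IsLatticeWidth (parallelogram (+ 2) (+ 5)) (fromℤ (+ 3))
  width-3 = parallelogram-width 2 5 (ℕₚ.≤ᵇ⇒≤ 3 5 _) λ i j 5≤ → bound i j 5≤ (3 ℕ.≤? i ℕ.+ (j ℕ.+ 0))
    where
    bound : ∀ i j → 5 ≤ℕ 2 ℕ.* i ℕ.+ j → Dec (3 ≤ℕ i ℕ.+ (j ℕ.+ 0)) → 3 ≤ℕ i ℕ.+ (j ℕ.+ 0)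
    bound i j 5≤ (yes h) = h
    -- If i + j ≤ 2, then 2 i + j ≤ 4, against 5 ≤ 2 i + j.
    bound i j 5≤ (no  h) = contradiction (ℕₚ.≤-trans 5≤ (ℕₚ.≤-trans (ℕₚ.m≤m+n _ j)
        (ℕₚ.≤-trans (ℕₚ.≤-reflexive (arith i j)) (ℕₚ.*-monoʳ-≤ 2 (ℕₚ.≤-pred (ℕₚ.≰⇒> h)))))) λ { (s≤s (s≤s (s≤s (s≤s ())))) }
      where
      arith : ∀ i j → 2 ℕ.* i ℕ.+ j ℕ.+ j ≡ 2 ℕ.* (i ℕ.+ (j ℕ.+ 0))
      arith = solve-∀

  width-hexagon : ∀ u v w → 1 ≤ℕ area u v → 1 ≤ℕ area u w → 1 ≤ℕ area v w → TwoUnit u v w →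
                  IsLatticeWidth (zonotope (u Vector.∷ v Vector.∷ w Vector.∷ Vector.[])) (fromℤ (+ 2))
  width-hexagon u v w uv≥1 uw≥1 vw≥1 two =
    let z , z≢0 , eq = narrowDirection u v w two in
    isLatticeWidth (u Vector.∷ v Vector.∷ w Vector.∷ Vector.[]) 2 z z≢0 eq (hexagonWidth≥2 u v w uv≥1 uw≥1 vw≥1)

  Listed : Pred ℝ² 0ℓ → Set
  Listed C =
      (∃[ k ] (1 ≤ℕ k
              × UnimodularlyEquivalent C (zonotope ⟪ e₁ , (+ 0 , + k) ⟫)
              × IsLatticeWidth (zonotope ⟪ e₁ , (+ 0 , + k) ⟫) (fromℤ (+ 1))))
    ⊎ (∃[ k ] (2 ≤ℕ k
              × UnimodularlyEquivalent C (parallelogram (+ 1) (+ k))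
              × IsLatticeWidth (parallelogram (+ 1) (+ k)) (fromℤ (+ 2))
              × area e₁ (+ 1 , + k) ≡ k))
    ⊎ (∃[ u ] ∃[ k ] (1 ≤ℕ k
              × UnimodularlyEquivalent C (zonotope {3} u)
              × IsLatticeWidth (zonotope {3} u) (fromℤ (+ 2))
              × volumeVector u ↭ (1 ∷ 1 ∷ k ∷ [])))
    ⊎ (UnimodularlyEquivalent C (parallelogram (+ 2) (+ 5))
              × IsLatticeWidth (parallelogram (+ 2) (+ 5)) (fromℤ (+ 3))
              × area e₁ (+ 2 , + 5) ≡ 5)

  classification : (C : Pred ℝ² 0ℓ) → IsLattice2Zonotope C → (μ : ℝ) → IsCoveringRadius C μ → ½ < μ → Listed C
  classification C (twoDimensional , n , u , t , C≐) μ radius (½≤μ , ½≉μ) =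
    list (outcome items independent) equivalent
    where
    open Reduction (reduce (λ _ → 0#) u)
    list : ∀ {L} → Outcome L → tabulate u ≃ L → Listed C
    list (slab s) e = ⊥-elim (½≉μ (antisym ½≤μ (slab⇒μ≤½ {C} (_≃_.t e ⊕ t) (∈C {C} {n} {u} {t} C≐ e) s radius)))
    list empty e = ⊥-elim (¬TwoDimensional {C} 0ᴹ (fromℤ² (_≃_.t e ⊕ t)) line twoDimensional)
      where
      line : ∀ {x} → C x → ∃[ c ] x ≈ᴹ (c *ₗ 0ᴹ) +ᴹ fromℤ² (_≃_.t e ⊕ t)
      line x∈ = let y , y≈0 , eq = C∋ {C} {n} {u} {t} C≐ e x∈ in
        0# , ≈ᴹ-trans eq (+ᴹ-cong (≈ᴹ-trans y≈0 (sym (zeroˡ 0#) , sym (zeroˡ 0#))) ≈ᴹ-refl)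
    list (single {w}) e = ⊥-elim (¬TwoDimensional {C} (fromℤ² w) (fromℤ² (_≃_.t e ⊕ t)) line twoDimensional)
      where
      line : ∀ {x} → C x → ∃[ c ] x ≈ᴹ (c *ₗ fromℤ² w) +ᴹ fromℤ² (_≃_.t e ⊕ t)
      line x∈ = let y , (c , z , _ , z≈0 , eq′) , eq = C∋ {C} {n} {u} {t} C≐ e x∈ in
        c , ≈ᴹ-trans eq (+ᴹ-cong (≈ᴹ-trans eq′ (≈ᴹ-trans (+ᴹ-cong ≈ᴹ-refl z≈0) (+-identityʳ _ , +-identityʳ _))) ≈ᴹ-refl)
    list (pair perm N exceptional) e = shape exceptional
        (unimodularlyEquivalent {C} {n} {u} {t} C≐ {v = ⟪ e₁ , (+ r , + n′) ⟫} p q unimodular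
          (≃-trans e (≃-trans (≃-↭ perm) (normalForm-≃ N))))
      where
      open NormalForm N renaming (n to n′)
      shape : ∀ {r n} → Exceptional r n → UnimodularlyEquivalent C (zonotope ⟪ e₁ , (+ r , + n) ⟫) → Listed C
      shape (width-one {k} k≥1) equiv = inj₁ (k , k≥1 , equiv , width-1 k k≥1)
      shape (width-two {k} k≥2) equiv = inj₂ (inj₁ (k , k≥2 , equiv , width-2 k k≥2 , area-e₁ (+ 1) k))
      shape width-three         equiv = inj₂ (inj₂ (inj₂ (equiv , width-3 , ≡.refl)))
    -- The list prescribes only the volume vector, so the generators themselves represent the
    -- hexagon, with the identity matrix and a translation as the equivalence.
    list (triple {x} {y} {z} xy xz yz two) e = inj₂ (inj₂ (inj₁ (v , proj₁ vol , proj₁ (proj₂ vol) ,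
        unimodularlyEquivalent {C} {n} {u} {t} C≐ {v = v} (+ 1 , + 0) (+ 0 , + 1) ≡.refl
          (≡.subst (λ L → tabulate u ≃ L) (≡.sym standard) e) ,
        width-hexagon x y z xy xz yz two , proj₂ (proj₂ vol))))
      where
      v = x Vector.∷ y Vector.∷ z Vector.∷ Vector.[]
      vol = volumes x y z xy xz yz two
      standard : map ⟦ (+ 1 , + 0) , (+ 0 , + 1) ⟧ (x ∷ y ∷ z ∷ []) ≡ x ∷ y ∷ z ∷ []
      standard = ≡.cong₂ _∷_ (⟦⟧-standard x) (≡.cong₂ _∷_ (⟦⟧-standard y) (≡.cong (_∷ []) (⟦⟧-standard z)))

  -- Linear dependences of cosimple collections

  weightedDet : ℤ² → List Item → ℝ
  weightedDet u []            = 0#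
  weightedDet u ((a , r) ∷ I) = a * fromℤ (det u (vector r)) + weightedDet u I

  dot-0 : ∀ z → ⟨ z ∙ 0ᴹ ⟩ ≈ 0#
  dot-0 z = trans (+-cong (zeroʳ _) (zeroʳ _)) (+-identityˡ 0#)

  dot-weightedSum : ∀ u I → ⟨ rotate u ∙ weightedSum I ⟩ ≈ weightedDet u I
  dot-weightedSum u []            = dot-0 (rotate u)
  dot-weightedSum u ((a , r) ∷ I) = trans (dot-linear (rotate u) a (vector r) (weightedSum I))
    (+-cong (*-congˡ (reflexive (≡.cong fromℤ (dot-rotate u (vector r))))) (dot-weightedSum u I))

  -- Choosing u among the generators eliminates its own term from the dependence, since its
  -- determinant with itself is 0.
  dependent : ∀ u I → weightedSum I ≈ᴹ 0ᴹ → weightedDet u I ≈ 0#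
  dependent u I eq = trans (sym (dot-weightedSum u I)) (trans (dot-cong (rotate u) eq) (dot-0 (rotate u)))

  det≉0 : ∀ u v → 1 ≤ℕ area u v → ¬ (fromℤ (det u v) ≈ 0#)
  det≉0 u v uv≥1 = fromℤ≉0 (det u v) λ eq → contradiction (≡.subst (1 ≤ℕ_) (≡.cong ℤ.∣_∣ eq) uv≥1) λ ()

  *-zeroFactor : ∀ a d → ¬ (d ≈ 0#) → a * d ≈ 0# → a ≈ 0#
  *-zeroFactor a d d≉0 eq = *-cancelˡ d d≉0 (trans (*-comm d a) (trans eq (sym (zeroʳ d))))

  ∣-∣-opposite : ∀ {b c} → b + c ≈ 0# → ∣ b ∣ ≈ ∣ c ∣
  ∣-∣-opposite {b} {c} eq = trans (⊔-cong b≈-c (-‿cong b≈-c)) (trans (⊔-cong refl (-‿involutive c)) (⊔-comm (- c) c))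
    where
    b≈-c : b ≈ - c
    b≈-c = trans (solve 2 (λ b c → b := (b :+ c) :- c) refl b c) (trans (+-congʳ eq) (+-identityˡ (- c)))

  ∣-∣-equal : ∀ {b c} → b - c ≈ 0# → ∣ b ∣ ≈ ∣ c ∣
  ∣-∣-equal {b} {c} eq = ⊔-cong b≈c (-‿cong b≈c)
    where
    b≈c : b ≈ c
    b≈c = trans (solve 2 (λ b c → b := (b :- c) :+ c) refl b c) (trans (+-congʳ eq) (+-identityˡ c))

  equalMagnitudes : ∀ b c i j → ℤ.∣ i ∣ ≡ 1 → ℤ.∣ j ∣ ≡ 1 → b * fromℤ i + c * fromℤ j ≈ 0# → ∣ b ∣ ≈ ∣ c ∣
  equalMagnitudes b c i j i≡ j≡ = cases i j (∣i∣≡1⇒i≡±1 i i≡) (∣i∣≡1⇒i≡±1 j j≡)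
    where
    flip : ∀ {x y} → x ≈ - y → y ≈ 0# → x ≈ 0#
    flip eq y≈0 = trans eq (trans (-‿cong y≈0) -0#≈0#)
    cases : ∀ i j → i ≡ + 1 ⊎ i ≡ -[1+ 0 ] → j ≡ + 1 ⊎ j ≡ -[1+ 0 ] → b * fromℤ i + c * fromℤ j ≈ 0# → ∣ b ∣ ≈ ∣ c ∣
    cases _ _ (inj₁ ≡.refl) (inj₁ ≡.refl) eq = ∣-∣-opposite (trans
      (solve 2 (λ b c → b :+ c := b :* con (+ 1) :+ c :* con (+ 1)) refl b c) eq)
    cases _ _ (inj₁ ≡.refl) (inj₂ ≡.refl) eq = ∣-∣-equal (trans
      (solve 2 (λ b c → b :- c := b :* con (+ 1) :+ c :* con -[1+ 0 ]) refl b c) eq)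
    cases _ _ (inj₂ ≡.refl) (inj₁ ≡.refl) eq = ∣-∣-equal (flip
      (solve 2 (λ b c → b :- c := :- (b :* con -[1+ 0 ] :+ c :* con (+ 1))) refl b c) eq)
    cases _ _ (inj₂ ≡.refl) (inj₂ ≡.refl) eq = ∣-∣-opposite (flip
      (solve 2 (λ b c → b :+ c := :- (b :* con -[1+ 0 ] :+ c :* con -[1+ 0 ])) refl b c) eq)

  fromℤ-det-self : ∀ u → fromℤ (det u u) ≈ 0#
  fromℤ-det-self u = reflexive (≡.cong fromℤ (det-self u))

  -- Taking determinants with the shared generator reduces the dependence to ± b ± c = 0.
  equalMagnitudesOfTriple : ∀ a r b s c t → weightedSum ((a , r) ∷ (b , s) ∷ (c , t) ∷ []) ≈ᴹ 0ᴹ →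
    area (vector r) (vector s) ≡ 1 → area (vector r) (vector t) ≡ 1 → ∣ b ∣ ≈ ∣ c ∣
  equalMagnitudesOfTriple a r b s c t eq rs rt = equalMagnitudes b c (det (vector r) (vector s)) (det (vector r) (vector t)) rs rt (begin
    b * fromℤ (det u (vector s)) + c * fromℤ (det u (vector t))
      ≈⟨ trans (+-cong (trans (*-congˡ (fromℤ-det-self u)) (zeroʳ a)) (+-congˡ (+-identityʳ _))) (+-identityˡ _) ⟨
    weightedDet u ((a , r) ∷ (b , s) ∷ (c , t) ∷ [])
      ≈⟨ dependent u ((a , r) ∷ (b , s) ∷ (c , t) ∷ []) eq ⟩
    0# ∎)
    where u = vector r

  weightedSum-↭ : ∀ {I J} → I ↭ J → weightedSum I ≈ᴹ weightedSum J
  weightedSum-↭ Perm.refl        = ≈ᴹ-refl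
  weightedSum-↭ (prep _ p)       = +ᴹ-cong ≈ᴹ-refl (weightedSum-↭ p)
  weightedSum-↭ (swap _ _ p)     = ≈ᴹ-trans (exchange _ _ _ , exchange _ _ _)
    (+ᴹ-cong ≈ᴹ-refl (+ᴹ-cong ≈ᴹ-refl (weightedSum-↭ p)))
  weightedSum-↭ (Perm.trans p q) = ≈ᴹ-trans (weightedSum-↭ p) (weightedSum-↭ q)

  -- Two independent rays have both coefficients 0, so `NonzeroItem` makes both excesses positive
  -- and `slabOfPair` applies. For three rays, a unit area forces excess zero on both of its rays,
  -- which is the premise under which `ApartItems` contradicts the equal magnitudes.
  cosimple⇒slab : ∀ I → AllPairs IndependentItems I → (∀ x → Span (vectors I) x) → weightedSum I ≈ᴹ 0ᴹ →
                  All NonzeroItem I → AllPairs ApartItems I → Slab (vectors I)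
  cosimple⇒slab [] _ span _ _ _ = ⊥-elim (1≉0 (proj₁ (span (1# , 0#))))
  cosimple⇒slab ((_ , r) ∷ []) _ span _ _ _ = ⊥-elim (onLine (span (1# , 0#)) (span (0# , 1#)))
    where
    onLine : Span (vector r ∷ []) (1# , 0#) → Span (vector r ∷ []) (0# , 1#) → ⊥
    -- If both standard basis vectors were multiples of one vector, their determinant 1 would
    -- vanish.
    onLine (a , y , (y₁ , y₂) , (p₁ , p₂)) (b , z , (z₁ , z₂) , (q₁ , q₂)) = 1≉0 (begin
      1#                           ≈⟨ *-identityˡ 1# ⟨
      1# * 1#                      ≈⟨ *-cong (drop p₁ y₁) (drop q₂ z₂) ⟩
      (a * v₁) * (b * v₂)          ≈⟨ solve 4 (λ a b v w → (a :* v) :* (b :* w) := (a :* w) :* (b :* v)) refl a b v₁ v₂ ⟩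
      (a * v₂) * (b * v₁)          ≈⟨ *-congʳ (drop p₂ y₂) ⟨
      0# * (b * v₁)                ≈⟨ zeroˡ _ ⟩
      0#                           ∎)
      where
      v₁ = fromℤ (proj₁ (vector r))
      v₂ = fromℤ (proj₂ (vector r))
      drop : ∀ {x c y} → x ≈ c + y → y ≈ 0# → x ≈ c
      drop p y≈0 = trans p (trans (+-congˡ y≈0) (+-identityʳ _))
  cosimple⇒slab ((a , r) ∷ (b , s) ∷ []) ((rs ∷ []) ∷ _) _ eq (a≉0 ∷ b≉0 ∷ []) _ =
    cases (zeroOrPositive (excess r)) (zeroOrPositive (excess s))
    where
    u = vector r
    v = vector s
    rs′ = independent-area r s rs
    b≈0 : b ≈ 0#
    b≈0 = *-zeroFactor b (fromℤ (det u v)) (det≉0 u v rs′) (trans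
      (sym (trans (+-cong (trans (*-congˡ (fromℤ-det-self u)) (zeroʳ a)) (+-identityʳ _)) (+-identityˡ _)))
      (dependent u ((a , r) ∷ (b , s) ∷ []) eq))
    a≈0 : a ≈ 0#
    a≈0 = *-zeroFactor a (fromℤ (det v u)) (det≉0 v u (≡.subst (1 ≤ℕ_) (≡.sym (area-swap u v)) rs′)) (trans
      (sym (trans (+-congˡ (trans (+-identityʳ _) (trans (*-congˡ (fromℤ-det-self v)) (zeroʳ b)))) (+-identityʳ _)))
      (dependent v ((a , r) ∷ (b , s) ∷ []) eq))
    cases : excess r ≡ 0 ⊎ 1 ≤ℕ excess r → excess s ≡ 0 ⊎ 1 ≤ℕ excess s → Slab (u ∷ v ∷ [])
    cases (inj₁ r≡0) _          = ⊥-elim (a≉0 r≡0 a≈0)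
    cases (inj₂ _)   (inj₁ s≡0) = ⊥-elim (b≉0 s≡0 b≈0)
    cases (inj₂ r≥1) (inj₂ s≥1) = slabOfPair r s r≥1 s≥1 rs
  cosimple⇒slab ((a , r) ∷ (b , s) ∷ (c , t) ∷ []) ((rs ∷ rt ∷ []) ∷ (st ∷ []) ∷ _) _ eq _ ((ab ∷ ac ∷ []) ∷ (bc ∷ []) ∷ _) =
    cases (hexagon r s t rs rt st)
    where
    x = (a , r)
    y = (b , s)
    z = (c , t)
    reorder : ∀ {I} → I ↭ x ∷ y ∷ z ∷ [] → weightedSum I ≈ᴹ 0ᴹ
    reorder p = ≈ᴹ-trans (weightedSum-↭ p) eq
    sr : area (vector r) (vector s) ≡ 1 → area (vector s) (vector r) ≡ 1
    sr = ≡.trans (area-swap (vector r) (vector s))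
    tr : area (vector r) (vector t) ≡ 1 → area (vector t) (vector r) ≡ 1
    tr = ≡.trans (area-swap (vector r) (vector t))
    ts : area (vector s) (vector t) ≡ 1 → area (vector t) (vector s) ≡ 1
    ts = ≡.trans (area-swap (vector s) (vector t))
    cases : Hexagon (vector r) (vector s) (vector t) → Slab (vector r ∷ vector s ∷ vector t ∷ [])
    cases (inj₁ l) = l
    cases (inj₂ (inj₁ (rs , rt))) = ⊥-elim (bc (proj₂ (excessOfUnit r s rs)) (proj₂ (excessOfUnit r t rt))
      (equalMagnitudesOfTriple a r b s c t eq rs rt))
    cases (inj₂ (inj₂ (inj₁ (rs , st)))) = ⊥-elim (ac (proj₁ (excessOfUnit r s rs)) (proj₂ (excessOfUnit s t st))
      (equalMagnitudesOfTriple b s a r c t (reorder (swap y x ↭-refl)) (sr rs) st))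
    cases (inj₂ (inj₂ (inj₂ (rt , st)))) = ⊥-elim (ab (proj₁ (excessOfUnit r t rt)) (proj₁ (excessOfUnit s t st))
      (equalMagnitudesOfTriple c t a r b s (reorder (↭-trans (swap z x ↭-refl) (prep x (swap z y ↭-refl)))) (tr rt) (ts st)))
  cosimple⇒slab ((_ , r) ∷ (_ , s) ∷ (_ , t) ∷ (_ , q) ∷ I) ((rs ∷ rt ∷ rq ∷ _) ∷ (st ∷ sq ∷ _) ∷ (tq ∷ _) ∷ _) _ _ _ _ =
    slab-++ (vectors I) (slabOfFour r s t q rs rt rq st sq tq)

  cosimple⇒μ≤½ : (n : ℕ) (u : Vector ℤ² n) → Cosimple u → (μ : ℝ) → IsCoveringRadius (zonotope u) μ → μ ≤ ½
  cosimple⇒μ≤½ n u (spans , c , c-eq , c≉0 , c-apart) μ radius =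
    slab⇒μ≤½ {zonotope u} (_≃_.t equivalent) (λ y∈ → Zon⇒zonotope u (_≃_.from equivalent y∈))
      (cosimple⇒slab items independent
        (λ x → let d , eq = spans x in Span-resp (vectors items) (≈ᴹ-sym eq) (spanning d))
        (≈ᴹ-trans weightedSum-eq c-eq) (nonzero c≉0) (apart c-apart))
      radius
    where
    open Reduction (reduce c u)

theorem6p3 : (𝓡 : RealNumbers) → let open Geometry 𝓡 in
    ((C : Pred ℝ² 0ℓ) → IsLattice2Zonotope C →
    (μ : ℝ) → IsCoveringRadius C μ → ½ < μ →
    (∃[ k ] (1 ≤ℕ k
    × UnimodularlyEquivalent C (zonotope ⟪ e₁ , (+ 0 , + k) ⟫)
    × IsLatticeWidth (zonotope ⟪ e₁ , (+ 0 , + k) ⟫) (fromℤ (+ 1))))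
    ⊎ (∃[ k ] (2 ≤ℕ k
    × UnimodularlyEquivalent C (parallelogram (+ 1) (+ k))
    × IsLatticeWidth (parallelogram (+ 1) (+ k)) (fromℤ (+ 2))
    × area e₁ (+ 1 , + k) ≡ k))
    ⊎ (∃[ u ] ∃[ k ] (1 ≤ℕ k
    × UnimodularlyEquivalent C (zonotope {3} u)
    × IsLatticeWidth (zonotope {3} u) (fromℤ (+ 2))
    × volumeVector u ↭ (1 ∷ 1 ∷ k ∷ [])))
    ⊎ (UnimodularlyEquivalent C (parallelogram (+ 2) (+ 5))
    × IsLatticeWidth (parallelogram (+ 2) (+ 5)) (fromℤ (+ 3))
    × area e₁ (+ 2 , + 5) ≡ 5))
    ×
    ((n : ℕ) (u : Vector ℤ² n) → Cosimple u →
    (μ : ℝ) → IsCoveringRadius (zonotope u) μ → μ ≤ ½)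
theorem6p3 𝓡 = Plane.classification 𝓡 , Plane.cosimple⇒μ≤½ 𝓡
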